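{- Let $m\ge2$ and let $\mathcal{H}\in\mathcal{P}(\mathcal{H})$ be a connected tricyclic Type I ($m$-uniform linear) hypergraph with $k$ edges such that $\mathcal{H}\ne T_1C(k-5,0,0,0)$. Then $\lambda_1(\mathcal{H})\le\lambda_1(T_1C(k-6,0,1,0))$, and equality holds only when $\mathcal{H}=T_1C(k-6,0,1,0)$.
   Context: A hypergraph has a finite vertex set and an edge set of non-empty subsets of the vertex set; it is $m$-uniform if all edges have cardinality $m$, and linear if two distinct edges share at most one vertex. The adjacency matrix of a linear $m$-uniform hypergraph has $(i,j)$ entry $\frac{1}{m-1}$ if $i\ne j$ lie in a common edge, and $0$ otherwise; $\lambda_1$ denotes the spectral radius of this matrix. The $m$-th power hypergraph of a graph $G(V,E)$ is the $m$-uniform hypergraph obtained by adding to each edge $e\in E$ $m-2$ new vertices $v_{e,1},\dots,v_{e,m-2}$ (distinct for distinct edges). $\mathcal{P}(\mathcal{H})$ denotes the set of $m$-th power hypergraphs of graphs (a fixed notation for the set, not depending on the particular hypergraph $\mathcal{H}$). A loose cycle of length $l\ge3$, $v_1e_1v_2e_2\dots v_le_lv_1$, is the $m$-uniform hypergraph with edges $e_1,\dots,e_l$ in which $e_{i-1}\cap e_i=\{v_i\}$ (indices mod $l$, the $v_i$ distinct) and non-consecutive edges are disjoint. A linear hypergraph is tricyclic ($3$-cyclic) if it contains exactly three loose cycles. An $m$-uniform $3$-cyclic linear hypergraph with $n$ vertices and $k$ edges is of Type I if $n=k(m-1)-1$. Attaching a pendant edge at a vertex $v$ means adding a new edge consisting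 of $v$ and $m-1$ new vertices. $T_1C(l_1,l_2,l_3,l_4)$ is the hypergraph consisting of the five edges $e_1,\dots,e_5$ forming the three loose cycles $v_1e_1v_2e_2v_3e_3v_1$, $v_1e_3v_3e_4v_4e_5v_1$ and $v_1e_1v_2e_2v_3e_4v_4e_5v_1$, together with $l_1,l_2,l_3,l_4$ pendant edges attached at $v_1,v_2,v_3,v_4$, respectively. Equality of hypergraphs means isomorphism. -}

module Defs where

open import Data.Bool.Base using (if_then_else_)
open import Data.Fin.Base using (Fin; zero; suc; toℕ; _↑ˡ_; quotient)
open import Data.Fin.Patterns using (0F; 1F; 2F; 3F; 4F)
open import Data.Fin.Properties using (_≟_; all?; any?)
open import Data.Fin.Subset using (Subset; _∈_; _∩_; _∪_; ⁅_⁆; ⊤; ⊥; ∣_∣; Nonempty; Empty)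
open import Data.Fin.Subset.Properties using (_∈?_; x∈⁅x⁆)
open import Data.Integer.Base using (+_)
open import Data.List.Base using (List; []; _∷_; replicate) renaming (_++_ to _++ˡ_)
open import Data.Nat.Base as ℕ using (ℕ; suc; _∸_; NonZero; NonTrivial)
open import Data.Nat.DivMod using (_mod_)
import Data.Nat.Properties as ℕ
open import Data.Product using (Σ; ∃-syntax; _×_; _,_)
open import Data.Rational.Base as ℚ using (ℚ; 0ℚ; 1ℚ; ½; _/_)
import Data.Rational.Properties as ℚ
open import Data.Rational.Solver using (module +-*-Solver)
open import Data.Vec.Base using (_++_; tabulate)
open import Data.Vec.Properties
  using (++-injectiveˡ; ++-injectiveʳ; []=⇒lookup; lookup⇒[]=; lookup-++ˡ; ≡-dec)
open import Data.Bool.Properties using () renaming (_≟_ to _≟ᵇ_)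
import Data.Vec.Functional as Vector
open import Function.Base using (_∘_)
open import Function.Bundles using (_↔_; _⇔_; Inverse)
open import Function.Definitions using (Injective)
open import Relation.Binary.Construct.Closure.ReflexiveTransitive using (Star)
open import Relation.Binary.PropositionalEquality
  using (_≡_; _≢_; refl; sym; trans; cong; subst)
open import Relation.Nullary
  using (¬_; Dec; does; contradiction; ¬?; _×-dec_; _→-dec_)
open import Relation.Nullary.Decidable using (from-yes)

------------------------------------------------------------------------
-- Real numbers, as Cauchy sequences of rationals

infix  4 _≈ℝ_ _≤ℝ_
infixl 6 _+ℝ_ _-ℝ_
infixl 7 _*ℝ_
infix  8 -ℝ_

Eventually : (ℕ → Set) → Set
Eventually P = ∃[ N ] ∀ n → N ℕ.≤ n → P n

IsCauchy : (ℕ → ℚ) → Set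
IsCauchy x = ∀ ε → 0ℚ ℚ.< ε →
  ∃[ N ] ∀ i j → N ℕ.≤ i → N ℕ.≤ j → ℚ.∣ x i ℚ.- x j ∣ ℚ.≤ ε

record ℝ : Set where
  constructor mkℝ
  field
    seq    : ℕ → ℚ
    cauchy : IsCauchy seq

open ℝ public

_≈ℝ_ : ℝ → ℝ → Set
x ≈ℝ y = ∀ ε → 0ℚ ℚ.< ε → Eventually λ n → ℚ.∣ seq x n ℚ.- seq y n ∣ ℚ.≤ ε

_≤ℝ_ : ℝ → ℝ → Set
x ≤ℝ y = ∀ ε → 0ℚ ℚ.< ε → Eventually λ n → seq x n ℚ.≤ seq y n ℚ.+ ε

fromℚ : ℚ → ℝ
fromℚ q = mkℝ (λ _ → q) λ ε ε>0 →
  0 , λ _ _ _ _ → subst (λ r → ℚ.∣ r ∣ ℚ.≤ ε) (sym (ℚ.+-inverseʳ q)) (ℚ.<⇒≤ ε>0)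

0ℝ : ℝ
0ℝ = fromℚ 0ℚ

private abstract
  ½-pos : ∀ {ε} → 0ℚ ℚ.< ε → 0ℚ ℚ.< ½ ℚ.* ε
  ½-pos {ε} ε>0 = subst (ℚ._< ½ ℚ.* ε) (ℚ.*-zeroʳ ½) (ℚ.*-monoʳ-<-pos ½ ε>0)

  ½-double : ∀ ε → ½ ℚ.* ε ℚ.+ ½ ℚ.* ε ≡ ε
  ½-double ε = trans (sym (ℚ.*-distribʳ-+ ε ½ ½)) (ℚ.*-identityˡ ε)

  +-cauchy : ∀ x y → IsCauchy x → IsCauchy y → IsCauchy (λ n → x n ℚ.+ y n)
  +-cauchy x y cx cy ε ε>0
    with cx (½ ℚ.* ε) (½-pos ε>0) | cy (½ ℚ.* ε) (½-pos ε>0)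
  ... | M , hx | N , hy = M ℕ.⊔ N , λ i j Ki Kj → begin
    ℚ.∣ (x i ℚ.+ y i) ℚ.- (x j ℚ.+ y j) ∣
      ≡⟨ cong ℚ.∣_∣ (interchange (x i) (y i) (x j) (y j)) ⟩
    ℚ.∣ (x i ℚ.- x j) ℚ.+ (y i ℚ.- y j) ∣
      ≤⟨ ℚ.∣p+q∣≤∣p∣+∣q∣ (x i ℚ.- x j) (y i ℚ.- y j) ⟩
    ℚ.∣ x i ℚ.- x j ∣ ℚ.+ ℚ.∣ y i ℚ.- y j ∣
      ≤⟨ ℚ.+-mono-≤
           (hx i j (ℕ.≤-trans (ℕ.m≤m⊔n M N) Ki) (ℕ.≤-trans (ℕ.m≤m⊔n M N) Kj))
           (hy i j (ℕ.≤-trans (ℕ.m≤n⊔m M N) Ki) (ℕ.≤-trans (ℕ.m≤n⊔m M N) Kj)) ⟩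
    ½ ℚ.* ε ℚ.+ ½ ℚ.* ε
      ≡⟨ ½-double ε ⟩
    ε ∎
    where
    open ℚ.≤-Reasoning
    interchange : ∀ a b c d →
      (a ℚ.+ b) ℚ.- (c ℚ.+ d) ≡ (a ℚ.- c) ℚ.+ (b ℚ.- d)
    interchange = solve 4 (λ a b c d →
      (a :+ b) :- (c :+ d) := (a :- c) :+ (b :- d)) refl
      where open +-*-Solver

  neg-cauchy : ∀ x → IsCauchy x → IsCauchy (λ n → ℚ.- x n)
  neg-cauchy x cx ε ε>0 with cx ε ε>0
  ... | N , hx = N , λ i j Ni Nj →
    subst (λ r → ℚ.∣ r ∣ ℚ.≤ ε) (swap (x i) (x j)) (hx j i Nj Ni)
    where
    swap : ∀ a b → b ℚ.- a ≡ (ℚ.- a) ℚ.- (ℚ.- b)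
    swap = solve 2 (λ a b → b :- a := (:- a) :- (:- b)) refl
      where open +-*-Solver

  bounded : ∀ x → IsCauchy x →
    ∃[ B ] 0ℚ ℚ.< B × Eventually λ n → ℚ.∣ x n ∣ ℚ.≤ B
  bounded x cx with cx 1ℚ (ℚ.positive⁻¹ 1ℚ)
  ... | N , h = B , B>0 , N , λ n N≤n → begin
    ℚ.∣ x n ∣                         ≡⟨ cong ℚ.∣_∣ (split (x n) (x N)) ⟩
    ℚ.∣ (x n ℚ.- x N) ℚ.+ x N ∣       ≤⟨ ℚ.∣p+q∣≤∣p∣+∣q∣ (x n ℚ.- x N) (x N) ⟩
    ℚ.∣ x n ℚ.- x N ∣ ℚ.+ ℚ.∣ x N ∣   ≤⟨ ℚ.+-monoˡ-≤ ℚ.∣ x N ∣ (h n N N≤n ℕ.≤-refl) ⟩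
    1ℚ ℚ.+ ℚ.∣ x N ∣                  ∎
    where
    open ℚ.≤-Reasoning
    B : ℚ
    B = 1ℚ ℚ.+ ℚ.∣ x N ∣
    B>0 : 0ℚ ℚ.< B
    B>0 = ℚ.<-≤-trans (ℚ.positive⁻¹ 1ℚ)
      (subst (ℚ._≤ B) (ℚ.+-identityʳ 1ℚ) (ℚ.+-monoʳ-≤ 1ℚ (ℚ.0≤∣p∣ (x N))))
    split : ∀ a b → a ≡ (a ℚ.- b) ℚ.+ b
    split = solve 2 (λ a b → a := (a :- b) :+ b) refl
      where open +-*-Solver

  *-mono-∣∣ : ∀ p q {B δ} → ℚ.∣ p ∣ ℚ.≤ B → ℚ.∣ q ∣ ℚ.≤ δ → ℚ.∣ p ℚ.* q ∣ ℚ.≤ B ℚ.* δ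
  *-mono-∣∣ p q {B} {δ} p≤ q≤ = begin
    ℚ.∣ p ℚ.* q ∣         ≡⟨ ℚ.∣p*q∣≡∣p∣*∣q∣ p q ⟩
    ℚ.∣ p ∣ ℚ.* ℚ.∣ q ∣   ≤⟨ ℚ.*-monoˡ-≤-nonNeg ℚ.∣ p ∣ {{ℚ.∣-∣-nonNeg p}} q≤ ⟩
    ℚ.∣ p ∣ ℚ.* δ         ≤⟨ ℚ.*-monoʳ-≤-nonNeg δ {{δ≥0}} p≤ ⟩
    B ℚ.* δ               ∎
    where
    open ℚ.≤-Reasoning
    δ≥0 : ℚ.NonNegative δ
    δ≥0 = ℚ.nonNegative (ℚ.≤-trans (ℚ.0≤∣p∣ q) q≤)

  rescale : ∀ D .{{_ : ℚ.Positive D}} ε → 0ℚ ℚ.< ε →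
    ∃[ δ ] 0ℚ ℚ.< δ × D ℚ.* δ ≡ ε
  rescale D ε ε>0 = ε ℚ.* 1/D , δ>0 , Dδ≡ε
    where
    instance
      D≢0 : ℚ.NonZero D
      D≢0 = ℚ.pos⇒nonZero D
    1/D : ℚ
    1/D = ℚ.1/ D
    δ>0 : 0ℚ ℚ.< ε ℚ.* 1/D
    δ>0 = subst (ℚ._< ε ℚ.* 1/D) (ℚ.*-zeroˡ 1/D)
      (ℚ.*-monoˡ-<-pos 1/D {{ℚ.1/pos⇒pos D}} ε>0)
    Dδ≡ε : D ℚ.* (ε ℚ.* 1/D) ≡ ε
    Dδ≡ε = trans (ℚ.*-comm D (ε ℚ.* 1/D)) (trans (ℚ.*-assoc ε 1/D D)
      (trans (cong (ε ℚ.*_) (ℚ.*-inverseˡ D)) (ℚ.*-identityʳ ε)))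

  *-split : ∀ a b c d →
    a ℚ.* b ℚ.- c ℚ.* d ≡ a ℚ.* (b ℚ.- d) ℚ.+ d ℚ.* (a ℚ.- c)
  *-split = solve 4 (λ a b c d →
    a :* b :- c :* d := a :* (b :- d) :+ d :* (a :- c)) refl
    where open +-*-Solver

  ∣ab-cd∣≤ : ∀ a b c d {B C δ} →
    ℚ.∣ a ∣ ℚ.≤ B → ℚ.∣ d ∣ ℚ.≤ C →
    ℚ.∣ b ℚ.- d ∣ ℚ.≤ δ → ℚ.∣ a ℚ.- c ∣ ℚ.≤ δ →
    ℚ.∣ a ℚ.* b ℚ.- c ℚ.* d ∣ ℚ.≤ (B ℚ.+ C) ℚ.* δ
  ∣ab-cd∣≤ a b c d {B} {C} {δ} a≤B d≤C bd≤δ ac≤δ = begin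
    ℚ.∣ a ℚ.* b ℚ.- c ℚ.* d ∣
      ≡⟨ cong ℚ.∣_∣ (*-split a b c d) ⟩
    ℚ.∣ a ℚ.* (b ℚ.- d) ℚ.+ d ℚ.* (a ℚ.- c) ∣
      ≤⟨ ℚ.∣p+q∣≤∣p∣+∣q∣ (a ℚ.* (b ℚ.- d)) (d ℚ.* (a ℚ.- c)) ⟩
    ℚ.∣ a ℚ.* (b ℚ.- d) ∣ ℚ.+ ℚ.∣ d ℚ.* (a ℚ.- c) ∣
      ≤⟨ ℚ.+-mono-≤ (*-mono-∣∣ a (b ℚ.- d) a≤B bd≤δ) (*-mono-∣∣ d (a ℚ.- c) d≤C ac≤δ) ⟩
    B ℚ.* δ ℚ.+ C ℚ.* δ
      ≡⟨ ℚ.*-distribʳ-+ δ B C ⟨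
    (B ℚ.+ C) ℚ.* δ ∎
    where open ℚ.≤-Reasoning

  *-cauchy : ∀ x y → IsCauchy x → IsCauchy y → IsCauchy (λ n → x n ℚ.* y n)
  *-cauchy x y cx cy ε ε>0 =
    let B , B>0 , K , hB = bounded x cx
        C , C>0 , L , hC = bounded y cy
        δ , δ>0 , eq     = rescale (B ℚ.+ C) {{ℚ.positive (ℚ.+-mono-< B>0 C>0)}} ε ε>0
        M , hx           = cx δ δ>0
        N , hy           = cy δ δ>0
    in (K ℕ.⊔ L) ℕ.⊔ (M ℕ.⊔ N) , λ i j Pi Pj →
      subst (ℚ.∣ x i ℚ.* y i ℚ.- x j ℚ.* y j ∣ ℚ.≤_) eq
        (∣ab-cd∣≤ (x i) (y i) (x j) (y j)
          (hB i (K≤ K L M N Pi)) (hC j (L≤ K L M N Pj))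
          (hy i j (N≤ K L M N Pi) (N≤ K L M N Pj))
          (hx i j (M≤ K L M N Pi) (M≤ K L M N Pj)))
    where
    K≤ : ∀ K L M N {n} → (K ℕ.⊔ L) ℕ.⊔ (M ℕ.⊔ N) ℕ.≤ n → K ℕ.≤ n
    K≤ K L M N = ℕ.m⊔n≤o⇒m≤o K L ∘ ℕ.m⊔n≤o⇒m≤o (K ℕ.⊔ L) (M ℕ.⊔ N)
    L≤ : ∀ K L M N {n} → (K ℕ.⊔ L) ℕ.⊔ (M ℕ.⊔ N) ℕ.≤ n → L ℕ.≤ n
    L≤ K L M N = ℕ.m⊔n≤o⇒n≤o K L ∘ ℕ.m⊔n≤o⇒m≤o (K ℕ.⊔ L) (M ℕ.⊔ N)
    M≤ : ∀ K L M N {n} → (K ℕ.⊔ L) ℕ.⊔ (M ℕ.⊔ N) ℕ.≤ n → M ℕ.≤ n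
    M≤ K L M N = ℕ.m⊔n≤o⇒m≤o M N ∘ ℕ.m⊔n≤o⇒n≤o (K ℕ.⊔ L) (M ℕ.⊔ N)
    N≤ : ∀ K L M N {n} → (K ℕ.⊔ L) ℕ.⊔ (M ℕ.⊔ N) ℕ.≤ n → N ℕ.≤ n
    N≤ K L M N = ℕ.m⊔n≤o⇒n≤o M N ∘ ℕ.m⊔n≤o⇒n≤o (K ℕ.⊔ L) (M ℕ.⊔ N)

_+ℝ_ : ℝ → ℝ → ℝ
x +ℝ y = mkℝ (λ n → seq x n ℚ.+ seq y n) (+-cauchy (seq x) (seq y) (cauchy x) (cauchy y))

-ℝ_ : ℝ → ℝ
-ℝ x = mkℝ (λ n → ℚ.- seq x n) (neg-cauchy (seq x) (cauchy x))

_-ℝ_ : ℝ → ℝ → ℝ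
x -ℝ y = x +ℝ (-ℝ y)

_*ℝ_ : ℝ → ℝ → ℝ
x *ℝ y = mkℝ (λ n → seq x n ℚ.* seq y n) (*-cauchy (seq x) (seq y) (cauchy x) (cauchy y))

------------------------------------------------------------------------
-- Complex numbers, eigenvalues and the spectral radius

infix  4 _≈ℂ_
infixl 6 _+ℂ_
infixl 7 _*ℂ_

record ℂ : Set where
  constructor _+i_
  field
    re im : ℝ

open ℂ public

_≈ℂ_ : ℂ → ℂ → Set
z ≈ℂ w = re z ≈ℝ re w × im z ≈ℝ im w

0ℂ : ℂ
0ℂ = 0ℝ +i 0ℝ

ℚ⇒ℂ : ℚ → ℂ
ℚ⇒ℂ q = fromℚ q +i 0ℝ

_+ℂ_ : ℂ → ℂ → ℂ
z +ℂ w = (re z +ℝ re w) +i (im z +ℝ im w)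

_*ℂ_ : ℂ → ℂ → ℂ
z *ℂ w = (re z *ℝ re w -ℝ im z *ℝ im w) +i (re z *ℝ im w +ℝ im z *ℝ re w)

∣_∣² : ℂ → ℝ
∣ z ∣² = re z *ℝ re z +ℝ im z *ℝ im z

Matrix : ℕ → Set
Matrix n = Fin n → Fin n → ℂ

∑ : ∀ {n} → (Fin n → ℂ) → ℂ
∑ = Vector.foldr _+ℂ_ 0ℂ

IsEigenvalue : ∀ {n} → Matrix n → ℂ → Set
IsEigenvalue {n} A μ = Σ (Fin n → ℂ) λ x →
  ¬ (∀ i → x i ≈ℂ 0ℂ) ×
  (∀ i → ∑ (λ j → A i j *ℂ x j) ≈ℂ μ *ℂ x i)

-- ρ is the largest modulus of an eigenvalue.  Moduli are compared through
-- their squares, which is the same because 0 ≤ ρ.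
IsSpectralRadius : ∀ {n} → Matrix n → ℝ → Set
IsSpectralRadius A ρ =
  0ℝ ≤ℝ ρ ×
  (∃[ μ ] IsEigenvalue A μ × ∣ μ ∣² ≈ℝ ρ *ℝ ρ) ×
  (∀ μ → IsEigenvalue A μ → ∣ μ ∣² ≤ℝ ρ *ℝ ρ)

------------------------------------------------------------------------
-- Hypergraphs

-- The edge set is given by an enumeration without repetitions; its order is
-- immaterial, since hypergraphs are only ever compared up to isomorphism.
record Hypergraph : Set where
  field
    order    : ℕ
    size     : ℕ
    edge     : Fin size → Subset order
    nonempty : ∀ e → Nonempty (edge e)
    distinct : Injective _≡_ _≡_ edge

open Hypergraph public

infix 4 _≅_

record _≅_ (H K : Hypergraph) : Set where
  field
    onVertices : Fin (order H) ↔ Fin (order K)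
    onEdges    : Fin (size H) ↔ Fin (size K)
    incidence  : ∀ v e →
      v ∈ edge H e ⇔ Inverse.to onVertices v ∈ edge K (Inverse.to onEdges e)

Uniform : ℕ → Hypergraph → Set
Uniform m H = ∀ e → ∣ edge H e ∣ ≡ m

Linear : Hypergraph → Set
Linear H = ∀ e f → e ≢ f → ∣ edge H e ∩ edge H f ∣ ℕ.≤ 1

Adjacent : (H : Hypergraph) → Fin (order H) → Fin (order H) → Set
Adjacent H i j = i ≢ j × ∃[ e ] i ∈ edge H e × j ∈ edge H e

Connected : Hypergraph → Set
Connected H = ∀ i j → Star (Adjacent H) i j

adjacent? : ∀ H i j → Dec (Adjacent H i j)
adjacent? H i j =
  ¬? (i ≟ j) ×-dec any? (λ e → (i ∈? edge H e) ×-dec (j ∈? edge H e))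

m∸1-nonZero : ∀ m .{{_ : NonTrivial m}} → NonZero (m ∸ 1)
m∸1-nonZero (suc (suc _)) = _

adjacencyMatrix : ∀ m .{{_ : NonTrivial m}} (H : Hypergraph) → Matrix (order H)
adjacencyMatrix m H i j =
  if does (adjacent? H i j)
  then ℚ⇒ℂ (_/_ (+ 1) (m ∸ 1) {{m∸1-nonZero m}})
  else 0ℂ

------------------------------------------------------------------------
-- Loose cycles

cyclicSuc : ∀ {l} → Fin l → Fin l
cyclicSuc {suc l} i = suc (toℕ i) mod suc l

-- A cyclic labelling v₁ e₁ v₂ e₂ … v_l e_l v₁, in which the vertex v i is
-- shared by the edge e i and its predecessor.
record LooseCycle (H : Hypergraph) (l : ℕ) : Set where
  field
    length≥3       : 3 ℕ.≤ l
    v              : Fin l → Fin (order H)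
    e              : Fin l → Fin (size H)
    v-distinct     : Injective _≡_ _≡_ v
    e-distinct     : Injective _≡_ _≡_ e
    consecutive    : ∀ i →
      edge H (e i) ∩ edge H (e (cyclicSuc i)) ≡ ⁅ v (cyclicSuc i) ⁆
    nonconsecutive : ∀ i j → i ≢ j → j ≢ cyclicSuc i → i ≢ cyclicSuc j →
      Empty (edge H (e i) ∩ edge H (e j))

-- Rotating or reversing the labelling does not change the cycle, so loose
-- cycles contained in H are identified with their sets of edges.
IsLooseCycle : (H : Hypergraph) → Subset (size H) → Set
IsLooseCycle H C = ∃[ l ] Σ (LooseCycle H l) λ c →
  ∀ f → f ∈ C ⇔ (∃[ i ] LooseCycle.e c i ≡ f)

Tricyclic : Hypergraph → Set
Tricyclic H = Σ (Fin 3 → Subset (size H)) λ c →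
  Injective _≡_ _≡_ c × (∀ C → IsLooseCycle H C ⇔ (∃[ i ] c i ≡ C))

TypeI : ℕ → Hypergraph → Set
TypeI m H = order H ℕ.+ 1 ≡ size H ℕ.* (m ∸ 1)

------------------------------------------------------------------------
-- Power hypergraphs

private
  nonempty-++ˡ : ∀ {n k} {p : Subset n} (q : Subset k) → Nonempty p → Nonempty (p ++ q)
  nonempty-++ˡ {k = k} {p} q (i , i∈p) =
    i ↑ˡ k , lookup⇒[]= (i ↑ˡ k) (p ++ q) (trans (lookup-++ˡ p q i) ([]=⇒lookup i∈p))

-- The new vertices are indexed by Fin (size G * (m ∸ 2)); those whose
-- quotient by m ∸ 2 is e are the ones added to the edge e.
power : ℕ → Hypergraph → Hypergraph
power m G = record
  { order    = order G ℕ.+ size G ℕ.* (m ∸ 2)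
  ; size     = size G
  ; edge     = λ e → edge G e ++ new e
  ; nonempty = λ e → nonempty-++ˡ (new e) (nonempty G e)
  ; distinct = λ {e} {f} eq → distinct G (++-injectiveˡ (edge G e) (edge G f) eq)
  }
  where
  new : Fin (size G) → Subset (size G ℕ.* (m ∸ 2))
  new e = tabulate λ j → does (quotient (m ∸ 2) j ≟ e)

-- Graphs are the 2-uniform hypergraphs.
IsPowerOfGraph : ℕ → Hypergraph → Set
IsPowerOfGraph m H = ∃[ G ] Uniform 2 G × H ≅ power m G

------------------------------------------------------------------------
-- The hypergraphs T₁C(l₁,l₂,l₃,l₄)

private
  ⊤≢⊥ : ∀ n .{{_ : NonZero n}} → ⊤ {n} ≢ ⊥
  ⊤≢⊥ (suc n) ()

attachPendant : ∀ m .{{_ : NonTrivial m}} (H : Hypergraph) → Fin (order H) → Hypergraph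
attachPendant m H v = record
  { order    = order H ℕ.+ (m ∸ 1)
  ; size     = suc (size H)
  ; edge     = edge′
  ; nonempty = λ where
      zero    → nonempty-++ˡ ⊤ (v , x∈⁅x⁆ v)
      (suc e) → nonempty-++ˡ ⊥ (nonempty H e)
  ; distinct = distinct′
  }
  where
  edge′ : Fin (suc (size H)) → Subset (order H ℕ.+ (m ∸ 1))
  edge′ zero    = ⁅ v ⁆ ++ ⊤
  edge′ (suc e) = edge H e ++ ⊥

  ⊤≢⊥′ : ⊤ {m ∸ 1} ≢ ⊥
  ⊤≢⊥′ = ⊤≢⊥ (m ∸ 1) {{m∸1-nonZero m}}

  distinct′ : Injective _≡_ _≡_ edge′
  distinct′ {zero}  {zero}  eq = refl
  distinct′ {zero}  {suc f} eq =
    contradiction (++-injectiveʳ ⁅ v ⁆ (edge H f) eq) ⊤≢⊥′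
  distinct′ {suc e} {zero}  eq =
    contradiction (sym (++-injectiveʳ (edge H e) ⁅ v ⁆ eq)) ⊤≢⊥′
  distinct′ {suc e} {suc f} eq =
    cong suc (distinct H (++-injectiveˡ (edge H e) (edge H f) eq))

-- The vertices to which edges are attached are named by elements of a fixed
-- type, and ι gives their current positions, which move as H grows.
attachPendants : ∀ m .{{_ : NonTrivial m}} (H : Hypergraph) {n : ℕ}
                 (ι : Fin n → Fin (order H)) → List (Fin n) → Hypergraph
attachPendants m H ι []       = H
attachPendants m H ι (v ∷ vs) =
  attachPendants m (attachPendant m H (ι v)) ((_↑ˡ (m ∸ 1)) ∘ ι) vs

-- The edges e₁, …, e₅ meet only in v₁, …, v₄ (here 0F, …, 3F), and each e_i
-- contains exactly two of these; they are obtained by adding m ∸ 2 further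
-- vertices to each edge of the following graph.
diamondEdge : Fin 5 → Subset 4
diamondEdge 0F = ⁅ 0F ⁆ ∪ ⁅ 1F ⁆
diamondEdge 1F = ⁅ 1F ⁆ ∪ ⁅ 2F ⁆
diamondEdge 2F = ⁅ 2F ⁆ ∪ ⁅ 0F ⁆
diamondEdge 3F = ⁅ 2F ⁆ ∪ ⁅ 3F ⁆
diamondEdge 4F = ⁅ 3F ⁆ ∪ ⁅ 0F ⁆

private abstract
  diamond-nonempty : ∀ e → Nonempty (diamondEdge e)
  diamond-nonempty = from-yes (all? λ e → any? λ v → v ∈? diamondEdge e)

  diamond-distinct : ∀ e f → diamondEdge e ≡ diamondEdge f → e ≡ f
  diamond-distinct = from-yes
    (all? λ e → all? λ f → ≡-dec _≟ᵇ_ (diamondEdge e) (diamondEdge f) →-dec (e ≟ f))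

diamond : Hypergraph
diamond = record
  { order    = 4
  ; size     = 5
  ; edge     = diamondEdge
  ; nonempty = diamond-nonempty
  ; distinct = diamond-distinct _ _
  }

T₁C : ∀ m .{{_ : NonTrivial m}} → ℕ → ℕ → ℕ → ℕ → Hypergraph
T₁C m l₁ l₂ l₃ l₄ = attachPendants m (power m diamond) {4} (_↑ˡ (5 ℕ.* (m ∸ 2)))
  (replicate l₁ 0F ++ˡ replicate l₂ 1F ++ˡ replicate l₃ 2F ++ˡ replicate l₄ 3F)

-- Let 𝓗 be the m-th power of a graph Γ with n vertices and n + 1 edges. Eliminating the new vertices turns an
-- eigenvector of 𝓗 into a vector x on Γ with (tw + Q)(x v) = ∑ (t (x u) + Q (x v)), summed over the neighbours u of v,
-- where Q = m - 2, w = (m - 1)λ - Q and t = w + 1 + Q; so x attains the value tw + Q of the quadratic form of tA + QD.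
-- Passing to absolute values, x is a nonnegative vector for which the equation holds with ≤.
--
-- Let r be a vertex where x is largest, and take a breadth-first spanning tree from r. If r is adjacent to every other
-- vertex, the two edges outside the tree either share a vertex, which gives T₁C(k-5,0,0,0), or are disjoint, which
-- gives only two loose cycles. Otherwise, moving tree edges to r and the other edges to the vertices with the next
-- largest values does not decrease the form and ends in T₁C(k-6,0,1,0). At the root w of E₁E₂ = G² belonging to this
-- hypergraph, tw + Q minus its form is a sum of squares. So for w at least this root all inequalities are equalities,
-- and these force Γ to be the graph of T₁C(k-6,0,1,0).
module Submission where

open import Defs
open import Algebra.Bundles using (CommutativeRing)
import Algebra.Properties.CommutativeMonoid.Sum as Summation
import Algebra.Properties.Ring as RingProperties
import Algebra.Properties.Semiring.Sum as SemiringSummation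
import Algebra.Solver.Ring as RingSolver
open import Algebra.Solver.Ring.AlmostCommutativeRing using (fromCommutativeRing; _-Raw-AlmostCommutative⟶_)
open import Data.Bool.Base using (Bool; true; false; if_then_else_)
open import Data.Empty using (⊥)
open import Data.Fin.Base using (Fin; zero; suc; toℕ; fromℕ<; _↑ˡ_; _↑ʳ_; splitAt; join; combine; remQuot; quotient)
open import Data.Fin.Patterns using (0F; 1F; 2F; 3F; 4F)
open import Data.Fin.Permutation using (Permutation; permutation; ↔⇒≡)
open import Data.Fin.Properties as Fin using (_≟_; all?; any?; pigeonhole; ¬∀⟶∃¬; injective⇒≤)
open import Data.Fin.Subset using (Subset; _∈_; ⁅_⁆; ∣_∣) renaming (⊤ to full; ⊥ to empty)
open import Data.Fin.Subset.Properties using (x∈⁅y⁆⇒x≡y; x∈⁅x⁆; x∈p∩q⁺; x∈p∩q⁻; ∉⊥; ∈⊤; ⊆-antisym)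
open import Data.Integer.Base as ℤ using (ℤ; +_)
import Data.Integer.Properties as ℤ
open import Data.List.Base using (List; []; _∷_; replicate) renaming (_++_ to _++ˡ_)
open import Data.List.Relation.Unary.All using (All; []; _∷_)
open import Data.List.Relation.Unary.All.Properties using (replicate⁺; ++⁺)
open import Data.Maybe.Base as Maybe using (Maybe)
open import Data.Nat.Base as ℕ using (ℕ; zero; suc; _∸_; NonTrivial)
open import Data.Nat.DivMod using (_%_; m%n<n; m<n⇒m%n≡m; n%n≡0)
import Data.Nat.Properties as ℕ
open import Data.Product using (Σ; ∃-syntax; _×_; _,_; proj₁; proj₂)
open import Data.Rational.Base as ℚ using (ℚ; 0ℚ; 1ℚ; ½)
import Data.Rational.Properties as ℚ
open import Data.Rational.Unnormalised.Base as ℚᵘ using (mkℚᵘ; *≡*; *≤*)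
import Data.Rational.Unnormalised.Properties as ℚᵘ
open import Data.Sum.Base as Sum using (_⊎_; inj₁; inj₂; [_,_]′)
open import Data.Unit.Base using (⊤; tt)
open import Data.Vec.Base using ([]; _∷_; _++_; tabulate; here; there)
open import Data.Vec.Properties using ([]=⇒lookup; lookup⇒[]=; lookup-++ˡ; lookup-++ʳ; lookup∘tabulate)
open import Function.Base using (_∘_; id)
open import Function.Bundles using (_↔_; _⇔_; Inverse; Equivalence; mk↔ₛ′; mk⇔)
open import Function.Definitions using (Injective)
open import Level using (0ℓ)
open import Relation.Binary.Consequences using (dec⇒weaklyDec)
open import Relation.Binary.Construct.Closure.ReflexiveTransitive as Walk using (Star; _◅_)
open import Relation.Binary.PropositionalEquality as ≡ using (_≡_; _≢_)
open import Relation.Binary.Structures using (IsEquivalence)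
open import Relation.Nullary using (¬_; Dec; yes; no; does; contradiction; _×-dec_; _⊎-dec_; _→-dec_; ¬?)
open import Relation.Nullary.Decidable using (decidable-stable; does-⇔; from-yes)

-- Ordered rings

-- Reals are Cauchy sequences, so their order is neither decidable nor total; signs, maxima and
-- rankings of vertices exist only under double negation. The classical argument survives because
-- `≤` on them is stable under double negation and `Extremal Γ` is a decidable statement about a
-- finite graph. The algebra is done over an abstract `OrderedRing` with a stable order, where
-- `x < y` stands for `¬ y ≤ x`; the rationals are a second instance, on which the root is found by
-- bisection. Perron-Frobenius theory is replaced by subsolutions: the absolute values of the real
-- or imaginary part of any eigenvector give a nonnegative vector y with ry ≤ Ay. An inequality in
-- this direction is enough, because the quadratic form and the equation at the hub are only ever
-- bounded from above. The number τ = (w + q)/(m - 1) separates the two spectral radii. Being an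
-- eigenvalue of T₁C(k-6,0,1,0), it is at most ρ′, while τ ≤ ρ is possible only if 𝓗 is that
-- hypergraph. The inequality and the case of equality both follow from this one dichotomy.

record OrderedRing : Set₁ where
  infix 4 _≤_
  field
    commutativeRing : CommutativeRing 0ℓ 0ℓ
  open CommutativeRing commutativeRing public hiding (_-_; zero) renaming (zeroˡ to *-zeroˡ; zeroʳ to *-zeroʳ)
  field
    _≤_         : Carrier → Carrier → Set
    ≤-reflexive : ∀ {x y} → x ≈ y → x ≤ y
    ≤-trans     : ∀ {x y z} → x ≤ y → y ≤ z → x ≤ z
    ≤-antisym   : ∀ {x y} → x ≤ y → y ≤ x → x ≈ y
    +-monoˡ-≤   : ∀ {x y} z → x ≤ y → x + z ≤ y + z
    *-nonneg    : ∀ {x y} → 0# ≤ x → 0# ≤ y → 0# ≤ x * y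
    *-positive  : ∀ {x y} → ¬ x ≤ 0# → ¬ y ≤ 0# → ¬ x * y ≤ 0#
    ≰⇒≥         : ∀ {x y} → ¬ x ≤ y → y ≤ x
    ≤-stable    : ∀ {x y} → ¬ ¬ x ≤ y → x ≤ y
    1≰0         : ¬ 1# ≤ 0#
    ℤ-morphism  : ℤ.+-*-rawRing -Raw-AlmostCommutative⟶ fromCommutativeRing commutativeRing

module OrderedRingProperties (R : OrderedRing) where

  open OrderedRing R public
  open _-Raw-AlmostCommutative⟶_ ℤ-morphism public using ()
    renaming (⟦_⟧ to fromℤ; +-homo to fromℤ-+; *-homo to fromℤ-*; 0-homo to fromℤ-0; 1-homo to fromℤ-1)

  private
    fromℤ-≟ : ∀ i j → Maybe (fromℤ i ≈ fromℤ j)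
    fromℤ-≟ i j = Maybe.map (λ { ≡.refl → refl }) (dec⇒weaklyDec ℤ._≟_ i j)

  open RingSolver ℤ.+-*-rawRing (fromCommutativeRing commutativeRing) ℤ-morphism fromℤ-≟ public
    using (solve; _:=_; _:+_; _:*_; _:-_; :-_; con; Polynomial)

  open Summation +-commutativeMonoid public
    using (sum; sum-cong-≋; sum-permute; ∑-distrib-+; ∑-comm; sum-replicate-zero)
  open SemiringSummation semiring public using (*-distribˡ-sum; *-distribʳ-sum)
  open RingProperties ring public using (-‿distribˡ-*; -‿distribʳ-*)

  infix  4 _<_
  infixl 6 _-_

  _-_ : Carrier → Carrier → Carrier
  x - y = x + (- y)

  _<_ : Carrier → Carrier → Set
  x < y = ¬ y ≤ x

  fromℕ : ℕ → Carrier
  fromℕ n = fromℤ (+ n)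

  ≤-refl : ∀ {x} → x ≤ x
  ≤-refl = ≤-reflexive refl

  ≤-respʳ : ∀ {x y z} → y ≈ z → x ≤ y → x ≤ z
  ≤-respʳ y≈z x≤y = ≤-trans x≤y (≤-reflexive y≈z)

  ≤-respˡ : ∀ {x y z} → x ≈ y → x ≤ z → y ≤ z
  ≤-respˡ x≈y x≤z = ≤-trans (≤-reflexive (sym x≈y)) x≤z

  ≤-resp : ∀ {x x′ y y′} → x ≈ x′ → y ≈ y′ → x ≤ y → x′ ≤ y′
  ≤-resp x≈ y≈ x≤y = ≤-respˡ x≈ (≤-respʳ y≈ x≤y)

  +-monoʳ-≤ : ∀ {x y} z → x ≤ y → z + x ≤ z + y
  +-monoʳ-≤ z x≤y = ≤-resp (+-comm _ z) (+-comm _ z) (+-monoˡ-≤ z x≤y)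

  +-mono-≤ : ∀ {x y u v} → x ≤ y → u ≤ v → x + u ≤ y + v
  +-mono-≤ x≤y u≤v = ≤-trans (+-monoˡ-≤ _ x≤y) (+-monoʳ-≤ _ u≤v)

  +-nonneg : ∀ {x y} → 0# ≤ x → 0# ≤ y → 0# ≤ x + y
  +-nonneg 0≤x 0≤y = ≤-respˡ (+-identityˡ 0#) (+-mono-≤ 0≤x 0≤y)

  ≤-by : ∀ {x y d} → 0# ≤ d → y ≈ x + d → x ≤ y
  ≤-by {x} 0≤d y≈x+d = ≤-resp (+-identityʳ x) (sym y≈x+d) (+-monoʳ-≤ x 0≤d)

  0≤y-x : ∀ {x y} → x ≤ y → 0# ≤ y - x
  0≤y-x {x} x≤y = ≤-respˡ (-‿inverseʳ x) (+-monoˡ-≤ (- x) x≤y)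

  +-cancelʳ-≤ : ∀ z {x y} → x + z ≤ y + z → x ≤ y
  +-cancelʳ-≤ z {x} {y} le = ≤-by (0≤y-x le)
    (solve 3 (λ x y z → y := x :+ ((y :+ z) :- (x :+ z))) refl x y z)

  *-monoˡ-≤ : ∀ {x y z} → 0# ≤ z → x ≤ y → z * x ≤ z * y
  *-monoˡ-≤ {x} {y} {z} 0≤z x≤y = ≤-by (*-nonneg 0≤z (0≤y-x x≤y))
    (solve 3 (λ x y z → z :* y := z :* x :+ z :* (y :- x)) refl x y z)

  *-monoʳ-≤ : ∀ {x y z} → 0# ≤ z → x ≤ y → x * z ≤ y * z
  *-monoʳ-≤ {x} {y} {z} 0≤z x≤y = ≤-resp (*-comm z x) (*-comm z y) (*-monoˡ-≤ 0≤z x≤y)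

  -- The order need not be total, so cases can be distinguished only under double negation; since
  -- `≤` is stable, this is enough whenever the goal is an inequality or a contradiction.
  ≤-total : ∀ x y → ¬ ¬ (x ≤ y ⊎ y ≤ x)
  ≤-total x y k = k (inj₂ (≰⇒≥ (k ∘ inj₁)))

  <⇒≤ : ∀ {x y} → x < y → x ≤ y
  <⇒≤ = ≰⇒≥

  0<1 : 0# < 1#
  0<1 = 1≰0

  0≤1 : 0# ≤ 1#
  0≤1 = <⇒≤ 0<1

  <-≤-trans : ∀ {x y z} → x < y → y ≤ z → x < z
  <-≤-trans x<y y≤z z≤x = x<y (≤-trans y≤z z≤x)

  ≤-<-trans : ∀ {x y z} → x ≤ y → y < z → x < z
  ≤-<-trans x≤y y<z z≤x = y<z (≤-trans z≤x x≤y)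

  <-respʳ : ∀ {x y z} → y ≈ z → x < y → x < z
  <-respʳ y≈z x<y = <-≤-trans x<y (≤-reflexive y≈z)

  <-by : ∀ {x y d} → 0# < d → y ≈ x + d → x < y
  <-by {x} {y} {d} 0<d y≈x+d y≤x = 0<d (+-cancelʳ-≤ x
    (≤-resp (trans y≈x+d (+-comm x d)) (sym (+-identityˡ x)) y≤x))

  0<y-x : ∀ {x y} → x < y → 0# < y - x
  0<y-x {x} {y} x<y le = x<y (≤-resp
    (solve 2 (λ x y → y :- x :+ x := y) refl x y) (+-identityˡ x) (+-monoˡ-≤ x le))

  +-pos-nonneg : ∀ {x y} → 0# < x → 0# ≤ y → 0# < x + y
  +-pos-nonneg {x} 0<x 0≤y = <-≤-trans 0<x (≤-by 0≤y refl)

  +-nonneg-pos : ∀ {x y} → 0# ≤ x → 0# < y → 0# < x + y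
  +-nonneg-pos {x} {y} 0≤x 0<y = <-respʳ (+-comm y x) (+-pos-nonneg 0<y 0≤x)

  *-cancelˡ-≤ : ∀ {x y z} → 0# < z → z * x ≤ z * y → x ≤ y
  *-cancelˡ-≤ {x} {y} {z} 0<z zx≤zy = ≤-stable λ y<x →
    *-positive 0<z (0<y-x y<x) (≤-resp
      (solve 3 (λ x y z → z :* x :- z :* y := z :* (x :- y)) refl x y z)
      (-‿inverseʳ (z * y)) (+-monoˡ-≤ (- (z * y)) zx≤zy))

  0≤-cancelˡ : ∀ {x z} → 0# < z → 0# ≤ z * x → 0# ≤ x
  0≤-cancelˡ {x} {z} 0<z 0≤zx = *-cancelˡ-≤ 0<z (≤-respˡ (sym (*-zeroʳ z)) 0≤zx)

  ≤0-cancelˡ : ∀ {x z} → 0# < z → z * x ≤ 0# → x ≤ 0#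
  ≤0-cancelˡ {x} {z} 0<z zx≤0 = *-cancelˡ-≤ 0<z (≤-respʳ (sym (*-zeroʳ z)) zx≤0)

  +≤0⇒≤0ˡ : ∀ {x y} → 0# ≤ y → x + y ≤ 0# → x ≤ 0#
  +≤0⇒≤0ˡ 0≤y x+y≤0 = ≤-trans (≤-by 0≤y refl) x+y≤0

  +≤0⇒≤0ʳ : ∀ {x y} → 0# ≤ x → x + y ≤ 0# → y ≤ 0#
  +≤0⇒≤0ʳ {x} {y} 0≤x x+y≤0 = +≤0⇒≤0ˡ 0≤x (≤-respˡ (+-comm x y) x+y≤0)

  x-y≈0⇒x≈y : ∀ {x y} → x - y ≈ 0# → x ≈ y
  x-y≈0⇒x≈y {x} {y} eq = trans (solve 2 (λ x y → x := (x :- y) :+ y) refl x y) (trans (+-congʳ eq) (+-identityˡ y))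

  0≤y-x⇒x≤y : ∀ {x y} → 0# ≤ y - x → x ≤ y
  0≤y-x⇒x≤y {x} {y} 0≤ = ≤-by 0≤ (solve 2 (λ x y → y := x :+ (y :- x)) refl x y)

  x≤y⇒x-y≤0 : ∀ {x y} → x ≤ y → x - y ≤ 0#
  x≤y⇒x-y≤0 {x} {y} x≤y = ≤-respʳ (-‿inverseʳ y) (+-monoˡ-≤ (- y) x≤y)

  +-cancel-≤ˡ : ∀ {x₁ x₂ y₁ y₂} → y₂ ≤ x₂ → x₁ + x₂ ≤ y₁ + y₂ → x₁ ≤ y₁
  +-cancel-≤ˡ {x₁} {x₂} {y₁} {y₂} y₂≤x₂ le = +-cancelʳ-≤ x₂ (≤-trans le (+-monoʳ-≤ y₁ y₂≤x₂))

  +-cancel-≤ʳ : ∀ {x₁ x₂ y₁ y₂} → y₁ ≤ x₁ → x₁ + x₂ ≤ y₁ + y₂ → x₂ ≤ y₂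
  +-cancel-≤ʳ {x₁} {x₂} {y₁} {y₂} y₁≤x₁ le = +-cancel-≤ˡ y₁≤x₁ (≤-resp (+-comm x₁ x₂) (+-comm y₁ y₂) le)

  ≈-stable : ∀ {x y} → ¬ ¬ x ≈ y → x ≈ y
  ≈-stable nn = ≤-antisym (≤-stable λ k → nn (k ∘ ≤-reflexive))
                          (≤-stable λ k → nn (k ∘ ≤-reflexive ∘ sym))

  *-cancelˡ-≈ : ∀ {x y z} → 0# < z → z * x ≈ z * y → x ≈ y
  *-cancelˡ-≈ 0<z eq = ≤-antisym (*-cancelˡ-≤ 0<z (≤-reflexive eq))
                                 (*-cancelˡ-≤ 0<z (≤-reflexive (sym eq)))

  0≤-x : ∀ {x} → x ≤ 0# → 0# ≤ - x
  0≤-x {x} x≤0 = ≤-respʳ (+-identityˡ (- x)) (0≤y-x x≤0)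

  square-nonneg : ∀ x → 0# ≤ x * x
  square-nonneg x = ≤-stable λ k → ≤-total 0# x λ where
    (inj₁ 0≤x) → k (*-nonneg 0≤x 0≤x)
    (inj₂ x≤0) → k (≤-respʳ (solve 1 (λ x → :- x :* :- x := x :* x) refl x)
                     (*-nonneg (0≤-x x≤0) (0≤-x x≤0)))

  x*x≤0⇒x≈0 : ∀ {x} → x * x ≤ 0# → x ≈ 0#
  x*x≤0⇒x≈0 {x} xx≤0 = ≤-antisym
    (≤-stable λ 0<x → *-positive 0<x 0<x xx≤0)
    (≤-stable λ x<0 → *-positive (-x>0 x<0) (-x>0 x<0)
      (≤-respˡ (solve 1 (λ x → x :* x := :- x :* :- x) refl x) xx≤0))
    where
    -x>0 : ¬ 0# ≤ x → 0# < - x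
    -x>0 x<0 = <-respʳ (+-identityˡ (- x)) (0<y-x x<0)

  0≤fromℕ : ∀ n → 0# ≤ fromℕ n
  0≤fromℕ zero    = ≤-reflexive (sym fromℤ-0)
  0≤fromℕ (suc n) = ≤-respʳ (sym (fromℤ-+ (+ 1) (+ n)))
    (+-nonneg (≤-respʳ (sym fromℤ-1) 0≤1) (0≤fromℕ n))

  fromℕ-suc : ∀ n → fromℕ (suc n) ≈ 1# + fromℕ n
  fromℕ-suc n = trans (fromℤ-+ (+ 1) (+ n)) (+-congʳ fromℤ-1)

  sum-cong : ∀ {n} {f g : Fin n → Carrier} → (∀ i → f i ≈ g i) → sum f ≈ sum g
  sum-cong = sum-cong-≋

  sum-zero : ∀ {n} {f : Fin n → Carrier} → (∀ i → f i ≈ 0#) → sum f ≈ 0#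
  sum-zero {n} f≈0 = trans (sum-cong f≈0) (sum-replicate-zero n)

  sum-mono : ∀ {n} {f g : Fin n → Carrier} → (∀ i → f i ≤ g i) → sum f ≤ sum g
  sum-mono {zero}  f≤g = ≤-refl
  sum-mono {suc n} f≤g = +-mono-≤ (f≤g zero) (sum-mono (f≤g ∘ suc))

  sum-nonneg : ∀ {n} {f : Fin n → Carrier} → (∀ i → 0# ≤ f i) → 0# ≤ sum f
  sum-nonneg {zero}  0≤f = ≤-refl
  sum-nonneg {suc n} 0≤f = +-nonneg (0≤f zero) (sum-nonneg (0≤f ∘ suc))

  sum-- : ∀ {n} (f g : Fin n → Carrier) → sum (λ i → f i - g i) ≈ sum f - sum g
  sum-- {zero}  f g = sym (-‿inverseʳ 0#)
  sum-- {suc n} f g = trans (+-congˡ (sum-- (f ∘ suc) (g ∘ suc)))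
    (solve 4 (λ a b c d → (a :- b) :+ (c :- d) := (a :+ c) :- (b :+ d)) refl
      (f zero) (g zero) (sum (f ∘ suc)) (sum (g ∘ suc)))

  term≤sum : ∀ {n} {f : Fin n → Carrier} → (∀ i → 0# ≤ f i) → ∀ i → f i ≤ sum f
  term≤sum 0≤f zero    = ≤-by (sum-nonneg (0≤f ∘ suc)) refl
  term≤sum 0≤f (suc i) = ≤-trans (term≤sum (0≤f ∘ suc) i)
    (≤-by (0≤f zero) (+-comm _ _))

  sum≤0⇒≈0 : ∀ {n} {f : Fin n → Carrier} → (∀ i → 0# ≤ f i) → sum f ≤ 0# → ∀ i → f i ≈ 0#
  sum≤0⇒≈0 0≤f Σ≤0 i = ≤-antisym (≤-trans (term≤sum 0≤f i) Σ≤0) (0≤f i)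

  -- How equality in a summed estimate reaches the single terms: the rest of the sum is cancelled
  -- against an estimate in the opposite direction. Later this shows that each remaining vertex is
  -- adjacent to the hub.
  sum-cancel-≤ : ∀ {n} {f g : Fin n → Carrier} → (∀ i → g i ≤ f i) → sum f ≤ sum g → ∀ i → f i ≤ g i
  sum-cancel-≤ {f = f} {g} g≤f Σf≤Σg zero    = +-cancel-≤ˡ (sum-mono (g≤f ∘ suc)) Σf≤Σg
  sum-cancel-≤ {f = f} {g} g≤f Σf≤Σg (suc i) = sum-cancel-≤ (g≤f ∘ suc) (+-cancel-≤ʳ (g≤f zero) Σf≤Σg) i

-- The rational estimates behind the ε-arguments. They are proved in an abstract ring, so that the
-- solver meets symbols instead of computing with rational numbers.
module OrderedRingInequalities (R : OrderedRing) where

  open OrderedRingProperties R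

  x-y≤d⇒x≤y+d : ∀ x y d → x - y ≤ d → x ≤ y + d
  x-y≤d⇒x≤y+d x y d le = ≤-by (0≤y-x le)
    (solve 3 (λ x y d → y :+ d := x :+ (d :- (x :- y))) refl x y d)

  x≤y+d⇒x-y≤d : ∀ x y d → x ≤ y + d → x - y ≤ d
  x≤y+d⇒x-y≤d x y d le = ≤-by (0≤y-x le)
    (solve 3 (λ x y d → d := (x :- y) :+ ((y :+ d) :- x)) refl x y d)

  -[x-y]≈y-x : ∀ x y → - (x - y) ≈ y - x
  -[x-y]≈y-x = solve 2 (λ x y → :- (x :- y) := y :- x) refl

  -x--y≈-[x-y] : ∀ x y → - x - - y ≈ - (x - y)
  -x--y≈-[x-y] = solve 2 (λ x y → :- x :- :- y := :- (x :- y)) refl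

  -- When two sequences move by at most `d` after some index, the threshold `d + d + d` at that
  -- index leaves an excess of at most five times `d` on one side and, in `perturb-gap`, a gap of
  -- `d` on the other. The excess is rounded up to eight times `d` because `ε` is divided by halving
  -- three times.
  perturb-≤ : ∀ u v u′ v′ d → 0# ≤ d → u ≤ v + (d + d + d) → u′ ≤ u + d → v ≤ v′ + d →
    u′ ≤ v′ + (((d + d) + (d + d)) + ((d + d) + (d + d)))
  perturb-≤ u v u′ v′ d 0≤d u≤v u′≤u v≤v′ = ≤-by
    (+-nonneg (+-nonneg (0≤y-x u≤v) (0≤y-x u′≤u)) (+-nonneg (0≤y-x v≤v′) (+-nonneg 0≤d (+-nonneg 0≤d 0≤d))))
    (solve 5 (λ u v u′ v′ δ → v′ :+ (((δ :+ δ) :+ (δ :+ δ)) :+ ((δ :+ δ) :+ (δ :+ δ))) :=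
       u′ :+ ((((v :+ (δ :+ δ :+ δ)) :- u) :+ ((u :+ δ) :- u′)) :+ (((v′ :+ δ) :- v) :+ (δ :+ (δ :+ δ)))))
      refl u v u′ v′ d)

  perturb-gap : ∀ u v u′ v′ d → v + (d + d + d) ≤ u → u ≤ u′ + d → v′ ≤ v + d → v′ + d ≤ u′
  perturb-gap u v u′ v′ d v≤u u≤u′ v′≤v = ≤-by
    (+-nonneg (0≤y-x v≤u) (+-nonneg (0≤y-x u≤u′) (0≤y-x v′≤v)))
    (solve 5 (λ u v u′ v′ δ → u′ :=
       (v′ :+ δ) :+ ((u :- (v :+ (δ :+ δ :+ δ))) :+ (((u′ :+ δ) :- u) :+ ((v :+ δ) :- v′))))
      refl u v u′ v′ d)

  no-gap : ∀ x y h → y + (h + h) ≤ x → x ≤ y + h → h ≤ 0#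
  no-gap x y h y+2h≤x x≤y+h = +-cancelʳ-≤ (y + h)
    (≤-resp (solve 2 (λ y h → y :+ (h :+ h) := h :+ (y :+ h)) refl y h)
      (sym (+-identityˡ _)) (≤-trans y+2h≤x x≤y+h))

  +-assocʳ-comm : ∀ x y z → (x + y) + z ≈ (x + z) + y
  +-assocʳ-comm = solve 3 (λ x y z → (x :+ y) :+ z := (x :+ z) :+ y) refl

  bound-above : ∀ u v a b e → u ≤ v + e → v ≤ a → 0# ≤ b → u ≤ e + (a + b)
  bound-above u v a b e u≤v+e v≤a 0≤b = ≤-by
    (+-nonneg (0≤y-x u≤v+e) (+-nonneg (0≤y-x v≤a) 0≤b))
    (solve 5 (λ u v a b e → e :+ (a :+ b) := u :+ (((v :+ e) :- u) :+ ((a :- v) :+ b))) refl u v a b e)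

  bound-below : ∀ u v a b e → v ≤ u + e → 0# ≤ v + a → 0# ≤ b → - (e + (a + b)) ≤ u
  bound-below u v a b e v≤u+e 0≤v+a 0≤b = ≤-by
    (+-nonneg (0≤y-x v≤u+e) (+-nonneg 0≤v+a 0≤b))
    (solve 5 (λ u v a b e → u := (:- (e :+ (a :+ b))) :+ (((u :+ e) :- v) :+ ((v :+ a) :+ b))) refl u v a b e)

  -- Expand (u + d)(v + d) ≥ 0.
  *-almost-nonneg : ∀ B d u v → 0# ≤ d → d ≤ 1# → 0# ≤ u + d → 0# ≤ v + d → u ≤ B → v ≤ B →
    0# ≤ u * v + (1# + (B + B)) * d
  *-almost-nonneg B d u v 0≤d d≤1 0≤u 0≤v u≤B v≤B = ≤-respʳ
    (solve 5 (λ x y δ B e → (x :+ δ) :* (y :+ δ) :+ δ :* (((B :- x) :+ (B :- y)) :+ (e :- δ)) :=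
        x :* y :+ (e :+ (B :+ B)) :* δ)
      refl u v d B 1#)
    (+-nonneg (*-nonneg 0≤u 0≤v)
      (*-nonneg 0≤d (+-nonneg (+-nonneg (0≤y-x u≤B) (0≤y-x v≤B)) (0≤y-x d≤1))))

  *-gap : ∀ d e u v → 0# ≤ d → 0# ≤ e → 0# + d ≤ u → 0# + e ≤ v → 0# + d * e ≤ u * v
  *-gap d e u v 0≤d 0≤e d≤u e≤v = ≤-resp (sym (+-identityˡ _)) refl
    (≤-trans (*-monoˡ-≤ 0≤d (≤-respˡ (+-identityˡ e) e≤v))
      (*-monoʳ-≤ (≤-trans 0≤e (≤-respˡ (+-identityˡ e) e≤v)) (≤-respˡ (+-identityˡ d) d≤u)))

  *-distribˡ-- : ∀ w u v → w * u - w * v ≈ w * (u - v)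
  *-distribˡ-- = solve 3 (λ w u v → w :* u :- w :* v := w :* (u :- v)) refl

  -y≤x⇒0≤x+y : ∀ x y → - y ≤ x → 0# ≤ x + y
  -y≤x⇒0≤x+y x y le = ≤-respʳ (solve 2 (λ x y → x :- :- y := x :+ y) refl x y) (0≤y-x le)

  d≤[1+B+B]*d : ∀ B d → 0# ≤ B → 0# ≤ d → d ≤ (1# + (B + B)) * d
  d≤[1+B+B]*d B d 0≤B 0≤d = ≤-by (*-nonneg (+-nonneg 0≤B 0≤B) 0≤d)
    (trans (distribʳ d 1# (B + B)) (+-congʳ (*-identityˡ d)))

  x+x≤y+y⇒x≤y : ∀ x y → x + x ≤ y + y → x ≤ y
  x+x≤y+y⇒x≤y x y le = ≤-stable λ y<x → +-pos-nonneg (0<y-x y<x) (<⇒≤ (0<y-x y<x))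
    (≤-resp (solve 2 (λ x y → (x :+ x) :- (y :+ y) := (x :- y) :+ (x :- y)) refl x y) (-‿inverseʳ (y + y))
      (+-monoˡ-≤ (- (y + y)) le))

  -- Twice the left side is w + Nw, at most D + D. Inductively, N times the width of the N-th
  -- bisection interval is at most D, so the widths tend to zero and powers of two are avoided.
  halving-bound : ∀ N D w h → h + h ≈ w → w ≤ D → fromℕ N * w ≤ D → fromℕ (suc N) * h ≤ D
  halving-bound N D w h 2h≈w w≤D Nw≤D = x+x≤y+y⇒x≤y _ _ (≤-respˡ
    (trans (+-cong (sym 2h≈w) (*-congˡ (sym 2h≈w)))
      (trans (solve 3 (λ h n e → (h :+ h) :+ n :* (h :+ h) := (h :+ n :* h) :+ (h :+ n :* h)) refl h (fromℕ N) 1#)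
        (+-cong step step)))
    (+-mono-≤ w≤D Nw≤D))
    where
    step : h + fromℕ N * h ≈ fromℕ (suc N) * h
    step = trans (+-congʳ (sym (*-identityˡ h))) (trans (sym (distribʳ h 1# (fromℕ N))) (*-congʳ (sym (fromℕ-suc N))))

  halving-≤ : ∀ D w h → 0# ≤ w → h + h ≈ w → w ≤ D → 0# ≤ h × h ≤ D
  halving-≤ D w h 0≤w 2h≈w w≤D = 0≤h , ≤-trans (≤-by 0≤h (sym 2h≈w)) w≤D
    where
    0≤h : 0# ≤ h
    0≤h = x+x≤y+y⇒x≤y 0# h (≤-resp (sym (+-identityʳ 0#)) (sym 2h≈w) 0≤w)

  interval-≤ : ∀ a w x y → a ≤ x → y ≤ a + w → y ≤ x + w
  interval-≤ a w x y a≤x y≤a+w = ≤-trans y≤a+w (+-monoˡ-≤ w a≤x)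

  *-large-cancel : ∀ N w ε D → D ≤ fromℕ (suc N) * ε → fromℕ (suc N) * w ≤ D → w ≤ ε
  *-large-cancel N w ε D D≤ ≤D = *-cancelˡ-≤ {w} {ε} {fromℕ (suc N)}
    (<-respʳ (sym (fromℕ-suc N)) (+-pos-nonneg 0<1 (0≤fromℕ N))) (≤-trans ≤D D≤)

-- Real numbers

-- The laws are verified on unnormalised fractions, where no common divisor has to be cancelled.
ℤ→ℚ-morphism : ℤ.+-*-rawRing -Raw-AlmostCommutative⟶ fromCommutativeRing ℚ.+-*-commutativeRing
ℤ→ℚ-morphism = record
  { ⟦_⟧    = λ i → ℚ.fromℚᵘ (mkℚᵘ i 0)
  ; +-homo = λ i j → ℚ.toℚᵘ-injective (ℚᵘ.≃-trans (to∘from (i ℤ.+ j))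
      (ℚᵘ.≃-sym (ℚᵘ.≃-trans (ℚ.toℚᵘ-homo-+ (from i) (from j))
        (ℚᵘ.≃-trans (ℚᵘ.+-cong (to∘from i) (to∘from j))
          (*≡* (≡.cong (ℤ._* + 1) (≡.cong₂ ℤ._+_ (ℤ.*-identityʳ i) (ℤ.*-identityʳ j))))))))
  ; *-homo = λ i j → ℚ.toℚᵘ-injective (ℚᵘ.≃-trans (to∘from (i ℤ.* j))
      (ℚᵘ.≃-sym (ℚᵘ.≃-trans (ℚ.toℚᵘ-homo-* (from i) (from j))
        (ℚᵘ.*-cong (to∘from i) (to∘from j)))))
  ; -‿homo = λ i → ℚ.toℚᵘ-injective (ℚᵘ.≃-trans (to∘from (ℤ.- i))
      (ℚᵘ.≃-sym (ℚᵘ.≃-trans (ℚ.toℚᵘ-homo‿- (from i)) (ℚᵘ.-‿cong (to∘from i)))))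
  ; 0-homo = ≡.refl
  ; 1-homo = ≡.refl
  }
  where
  from : ℤ → ℚ
  from i = ℚ.fromℚᵘ (mkℚᵘ i 0)
  to∘from : ∀ i → ℚ.toℚᵘ (from i) ℚᵘ.≃ mkℚᵘ i 0
  to∘from i = ℚ.toℚᵘ-fromℚᵘ (mkℚᵘ i 0)

<⇒≱ : ∀ {p q} → p ℚ.< q → ¬ q ℚ.≤ p
<⇒≱ p<q q≤p = ℚ.<-irrefl ≡.refl (ℚ.<-≤-trans p<q q≤p)

ℚ-ordered : OrderedRing
ℚ-ordered = record
  { commutativeRing = ℚ.+-*-commutativeRing
  ; _≤_             = ℚ._≤_
  ; ≤-reflexive     = ℚ.≤-reflexive
  ; ≤-trans         = ℚ.≤-trans
  ; ≤-antisym       = ℚ.≤-antisym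
  ; +-monoˡ-≤       = λ z → ℚ.+-monoˡ-≤ z
  ; *-nonneg        = λ {x} {y} 0≤x 0≤y → ℚ.nonNegative⁻¹ (x ℚ.* y)
      {{ℚ.nonNeg*nonNeg⇒nonNeg x {{ℚ.nonNegative 0≤x}} y {{ℚ.nonNegative 0≤y}}}}
  ; *-positive      = λ {x} {y} x≰0 y≰0 → <⇒≱ (ℚ.positive⁻¹ (x ℚ.* y)
      {{ℚ.pos*pos⇒pos x {{ℚ.positive (ℚ.≰⇒> x≰0)}} y {{ℚ.positive (ℚ.≰⇒> y≰0)}}}})
  ; ≰⇒≥             = λ x≰y → ℚ.<⇒≤ (ℚ.≰⇒> x≰y)
  ; ≤-stable        = decidable-stable (_ ℚ.≤? _)
  ; 1≰0             = <⇒≱ (ℚ.positive⁻¹ 1ℚ)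
  ; ℤ-morphism      = ℤ→ℚ-morphism
  }

module ℚᵒ where
  open OrderedRingProperties ℚ-ordered public
  open OrderedRingInequalities ℚ-ordered public

eventually-× : ∀ {P Q} → Eventually P → Eventually Q → Eventually (λ n → P n × Q n)
eventually-× (M , p) (N , q) = M ℕ.⊔ N , λ n M⊔N≤n →
  p n (ℕ.≤-trans (ℕ.m≤m⊔n M N) M⊔N≤n) , q n (ℕ.≤-trans (ℕ.m≤n⊔m M N) M⊔N≤n)

eventually-map : ∀ {P Q : ℕ → Set} → (∀ n → P n → Q n) → Eventually P → Eventually Q
eventually-map f (N , p) = N , λ n N≤n → f n (p n N≤n)

eventually-instance : ∀ {P} → Eventually P → ∃[ n ] P n
eventually-instance (N , p) = N , p N ℕ.≤-refl

always : ∀ {P : ℕ → Set} → (∀ n → P n) → Eventually P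
always p = 0 , λ n _ → p n

p≤∣p∣ : ∀ p → p ℚ.≤ ℚ.∣ p ∣
p≤∣p∣ p with ℚ.≤-total 0ℚ p
... | inj₁ 0≤p = ℚ.≤-reflexive (≡.sym (ℚ.0≤p⇒∣p∣≡p 0≤p))
... | inj₂ p≤0 = ℚ.≤-trans p≤0 (ℚ.0≤∣p∣ p)

∣p-q∣≡∣q-p∣ : ∀ p q → ℚ.∣ p ℚ.- q ∣ ≡ ℚ.∣ q ℚ.- p ∣
∣p-q∣≡∣q-p∣ p q = ≡.trans (≡.sym (ℚ.∣-p∣≡∣p∣ (p ℚ.- q))) (≡.cong ℚ.∣_∣ (ℚᵒ.-[x-y]≈y-x p q))

∣p-q∣≤⇒p≤q+ : ∀ p q {δ} → ℚ.∣ p ℚ.- q ∣ ℚ.≤ δ → p ℚ.≤ q ℚ.+ δ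
∣p-q∣≤⇒p≤q+ p q {δ} le = ℚᵒ.x-y≤d⇒x≤y+d p q δ (ℚ.≤-trans (p≤∣p∣ (p ℚ.- q)) le)

∣p-q∣≤⇒q≤p+ : ∀ p q {δ} → ℚ.∣ p ℚ.- q ∣ ℚ.≤ δ → q ℚ.≤ p ℚ.+ δ
∣p-q∣≤⇒q≤p+ p q {δ} le = ∣p-q∣≤⇒p≤q+ q p (≡.subst (ℚ._≤ δ) (∣p-q∣≡∣q-p∣ p q) le)

∣p-q∣≤ : ∀ p q {δ} → p ℚ.≤ q ℚ.+ δ → q ℚ.≤ p ℚ.+ δ → ℚ.∣ p ℚ.- q ∣ ℚ.≤ δ
∣p-q∣≤ p q {δ} p≤ q≤ with ℚ.∣p∣≡p∨∣p∣≡-p (p ℚ.- q)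
... | inj₁ eq = ≡.subst (ℚ._≤ δ) (≡.sym eq) (ℚᵒ.x≤y+d⇒x-y≤d p q δ p≤)
... | inj₂ eq = ≡.subst (ℚ._≤ δ) (≡.sym (≡.trans eq (ℚᵒ.-[x-y]≈y-x p q))) (ℚᵒ.x≤y+d⇒x-y≤d q p δ q≤)

0<1+B+C : ∀ B C → 0ℚ ℚ.≤ B → 0ℚ ℚ.≤ C → 0ℚ ℚ.< 1ℚ ℚ.+ (B ℚ.+ C)
0<1+B+C B C 0≤B 0≤C = ℚ.≰⇒> (ℚᵒ.+-pos-nonneg {1ℚ} {B ℚ.+ C} ℚᵒ.0<1 (ℚᵒ.+-nonneg {B} {C} 0≤B 0≤C))

p≤p+ε : ∀ p {ε} → 0ℚ ℚ.< ε → p ℚ.≤ p ℚ.+ ε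
p≤p+ε p {ε} ε>0 = ℚᵒ.≤-by {p} {p ℚ.+ ε} {ε} (ℚ.<⇒≤ ε>0) ≡.refl

halve : ∀ ε → 0ℚ ℚ.< ε → ∃[ h ] 0ℚ ℚ.< h × h ℚ.+ h ≡ ε
halve ε ε>0 = ½ ℚ.* ε , ℚ.positive⁻¹ _ {{ℚ.pos*pos⇒pos ½ ε {{ℚ.positive ε>0}}}} ,
  ≡.trans (≡.sym (ℚ.*-distribʳ-+ ε ½ ½)) (ℚ.*-identityˡ ε)

eighth : ∀ ε → 0ℚ ℚ.< ε → ∃[ h ] 0ℚ ℚ.< h × ((h ℚ.+ h) ℚ.+ (h ℚ.+ h)) ℚ.+ ((h ℚ.+ h) ℚ.+ (h ℚ.+ h)) ≡ ε
eighth ε ε>0 with halve ε ε>0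
... | h₁ , h₁>0 , ≡.refl with halve h₁ h₁>0
...   | h₂ , h₂>0 , ≡.refl with halve h₂ h₂>0
...     | h₃ , h₃>0 , ≡.refl = h₃ , h₃>0 , ≡.refl

scale-to : ∀ D → 0ℚ ℚ.< D → ∀ ε → 0ℚ ℚ.< ε → ∃[ δ ] 0ℚ ℚ.< δ × D ℚ.* δ ≡ ε
scale-to D D>0 ε ε>0 = ℚ.1/ D ℚ.* ε ,
  ℚ.positive⁻¹ _ {{ℚ.pos*pos⇒pos (ℚ.1/ D) {{ℚ.1/pos⇒pos D}} ε {{ℚ.positive ε>0}}}} ,
  ≡.trans (≡.sym (ℚ.*-assoc D (ℚ.1/ D) ε))
    (≡.trans (≡.cong (ℚ._* ε) (ℚ.*-inverseʳ D)) (ℚ.*-identityˡ ε))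
  where
  instance
    D-pos : ℚ.Positive D
    D-pos = ℚ.positive D>0
    D-nonZero : ℚ.NonZero D
    D-nonZero = ℚ.pos⇒nonZero D

-- The constructive content of trichotomy: one of two overlapping open conditions can be found.
≤ℝ-or-gap : ∀ x y ε → 0ℚ ℚ.< ε →
  Eventually (λ n → seq x n ℚ.≤ seq y n ℚ.+ ε) ⊎
  ∃[ δ ] 0ℚ ℚ.< δ × Eventually (λ n → seq y n ℚ.+ δ ℚ.≤ seq x n)
≤ℝ-or-gap x y ε ε>0 with eighth ε ε>0
... | δ , δ>0 , ≡.refl = decide
  where
  close : Eventually λ N → ∀ n → N ℕ.≤ n →
    (ℚ.∣ seq x N ℚ.- seq x n ∣ ℚ.≤ δ) × (ℚ.∣ seq y N ℚ.- seq y n ∣ ℚ.≤ δ)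
  close with cauchy x δ δ>0 | cauchy y δ δ>0
  ... | M , cx | N , cy = M ℕ.⊔ N , λ i K≤i n i≤n →
    let M≤i = ℕ.≤-trans (ℕ.m≤m⊔n M N) K≤i
        N≤i = ℕ.≤-trans (ℕ.m≤n⊔m M N) K≤i
    in cx i n M≤i (ℕ.≤-trans M≤i i≤n) , cy i n N≤i (ℕ.≤-trans N≤i i≤n)
  decide : Eventually (λ n → seq x n ℚ.≤ seq y n ℚ.+ (((δ ℚ.+ δ) ℚ.+ (δ ℚ.+ δ)) ℚ.+ ((δ ℚ.+ δ) ℚ.+ (δ ℚ.+ δ)))) ⊎
    ∃[ η ] 0ℚ ℚ.< η × Eventually (λ n → seq y n ℚ.+ η ℚ.≤ seq x n)
  decide with eventually-instance close
  ... | N , h with seq x N ℚ.≤? seq y N ℚ.+ (δ ℚ.+ δ ℚ.+ δ)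
  ...   | yes le = inj₁ (N , λ n N≤n → ℚᵒ.perturb-≤ (seq x N) (seq y N) (seq x n) (seq y n) δ (ℚ.<⇒≤ δ>0) le
          (∣p-q∣≤⇒q≤p+ (seq x N) (seq x n) (proj₁ (h n N≤n)))
          (∣p-q∣≤⇒p≤q+ (seq y N) (seq y n) (proj₂ (h n N≤n))))
  ...   | no ¬le = inj₂ (δ , δ>0 , N , λ n N≤n → ℚᵒ.perturb-gap (seq x N) (seq y N) (seq x n) (seq y n) δ (ℚ.<⇒≤ (ℚ.≰⇒> ¬le))
          (∣p-q∣≤⇒p≤q+ (seq x N) (seq x n) (proj₁ (h n N≤n)))
          (∣p-q∣≤⇒q≤p+ (seq y N) (seq y n) (proj₂ (h n N≤n))))

gap⇒≰ : ∀ {x y} δ → 0ℚ ℚ.< δ → Eventually (λ n → seq y n ℚ.+ δ ℚ.≤ seq x n) → ¬ x ≤ℝ y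
gap⇒≰ {x} {y} δ δ>0 gap x≤y with halve δ δ>0
... | h , h>0 , ≡.refl with eventually-instance (eventually-× gap (x≤y h h>0))
...   | n , y+2h≤x , x≤y+h = <⇒≱ h>0 (ℚᵒ.no-gap (seq x n) (seq y n) h y+2h≤x x≤y+h)

-- A failed inequality names no ε at which it fails, hence the double negation: if there were no
-- gap, `≤ℝ-or-gap` would return its first alternative for every ε.
≰⇒gap : ∀ {x y} → ¬ x ≤ℝ y →
  ¬ ¬ (∃[ δ ] 0ℚ ℚ.< δ × Eventually (λ n → seq y n ℚ.+ δ ℚ.≤ seq x n))
≰⇒gap {x} {y} x≰y k = x≰y λ ε ε>0 → case (≤ℝ-or-gap x y ε ε>0)
  where
  case : ∀ {ε} → _ ⊎ _ → Eventually (λ n → seq x n ℚ.≤ seq y n ℚ.+ ε)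
  case (inj₁ le)  = le
  case (inj₂ gap) = contradiction gap k

-- For each ε the search in `≤ℝ-or-gap` ends with an answer, and a gap would refute the doubly
-- negated inequality. This makes classical reasoning available for every goal that is an
-- inequality.
≤ℝ-stable : ∀ {x y} → ¬ ¬ x ≤ℝ y → x ≤ℝ y
≤ℝ-stable {x} {y} nn ε ε>0 with ≤ℝ-or-gap x y ε ε>0
... | inj₁ le               = le
... | inj₂ (δ , δ>0 , gap) = contradiction (gap⇒≰ {x} {y} δ δ>0 gap) nn

bounded-pair : ∀ x y → ∃[ B ] 0ℚ ℚ.< B × Eventually λ n →
  (seq x n ℚ.≤ B × ℚ.- B ℚ.≤ seq x n) × (seq y n ℚ.≤ B × ℚ.- B ℚ.≤ seq y n)
bounded-pair x y with cauchy x 1ℚ (ℚ.positive⁻¹ 1ℚ) | cauchy y 1ℚ (ℚ.positive⁻¹ 1ℚ)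
... | M , cx | N , cy = B , B>0 , eventually-×
  (M , λ n M≤n → bound (seq x n) (seq x M) (seq y N) (cx n M M≤n ℕ.≤-refl))
  (N , λ n N≤n → ≡.subst (λ b → seq y n ℚ.≤ b × ℚ.- b ℚ.≤ seq y n)
    (≡.cong (1ℚ ℚ.+_) (ℚ.+-comm ℚ.∣ seq y N ∣ ℚ.∣ seq x M ∣))
    (bound (seq y n) (seq y N) (seq x M) (cy n N N≤n ℕ.≤-refl)))
  where
  B = 1ℚ ℚ.+ (ℚ.∣ seq x M ∣ ℚ.+ ℚ.∣ seq y N ∣)
  B>0 : 0ℚ ℚ.< B
  B>0 = 0<1+B+C ℚ.∣ seq x M ∣ ℚ.∣ seq y N ∣ (ℚ.0≤∣p∣ (seq x M)) (ℚ.0≤∣p∣ (seq y N))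
  0≤p+∣p∣ : ∀ p → 0ℚ ℚ.≤ p ℚ.+ ℚ.∣ p ∣
  0≤p+∣p∣ p = ∣p-q∣≤⇒q≤p+ p 0ℚ (ℚ.≤-reflexive (≡.cong ℚ.∣_∣ (ℚ.+-identityʳ p)))
  bound : ∀ u v w → ℚ.∣ u ℚ.- v ∣ ℚ.≤ 1ℚ →
    (u ℚ.≤ 1ℚ ℚ.+ (ℚ.∣ v ∣ ℚ.+ ℚ.∣ w ∣)) × (ℚ.- (1ℚ ℚ.+ (ℚ.∣ v ∣ ℚ.+ ℚ.∣ w ∣)) ℚ.≤ u)
  bound u v w u~v =
    ℚᵒ.bound-above u v ℚ.∣ v ∣ ℚ.∣ w ∣ 1ℚ (∣p-q∣≤⇒p≤q+ u v u~v) (p≤∣p∣ v) (ℚ.0≤∣p∣ w) ,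
    ℚᵒ.bound-below u v ℚ.∣ v ∣ ℚ.∣ w ∣ 1ℚ (∣p-q∣≤⇒q≤p+ u v u~v) (0≤p+∣p∣ v) (ℚ.0≤∣p∣ w)

≈ℝ⇒≤ℝ : ∀ {x y} → x ≈ℝ y → x ≤ℝ y
≈ℝ⇒≤ℝ {x} {y} x≈y ε ε>0 = eventually-map (λ n → ∣p-q∣≤⇒p≤q+ (seq x n) (seq y n)) (x≈y ε ε>0)

≈ℝ⇒≥ℝ : ∀ {x y} → x ≈ℝ y → y ≤ℝ x
≈ℝ⇒≥ℝ {x} {y} x≈y ε ε>0 = eventually-map (λ n → ∣p-q∣≤⇒q≤p+ (seq x n) (seq y n)) (x≈y ε ε>0)

≤ℝ-antisym : ∀ {x y} → x ≤ℝ y → y ≤ℝ x → x ≈ℝ y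
≤ℝ-antisym {x} {y} x≤y y≤x ε ε>0 = eventually-map (λ n (p , q) → ∣p-q∣≤ (seq x n) (seq y n) p q)
  (eventually-× (x≤y ε ε>0) (y≤x ε ε>0))

≤ℝ-trans : ∀ {x y z} → x ≤ℝ y → y ≤ℝ z → x ≤ℝ z
≤ℝ-trans {x} {y} {z} x≤y y≤z ε ε>0 with halve ε ε>0
... | h , h>0 , ≡.refl = eventually-map
  (λ n (p , q) → ≡.subst (seq x n ℚ.≤_) (ℚ.+-assoc (seq z n) h h) (ℚ.≤-trans p (ℚ.+-monoˡ-≤ h q)))
  (eventually-× (x≤y h h>0) (y≤z h h>0))

≡⇒≈ℝ : ∀ x y → (∀ n → seq x n ≡ seq y n) → x ≈ℝ y
≡⇒≈ℝ x y eq = ≤ℝ-antisym {x} {y} (le x y eq) (le y x (≡.sym ∘ eq))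
  where
  le : ∀ x y → (∀ n → seq x n ≡ seq y n) → x ≤ℝ y
  le x y eq ε ε>0 = always λ n → ≡.subst (λ p → seq x n ℚ.≤ p ℚ.+ ε) (eq n) (p≤p+ε (seq x n) ε>0)

≤⇒≤ℝ : ∀ {x y} → (∀ n → seq x n ℚ.≤ seq y n) → x ≤ℝ y
≤⇒≤ℝ {x} {y} le ε ε>0 = always λ n → ℚ.≤-trans (le n) (p≤p+ε (seq y n) ε>0)

+ℝ-monoˡ-≤ℝ : ∀ {x y} z → x ≤ℝ y → x +ℝ z ≤ℝ y +ℝ z
+ℝ-monoˡ-≤ℝ {x} {y} z x≤y ε ε>0 = eventually-map
  (λ n p → ≡.subst (seq x n ℚ.+ seq z n ℚ.≤_) (ℚᵒ.+-assocʳ-comm (seq y n) ε (seq z n))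
    (ℚ.+-monoˡ-≤ (seq z n) p))
  (x≤y ε ε>0)
  where open ℚᵒ using (_:+_; _:=_)

-- The terms of a nonnegative real may be slightly negative. If both factors lie between -δ and B,
-- with δ ≤ 1, their product is at least -(1 + 2B)δ; so δ is taken to be ε divided by 1 + 2B.
*ℝ-nonneg : ∀ {x y} → 0ℝ ≤ℝ x → 0ℝ ≤ℝ y → 0ℝ ≤ℝ x *ℝ y
*ℝ-nonneg {x} {y} 0≤x 0≤y ε ε>0 = choose (ε ℚ.≤? 1ℚ)
  where
  small : ∀ ε → 0ℚ ℚ.< ε → ε ℚ.≤ 1ℚ → Eventually λ n → 0ℚ ℚ.≤ seq x n ℚ.* seq y n ℚ.+ ε
  small ε ε>0 ε≤1 =
    let B , B>0 , bound = bounded-pair x y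
        0≤B = ℚ.<⇒≤ B>0
        δ , δ>0 , Dδ≡ε = scale-to (1ℚ ℚ.+ (B ℚ.+ B)) (0<1+B+C B B 0≤B 0≤B) ε ε>0
        δ≤1 = ℚ.≤-trans (≡.subst (δ ℚ.≤_) Dδ≡ε (ℚᵒ.d≤[1+B+B]*d B δ 0≤B (ℚ.<⇒≤ δ>0))) ε≤1
        K , h = eventually-× (eventually-× (0≤x δ δ>0) (0≤y δ δ>0)) bound
    in K , λ n K≤n →
      let (0≤x+δ , 0≤y+δ) , (x≤B , _) , (y≤B , _) = h n K≤n
      in ≡.subst (λ e → 0ℚ ℚ.≤ seq x n ℚ.* seq y n ℚ.+ e) Dδ≡ε
           (ℚᵒ.*-almost-nonneg B δ (seq x n) (seq y n) (ℚ.<⇒≤ δ>0) δ≤1 0≤x+δ 0≤y+δ x≤B y≤B)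
  -- The condition δ ≤ 1 follows from ε ≤ 1; for a larger ε the bound obtained for 1 is good enough.
  choose : Dec (ε ℚ.≤ 1ℚ) → Eventually λ n → 0ℚ ℚ.≤ seq x n ℚ.* seq y n ℚ.+ ε
  choose (yes ε≤1) = small ε ε>0 ε≤1
  choose (no ε≰1)  =
    let K , h = small 1ℚ (ℚ.positive⁻¹ 1ℚ) ℚ.≤-refl
    in K , λ n K≤n → ℚ.≤-trans (h n K≤n) (ℚ.+-monoʳ-≤ (seq x n ℚ.* seq y n) (ℚ.<⇒≤ (ℚ.≰⇒> ε≰1)))

-- The conclusion is a negation, so gaps may be taken out of their double negations, and the product
-- of two gaps above zero is again such a gap.
*ℝ-positive : ∀ {x y} → ¬ x ≤ℝ 0ℝ → ¬ y ≤ℝ 0ℝ → ¬ x *ℝ y ≤ℝ 0ℝ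
*ℝ-positive {x} {y} x≰0 y≰0 xy≤0 = ≰⇒gap {x} {0ℝ} x≰0 λ (δ , δ>0 , x≥δ) → ≰⇒gap {y} {0ℝ} y≰0 λ (η , η>0 , y≥η) →
  gap⇒≰ {x *ℝ y} {0ℝ} (δ ℚ.* η)
    (ℚ.positive⁻¹ _ {{ℚ.pos*pos⇒pos δ {{ℚ.positive δ>0}} η {{ℚ.positive η>0}}}})
    (let K , h = eventually-× x≥δ y≥η in K , λ n K≤n →
      ℚᵒ.*-gap δ η (seq x n) (seq y n) (ℚ.<⇒≤ δ>0) (ℚ.<⇒≤ η>0) (proj₁ (h n K≤n)) (proj₂ (h n K≤n)))
    xy≤0

*ℝ-congˡ : ∀ {x y} z → x ≈ℝ y → z *ℝ x ≈ℝ z *ℝ y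
*ℝ-congˡ {x} {y} z x≈y ε ε>0 =
  let B , B>0 , bound = bounded-pair z z
      δ , δ>0 , Bδ≡ε = scale-to B B>0 ε ε>0
      K , h = eventually-× (x≈y δ δ>0) bound
  in K , λ n K≤n →
    let d , (z≤B , -B≤z) , _ = h n K≤n
    in ≡.subst (ℚ.∣ seq z n ℚ.* seq x n ℚ.- seq z n ℚ.* seq y n ∣ ℚ.≤_) Bδ≡ε
         (close B δ (seq x n) (seq y n) (seq z n) z≤B -B≤z d)
  where
  close : ∀ B δ u v w → w ℚ.≤ B → ℚ.- B ℚ.≤ w → ℚ.∣ u ℚ.- v ∣ ℚ.≤ δ →
    ℚ.∣ w ℚ.* u ℚ.- w ℚ.* v ∣ ℚ.≤ B ℚ.* δ
  close B δ u v w w≤B -B≤w u~v = ℚ.≤-trans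
    (ℚ.≤-reflexive (≡.trans (≡.cong ℚ.∣_∣ (ℚᵒ.*-distribˡ-- w u v)) (ℚ.∣p*q∣≡∣p∣*∣q∣ w (u ℚ.- v))))
    (ℚ.≤-trans (ℚᵒ.*-monoˡ-≤ {ℚ.∣ u ℚ.- v ∣} {δ} {ℚ.∣ w ∣} (ℚ.0≤∣p∣ w) u~v)
      (ℚᵒ.*-monoʳ-≤ {ℚ.∣ w ∣} {B} {δ} (ℚ.≤-trans (ℚ.0≤∣p∣ (u ℚ.- v)) u~v) ∣w∣≤B))
    where
    ∣w∣≤B : ℚ.∣ w ∣ ℚ.≤ B
    ∣w∣≤B = ≡.subst (λ p → ℚ.∣ p ∣ ℚ.≤ B) (ℚ.+-identityʳ w) (∣p-q∣≤ w 0ℚ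
      (≡.subst (w ℚ.≤_) (≡.sym (ℚ.+-identityˡ B)) w≤B) (ℚᵒ.-y≤x⇒0≤x+y w B -B≤w))

-ℝ-cong : ∀ {x y} → x ≈ℝ y → (-ℝ x) ≈ℝ (-ℝ y)
-ℝ-cong {x} {y} x≈y ε ε>0 = eventually-map (λ n → ≡.subst (ℚ._≤ ε) (swap (seq x n) (seq y n))) (x≈y ε ε>0)
  where
  swap : ∀ u v → ℚ.∣ u ℚ.- v ∣ ≡ ℚ.∣ ℚ.- u ℚ.- ℚ.- v ∣
  swap u v = ≡.trans (≡.sym (ℚ.∣-p∣≡∣p∣ (u ℚ.- v)))
    (≡.cong ℚ.∣_∣ (≡.sym (ℚᵒ.-x--y≈-[x-y] u v)))

ℝ-commutativeRing : CommutativeRing 0ℓ 0ℓ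
ℝ-commutativeRing = record
  { Carrier = ℝ ; _≈_ = _≈ℝ_ ; _+_ = _+ℝ_ ; _*_ = _*ℝ_ ; -_ = -ℝ_ ; 0# = 0ℝ ; 1# = fromℚ 1ℚ
  ; isCommutativeRing = record
    { isRing = record
      { +-isAbelianGroup = record
        { isGroup = record
          { isMonoid = record
            { isSemigroup = record
              { isMagma = record
                { isEquivalence = ≈ℝ-isEquivalence
                ; ∙-cong = λ {x} {y} {u} {v} → +ℝ-cong {x} {y} {u} {v}
                }
              ; assoc = λ x y z → ≡⇒≈ℝ ((x +ℝ y) +ℝ z) (x +ℝ (y +ℝ z)) λ n → ℚ.+-assoc (seq x n) (seq y n) (seq z n)
              }
            ; identity = (λ x → ≡⇒≈ℝ (0ℝ +ℝ x) x λ n → ℚ.+-identityˡ (seq x n)) , (λ x → ≡⇒≈ℝ (x +ℝ 0ℝ) x λ n → ℚ.+-identityʳ (seq x n))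
            }
          ; inverse = (λ x → ≡⇒≈ℝ (-ℝ x +ℝ x) 0ℝ λ n → ℚ.+-inverseˡ (seq x n)) , (λ x → ≡⇒≈ℝ (x +ℝ -ℝ x) 0ℝ λ n → ℚ.+-inverseʳ (seq x n))
          ; ⁻¹-cong = λ {x} {y} → -ℝ-cong {x} {y}
          }
        ; comm = +ℝ-comm
        }
      ; *-cong = λ {x} {y} {u} {v} x≈y u≈v → ≈ℝ-trans {x *ℝ u} {x *ℝ v} {y *ℝ v}
          (*ℝ-congˡ {u} {v} x u≈v)
          (≈ℝ-trans {x *ℝ v} {v *ℝ x} {y *ℝ v} (*ℝ-comm x v)
            (≈ℝ-trans {v *ℝ x} {v *ℝ y} {y *ℝ v} (*ℝ-congˡ {x} {y} v x≈y) (*ℝ-comm v y)))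
      ; *-assoc = λ x y z → ≡⇒≈ℝ ((x *ℝ y) *ℝ z) (x *ℝ (y *ℝ z)) λ n → ℚ.*-assoc (seq x n) (seq y n) (seq z n)
      ; *-identity = (λ x → ≡⇒≈ℝ (fromℚ 1ℚ *ℝ x) x λ n → ℚ.*-identityˡ (seq x n)) , (λ x → ≡⇒≈ℝ (x *ℝ fromℚ 1ℚ) x λ n → ℚ.*-identityʳ (seq x n))
      ; distrib = (λ x y z → ≡⇒≈ℝ (x *ℝ (y +ℝ z)) (x *ℝ y +ℝ x *ℝ z) λ n → ℚ.*-distribˡ-+ (seq x n) (seq y n) (seq z n)) ,
                  (λ x y z → ≡⇒≈ℝ ((y +ℝ z) *ℝ x) (y *ℝ x +ℝ z *ℝ x) λ n → ℚ.*-distribʳ-+ (seq x n) (seq y n) (seq z n))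
      }
    ; *-comm = *ℝ-comm
    }
  }
  where
  ≈ℝ-trans : ∀ {x y z} → x ≈ℝ y → y ≈ℝ z → x ≈ℝ z
  ≈ℝ-trans {x} {y} {z} x≈y y≈z = ≤ℝ-antisym {x} {z}
    (≤ℝ-trans {x} {y} {z} (≈ℝ⇒≤ℝ {x} {y} x≈y) (≈ℝ⇒≤ℝ {y} {z} y≈z))
    (≤ℝ-trans {z} {y} {x} (≈ℝ⇒≥ℝ {y} {z} y≈z) (≈ℝ⇒≥ℝ {x} {y} x≈y))
  ≈ℝ-isEquivalence : IsEquivalence _≈ℝ_
  ≈ℝ-isEquivalence = record
    { refl  = λ {x} → ≡⇒≈ℝ x x λ _ → ≡.refl
    ; sym   = λ {x} {y} x≈y → ≤ℝ-antisym {y} {x} (≈ℝ⇒≥ℝ {x} {y} x≈y) (≈ℝ⇒≤ℝ {x} {y} x≈y)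
    ; trans = λ {x} {y} {z} → ≈ℝ-trans {x} {y} {z}
    }
  +ℝ-comm : ∀ x y → x +ℝ y ≈ℝ y +ℝ x
  +ℝ-comm x y = ≡⇒≈ℝ (x +ℝ y) (y +ℝ x) λ n → ℚ.+-comm (seq x n) (seq y n)
  *ℝ-comm : ∀ x y → x *ℝ y ≈ℝ y *ℝ x
  *ℝ-comm x y = ≡⇒≈ℝ (x *ℝ y) (y *ℝ x) λ n → ℚ.*-comm (seq x n) (seq y n)
  +ℝ-congʳ : ∀ {x y} z → x ≈ℝ y → x +ℝ z ≈ℝ y +ℝ z
  +ℝ-congʳ {x} {y} z x≈y = ≤ℝ-antisym {x +ℝ z} {y +ℝ z}
    (+ℝ-monoˡ-≤ℝ {x} {y} z (≈ℝ⇒≤ℝ {x} {y} x≈y)) (+ℝ-monoˡ-≤ℝ {y} {x} z (≈ℝ⇒≥ℝ {x} {y} x≈y))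
  +ℝ-cong : ∀ {x y u v} → x ≈ℝ y → u ≈ℝ v → x +ℝ u ≈ℝ y +ℝ v
  +ℝ-cong {x} {y} {u} {v} x≈y u≈v = ≈ℝ-trans {x +ℝ u} {y +ℝ u} {y +ℝ v} (+ℝ-congʳ {x} {y} u x≈y)
    (≈ℝ-trans {y +ℝ u} {u +ℝ y} {y +ℝ v} (+ℝ-comm y u)
      (≈ℝ-trans {u +ℝ y} {v +ℝ y} {y +ℝ v} (+ℝ-congʳ {u} {v} y u≈v) (+ℝ-comm v y)))

ℝ-ordered : OrderedRing
ℝ-ordered = record
  { commutativeRing = ℝ-commutativeRing
  ; _≤_             = _≤ℝ_
  ; ≤-reflexive     = λ {x} {y} → ≈ℝ⇒≤ℝ {x} {y}
  ; ≤-trans         = λ {x} {y} {z} → ≤ℝ-trans {x} {y} {z}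
  ; ≤-antisym       = λ {x} {y} → ≤ℝ-antisym {x} {y}
  ; +-monoˡ-≤       = λ {x} {y} → +ℝ-monoˡ-≤ℝ {x} {y}
  ; *-nonneg        = λ {x} {y} → *ℝ-nonneg {x} {y}
  ; *-positive      = λ {x} {y} → *ℝ-positive {x} {y}
  ; ≰⇒≥             = λ {x} {y} x≰y → ≤ℝ-stable {y} {x} λ y≰x →
      ≰⇒gap {x} {y} x≰y λ (δ , δ>0 , y+δ≤x) → y≰x λ ε ε>0 →
        eventually-map (λ n le → ℚ.≤-trans (ℚ.≤-trans (p≤p+ε (seq y n) δ>0) le) (p≤p+ε (seq x n) ε>0)) y+δ≤x
  ; ≤-stable        = λ {x} {y} → ≤ℝ-stable {x} {y}
  ; 1≰0             = gap⇒≰ {fromℚ 1ℚ} {0ℝ} 1ℚ (ℚ.positive⁻¹ 1ℚ) (always λ n → ℚ.≤-refl)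
  ; ℤ-morphism      = record
    { ⟦_⟧    = from
    ; +-homo = λ i j → ≡⇒≈ℝ (from (i ℤ.+ j)) (from i +ℝ from j) λ _ → ℚᵒ.fromℤ-+ i j
    ; *-homo = λ i j → ≡⇒≈ℝ (from (i ℤ.* j)) (from i *ℝ from j) λ _ → ℚᵒ.fromℤ-* i j
    ; -‿homo = λ i → ≡⇒≈ℝ (from (ℤ.- i)) (-ℝ (from i)) λ _ → _-Raw-AlmostCommutative⟶_.-‿homo ℤ→ℚ-morphism i
    ; 0-homo = ≡⇒≈ℝ (from (+ 0)) 0ℝ λ _ → ≡.refl
    ; 1-homo = ≡⇒≈ℝ (from (+ 1)) (fromℚ 1ℚ) λ _ → ≡.refl
    }
  }
  where
  from : ℤ → ℝ
  from i = fromℚ (ℚᵒ.fromℤ i)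

ℚ≤fromℕ : ∀ p → ∃[ N ] p ℚ.≤ ℚᵒ.fromℕ N
ℚ≤fromℕ p@(ℚ.mkℚ n d _) = ℤ.∣ n ∣ , ℚ.toℚᵘ-cancel-≤ (ℚᵘ.≤-trans
  (*≤* (ℤ.≤-trans (ℤ.≤-reflexive (ℤ.*-identityʳ n)) (n≤∣n∣*d n)))
  (ℚᵘ.≤-reflexive (ℚᵘ.≃-sym (ℚ.toℚᵘ-fromℚᵘ (mkℚᵘ (+ ℤ.∣ n ∣) 0)))))
  where
  n≤∣n∣*d : ∀ n → n ℤ.≤ + ℤ.∣ n ∣ ℤ.* + suc d
  n≤∣n∣*d (+ n)        = ≡.subst (+ n ℤ.≤_) (ℤ.pos-* n (suc d)) (ℤ.+≤+ (ℕ.m≤m*n n (suc d)))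
  n≤∣n∣*d (ℤ.-[1+ n ]) = ≡.subst (ℤ.-[1+ n ] ℤ.≤_) (ℤ.pos-* (suc n) (suc d)) ℤ.-≤+

archimedean : ∀ D ε → 0ℚ ℚ.< ε → ∃[ N ] D ℚ.≤ ℚᵒ.fromℕ (suc N) ℚ.* ε
archimedean D ε ε>0 =
  let η , η>0 , εη≡1 = scale-to ε ε>0 1ℚ (ℚ.positive⁻¹ 1ℚ)
      N , Dη≤N = ℚ≤fromℕ (D ℚ.* η)
      Dη≤1+N = ℚ.≤-trans {D ℚ.* η} {ℚᵒ.fromℕ N} {ℚᵒ.fromℕ (suc N)} Dη≤N (≡.subst (ℚᵒ.fromℕ N ℚ.≤_) (≡.trans (ℚ.+-comm (ℚᵒ.fromℕ N) 1ℚ) (≡.sym (ℚᵒ.fromℕ-suc N)))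
        (p≤p+ε (ℚᵒ.fromℕ N) (ℚ.positive⁻¹ 1ℚ)))
  in N , ≡.subst (ℚ._≤ ℚᵒ.fromℕ (suc N) ℚ.* ε)
    (≡.trans (ℚ.*-assoc D η ε) (≡.trans (≡.cong (D ℚ.*_) (≡.trans (ℚ.*-comm η ε) εη≡1)) (ℚ.*-identityʳ D)))
    (ℚᵒ.*-monoʳ-≤ {D ℚ.* η} {ℚᵒ.fromℕ (suc N)} {ε} (ℚ.<⇒≤ ε>0) Dη≤1+N)

-- Neither monotonicity nor continuity of `P` enters: the invariant is that it fails at the lower
-- end and holds at the upper end. `limitˡ` and `limitʳ` represent the same real by the two
-- sequences of ends. Nonstrict inequalities contained in `P` pass to the limit along the second,
-- while the failure of `P` is known along the first.
module Bisection (P : ℚ → Set) (P? : ∀ p → Dec (P p)) (a D : ℚ) (0≤D : 0ℚ ℚ.≤ D)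
                 (¬Pa : ¬ P a) (Pb : P (a ℚ.+ D)) where

  width lower : ℕ → ℚ
  width zero    = D
  width (suc n) = ½ ℚ.* width n
  lower zero    = a
  lower (suc n) with P? (lower n ℚ.+ ½ ℚ.* width n)
  ... | yes _ = lower n
  ... | no  _ = lower n ℚ.+ ½ ℚ.* width n

  halves : ∀ n → ½ ℚ.* width n ℚ.+ ½ ℚ.* width n ≡ width n
  halves n = ≡.trans (≡.sym (ℚ.*-distribʳ-+ (width n) ½ ½)) (ℚ.*-identityˡ (width n))

  width-bounds : ∀ n → 0ℚ ℚ.≤ width n × width n ℚ.≤ D
  width-bounds zero    = 0≤D , ℚ.≤-refl
  width-bounds (suc n) =
    let 0≤w , w≤D = width-bounds n in ℚᵒ.halving-≤ D (width n) (½ ℚ.* width n) 0≤w (halves n) w≤D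

  N*width≤D : ∀ n → ℚᵒ.fromℕ n ℚ.* width n ℚ.≤ D
  N*width≤D zero    = ≡.subst (ℚ._≤ D) (≡.sym (ℚ.*-zeroˡ D)) 0≤D
  N*width≤D (suc n) = ℚᵒ.halving-bound n D (width n) (½ ℚ.* width n) (halves n) (proj₂ (width-bounds n)) (N*width≤D n)

  lower-step : ∀ n → lower n ℚ.≤ lower (suc n)
  lower-step n with P? (lower n ℚ.+ ½ ℚ.* width n)
  ... | yes _ = ℚ.≤-refl
  ... | no  _ = ℚᵒ.≤-by {lower n} {_} {½ ℚ.* width n} (proj₁ (width-bounds (suc n))) ≡.refl

  upper-step : ∀ n → lower (suc n) ℚ.+ width (suc n) ℚ.≤ lower n ℚ.+ width n
  upper-step n with P? (lower n ℚ.+ ½ ℚ.* width n)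
  ... | yes _ = ℚ.+-monoʳ-≤ (lower n) (ℚᵒ.≤-by {½ ℚ.* width n} {width n} {½ ℚ.* width n}
                  (proj₁ (width-bounds (suc n))) (≡.sym (halves n)))
  ... | no  _ = ℚ.≤-reflexive (≡.trans (ℚ.+-assoc (lower n) (½ ℚ.* width n) (½ ℚ.* width n)) (≡.cong (lower n ℚ.+_) (halves n)))

  ¬P-lower : ∀ n → ¬ P (lower n)
  ¬P-lower zero    = ¬Pa
  ¬P-lower (suc n) with P? (lower n ℚ.+ ½ ℚ.* width n)
  ... | yes _ = ¬P-lower n
  ... | no ¬p = ¬p

  P-upper : ∀ n → P (lower n ℚ.+ width n)
  P-upper zero    = Pb
  P-upper (suc n) with P? (lower n ℚ.+ ½ ℚ.* width n)
  ... | yes p = p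
  ... | no _  = ≡.subst P (≡.sym (≡.trans (ℚ.+-assoc (lower n) (½ ℚ.* width n) (½ ℚ.* width n)) (≡.cong (lower n ℚ.+_) (halves n)))) (P-upper n)

  lower-mono : ∀ {m n} → m ℕ.≤′ n → lower m ℚ.≤ lower n
  lower-mono ℕ.≤′-refl       = ℚ.≤-refl
  lower-mono (ℕ.≤′-step m≤n) = ℚ.≤-trans (lower-mono m≤n) (lower-step _)

  upper-mono : ∀ {m n} → m ℕ.≤′ n → lower n ℚ.+ width n ℚ.≤ lower m ℚ.+ width m
  upper-mono ℕ.≤′-refl       = ℚ.≤-refl
  upper-mono (ℕ.≤′-step m≤n) = ℚ.≤-trans (upper-step _) (upper-mono m≤n)

  a≤lower : ∀ n → a ℚ.≤ lower n
  a≤lower n = lower-mono {0} {n} ℕ.z≤′n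

  width→0 : ∀ ε → 0ℚ ℚ.< ε → ∃[ N ] width N ℚ.≤ ε
  width→0 ε ε>0 = let N , D≤ = archimedean D ε ε>0 in
    suc N , ℚᵒ.*-large-cancel N (width (suc N)) ε D D≤ (N*width≤D (suc N))

  lower≤upper : ∀ n → lower n ℚ.≤ lower n ℚ.+ width n
  lower≤upper n = ℚᵒ.≤-by {lower n} {_} {width n} (proj₁ (width-bounds n)) ≡.refl

  limit-cauchy : ∀ (x : ℕ → ℚ) → (∀ n → lower n ℚ.≤ x n) → (∀ n → x n ℚ.≤ lower n ℚ.+ width n) → IsCauchy x
  limit-cauchy x lower≤x x≤upper ε ε>0 = let N , w≤ε = width→0 ε ε>0 in N , λ i j N≤i N≤j →
    ℚ.≤-trans (∣p-q∣≤ (x i) (x j) (near N N≤j N≤i) (near N N≤i N≤j)) w≤ε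
    where
    near : ∀ N {i j} → N ℕ.≤ i → N ℕ.≤ j → x j ℚ.≤ x i ℚ.+ width N
    near N {i} {j} N≤i N≤j = ℚᵒ.interval-≤ (lower N) (width N) (x i) (x j)
      (ℚ.≤-trans (lower-mono (ℕ.≤⇒≤′ N≤i)) (lower≤x i)) (ℚ.≤-trans (x≤upper j) (upper-mono (ℕ.≤⇒≤′ N≤j)))

  limitˡ limitʳ : ℝ
  limitˡ = mkℝ lower (limit-cauchy lower (λ n → ℚ.≤-refl) lower≤upper)
  limitʳ = mkℝ (λ n → lower n ℚ.+ width n) (limit-cauchy (λ n → lower n ℚ.+ width n) lower≤upper (λ n → ℚ.≤-refl))

  limits-equal : limitˡ ≈ℝ limitʳ
  limits-equal ε ε>0 = let N , w≤ε = width→0 ε ε>0 in N , λ n N≤n →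
    ∣p-q∣≤ (lower n) (lower n ℚ.+ width n)
      (ℚ.≤-trans (lower≤upper n) (p≤p+ε (lower n ℚ.+ width n) ε>0))
      (ℚ.≤-trans (ℚᵒ.interval-≤ (lower N) (width N) (lower n) (lower n ℚ.+ width n)
        (lower-mono (ℕ.≤⇒≤′ N≤n)) (upper-mono (ℕ.≤⇒≤′ N≤n))) (ℚ.+-monoʳ-≤ (lower n) w≤ε))

-- The spectral radius of T₁C(ℓ,0,1,0)

-- Write m = q + 2 and w + q for an eigenvalue of m - 1 times the adjacency matrix of a power hypergraph. The new
-- vertices of an edge uv have the value (x u + x v) / (w + 1), and eliminating them turns the eigenvalue equation at
-- v into (tw + Q)(x v) = ∑ (t (x u) + Q (x v)), summed over the neighbours u of v. For T₁C(ℓ,0,1,0), eliminating also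
-- the leaves and the two vertices of degree 2 leaves E₂h = Gc and E₁c = Gh for the values h and c at v₁ and v₃.
module Characteristic (R : OrderedRing) (q ℓ : ℕ) where

  open OrderedRingProperties R

  Q L : Carrier
  Q = fromℕ q
  L = fromℕ ℓ

  -- `κ` is the coefficient of a vertex of degree 2 after its own terms are collected: κa = t(h +
  -- c). A leaf times w is the value of its neighbour. With these substituted and the equations
  -- multiplied by κw, `E₂` is the coefficient of the hub, of degree ℓ + 3, `E₁` that of v₃, of
  -- degree 4, and `G` couples the two.
  t κ E₁ E₂ G : Carrier → Carrier
  t  w = w + fromℕ 1 + Q
  κ  w = t w * w - Q
  E₁ w = (t w * w - (Q + Q + Q)) * (κ w * w) - t w * (t w * w + t w * w + κ w)
  E₂ w = (t w * w - (L * Q + Q + Q)) * (κ w * w) - t w * (t w * w + t w * w + L * κ w)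
  G  w = t w * w * (κ w + t w + t w)

  -- Positive semidefiniteness of E₂h² - 2Ghc + E₁c², the form left in h and c after the
  -- elimination. The root is a boundary point of this condition, where the form degenerates.
  Good : Carrier → Set
  Good w = 0# ≤ E₁ w × 0# ≤ E₂ w × G w * G w ≤ E₁ w * E₂ w

  private
    tᵖ κᵖ Gᵖ : ∀ {n} → Polynomial n → Polynomial n → Polynomial n
    tᵖ Q w = w :+ con (+ 1) :+ Q
    κᵖ Q w = tᵖ Q w :* w :- Q
    Gᵖ Q w = tᵖ Q w :* w :* (κᵖ Q w :+ tᵖ Q w :+ tᵖ Q w)
    E₁ᵖ : ∀ {n} → Polynomial n → Polynomial n → Polynomial n
    E₁ᵖ Q w = (tᵖ Q w :* w :- (Q :+ Q :+ Q)) :* (κᵖ Q w :* w) :- tᵖ Q w :* (tᵖ Q w :* w :+ tᵖ Q w :* w :+ κᵖ Q w)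
    E₂ᵖ : ∀ {n} → Polynomial n → Polynomial n → Polynomial n → Polynomial n
    E₂ᵖ Q L w = (tᵖ Q w :* w :- (L :* Q :+ Q :+ Q)) :* (κᵖ Q w :* w) :- tᵖ Q w :* (tᵖ Q w :* w :+ tᵖ Q w :* w :+ L :* κᵖ Q w)

  t-cong : ∀ {u v} → u ≈ v → t u ≈ t v
  t-cong eq = +-congʳ (+-congʳ eq)

  κ-cong : ∀ {u v} → u ≈ v → κ u ≈ κ v
  κ-cong eq = +-congʳ (*-cong (t-cong eq) eq)

  E₁-cong : ∀ {u v} → u ≈ v → E₁ u ≈ E₁ v
  E₁-cong eq = +-cong (*-cong (+-congʳ (*-cong (t-cong eq) eq)) (*-cong (κ-cong eq) eq))
    (-‿cong (*-cong (t-cong eq) (+-cong (+-cong (*-cong (t-cong eq) eq) (*-cong (t-cong eq) eq)) (κ-cong eq))))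

  E₂-cong : ∀ {u v} → u ≈ v → E₂ u ≈ E₂ v
  E₂-cong eq = +-cong (*-cong (+-congʳ (*-cong (t-cong eq) eq)) (*-cong (κ-cong eq) eq))
    (-‿cong (*-cong (t-cong eq) (+-cong (+-cong (*-cong (t-cong eq) eq) (*-cong (t-cong eq) eq)) (*-congˡ (κ-cong eq)))))

  G-cong : ∀ {u v} → u ≈ v → G u ≈ G v
  G-cong eq = *-cong (*-cong (t-cong eq) eq) (+-cong (+-cong (κ-cong eq) (t-cong eq)) (t-cong eq))

  0≤Q : 0# ≤ Q
  0≤Q = 0≤fromℕ q

  0≤L : 0# ≤ L
  0≤L = 0≤fromℕ ℓ

  0<fromℕ-suc : ∀ n → 0# < fromℕ (suc n)
  0<fromℕ-suc n = <-respʳ (sym (fromℕ-suc n)) (+-pos-nonneg 0<1 (0≤fromℕ n))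

  module _ {w} (1≤w : fromℕ 1 ≤ w) where

    0<w : 0# < w
    0<w = <-≤-trans (0<fromℕ-suc 0) 1≤w

    0≤w : 0# ≤ w
    0≤w = <⇒≤ 0<w

    0<t : 0# < t w
    0<t = +-pos-nonneg (+-pos-nonneg 0<w (0≤fromℕ 1)) 0≤Q

    0≤t : 0# ≤ t w
    0≤t = <⇒≤ 0<t

    0<κ : 0# < κ w
    0<κ = <-respʳ
      (solve 2 (λ Q w → w :+ (w :* w :+ Q :* (w :- con (+ 1))) := κᵖ Q w) refl Q w)
      (+-pos-nonneg 0<w (+-nonneg (*-nonneg 0≤w 0≤w) (*-nonneg 0≤Q (0≤y-x 1≤w))))

    0≤κ : 0# ≤ κ w
    0≤κ = <⇒≤ 0<κ

    0<G : 0# < G w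
    0<G = *-positive (*-positive 0<t 0<w) (+-pos-nonneg (+-pos-nonneg 0<κ 0≤t) 0≤t)

  -- E₁(1) = -(8 + 14Q + 2Q²), which is negative.
  ¬Good-1 : ¬ Good (fromℕ 1)
  ¬Good-1 (0≤E₁ , _) = +-pos-nonneg (0<fromℕ-suc 7)
    (+-nonneg (*-nonneg (0≤fromℕ 14) 0≤Q) (*-nonneg (0≤fromℕ 2) (*-nonneg 0≤Q 0≤Q)))
    (≤-trans (≤-by 0≤E₁ refl) (≤-reflexive (trans
      (solve 1 (λ Q → con (+ 8) :+ (con (+ 14) :* Q :+ con (+ 2) :* (Q :* Q)) :+ E₁ᵖ Q (con (+ 1)) := con (+ 0)) refl Q)
      fromℤ-0)))

  -- It suffices that both E₁ and E₂ dominate G ≥ 0. With w = L + 6 all coefficients in the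
  -- expansions of E₁ - G and E₂ - G are nonnegative.
  Good-large : Good (L + fromℕ 6)
  Good-large = ≤-trans 0≤G G≤E₁ , ≤-trans 0≤G G≤E₂ ,
    ≤-trans (*-monoʳ-≤ 0≤G G≤E₁) (*-monoˡ-≤ (≤-trans 0≤G G≤E₁) G≤E₂)
    where
    w e : Carrier
    w = L + fromℕ 6
    e = w + fromℕ 1
    1≤w : fromℕ 1 ≤ w
    1≤w = ≤-by (+-nonneg 0≤L (0≤fromℕ 5)) (solve 1 (λ L → L :+ con (+ 6) := con (+ 1) :+ (L :+ con (+ 5))) refl L)
    0≤G : 0# ≤ G w
    0≤G = <⇒≤ (0<G 1≤w)
    0≤e : 0# ≤ e
    0≤e = +-nonneg (0≤w 1≤w) (0≤fromℕ 1)
    LL = *-nonneg 0≤L 0≤L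
    κew : 0# ≤ κ w * (e * w)
    κew = *-nonneg (0≤κ 1≤w) (*-nonneg 0≤e (0≤w 1≤w))
    -- Both differences are expanded in t and e = t - Q.
    G≤E₁ : G w ≤ E₁ w
    G≤E₁ = ≤-by
      (+-nonneg (*-nonneg (+-nonneg (*-nonneg 0≤L (+-nonneg (+-nonneg LL (*-nonneg (0≤fromℕ 13) 0≤L)) (0≤fromℕ 47))) (0≤fromℕ 31))
                  (*-nonneg (0≤t 1≤w) (0≤t 1≤w)))
        (+-nonneg (*-nonneg (+-nonneg (+-nonneg LL (*-nonneg (0≤fromℕ 8) 0≤L)) (0≤fromℕ 11)) (*-nonneg 0≤e (0≤t 1≤w)))
                  (*-nonneg (0≤fromℕ 3) κew)))
      (solve 2 (λ Q L → let w = L :+ con (+ 6) ; t = tᵖ Q w ; e = w :+ con (+ 1) in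
        E₁ᵖ Q w := Gᵖ Q w :+ ((L :* ((L :* L :+ con (+ 13) :* L) :+ con (+ 47)) :+ con (+ 31)) :* (t :* t)
          :+ (((L :* L :+ con (+ 8) :* L) :+ con (+ 11)) :* (e :* t) :+ con (+ 3) :* (κᵖ Q w :* (e :* w))))) refl Q L)
    G≤E₂ : G w ≤ E₂ w
    G≤E₂ = ≤-by
      (+-nonneg (*-nonneg (+-nonneg (+-nonneg (*-nonneg (0≤fromℕ 2) LL) (*-nonneg (0≤fromℕ 24) 0≤L)) (0≤fromℕ 66))
                  (*-nonneg (0≤t 1≤w) (0≤t 1≤w)))
        (+-nonneg (*-nonneg (+-nonneg (*-nonneg (0≤fromℕ 2) 0≤L) (0≤fromℕ 18)) (*-nonneg 0≤e (0≤t 1≤w)))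
                  (*-nonneg (+-nonneg 0≤L (0≤fromℕ 2)) κew)))
      (solve 2 (λ Q L → let w = L :+ con (+ 6) ; t = tᵖ Q w ; e = w :+ con (+ 1) in
        E₂ᵖ Q L w := Gᵖ Q w :+ (((con (+ 2) :* (L :* L) :+ con (+ 24) :* L) :+ con (+ 66)) :* (t :* t)
          :+ ((con (+ 2) :* L :+ con (+ 18)) :* (e :* t) :+ (L :+ con (+ 2)) :* (κᵖ Q w :* (e :* w))))) refl Q L)

  Good-upper : Good (fromℕ 1 + (L + fromℕ 5))
  Good-upper =
    let 0≤E₁ , 0≤E₂ , GG≤ = Good-large
    in ≤-respʳ (E₁-cong eq) 0≤E₁ , ≤-respʳ (E₂-cong eq) 0≤E₂ ,
       ≤-resp (*-cong (G-cong eq) (G-cong eq)) (*-cong (E₁-cong eq) (E₂-cong eq)) GG≤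
    where
    eq : L + fromℕ 6 ≈ fromℕ 1 + (L + fromℕ 5)
    eq = solve 1 (λ L → L :+ con (+ 6) := con (+ 1) :+ (L :+ con (+ 5))) refl L

-- All that later parts know about the root. It is stated over any ordered ring, so that the linear
-- algebra never unfolds the bisection.
record CharacteristicRoot (R : OrderedRing) (q ℓ : ℕ) : Set where
  open OrderedRingProperties R
  open Characteristic R q ℓ using (E₁; E₂; G)
  field
    w       : Carrier
    1≤w     : fromℕ 1 ≤ w
    0<E₁    : 0# < E₁ w
    0<E₂    : 0# < E₂ w
    E₁E₂≈GG : E₁ w * E₂ w ≈ G w * G w

characteristicRoot : ∀ q ℓ → CharacteristicRoot ℝ-ordered q ℓ
characteristicRoot q ℓ = record { w = w ; 1≤w = 1≤w ; 0<E₁ = 0<E₁ ; 0<E₂ = 0<E₂ ; E₁E₂≈GG = E₁E₂≈GG }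
  where
  module χ = Characteristic ℚ-ordered q ℓ
  open Characteristic ℝ-ordered q ℓ
  open OrderedRingProperties ℝ-ordered
  good? : ∀ p → Dec (χ.Good p)
  good? p = (0ℚ ℚ.≤? χ.E₁ p) ×-dec ((0ℚ ℚ.≤? χ.E₂ p) ×-dec (χ.G p ℚ.* χ.G p ℚ.≤? χ.E₁ p ℚ.* χ.E₂ p))
  open Bisection χ.Good good? (ℚᵒ.fromℕ 1) (χ.L ℚ.+ ℚᵒ.fromℕ 5)
    (ℚᵒ.+-nonneg {χ.L} {ℚᵒ.fromℕ 5} χ.0≤L (ℚᵒ.0≤fromℕ 5)) χ.¬Good-1 χ.Good-upper
  w : ℝ
  w = limitʳ
  1≤w : fromℕ 1 ≤ w
  1≤w = ≤⇒≤ℝ {fromℕ 1} {w} λ n → ℚ.≤-trans (a≤lower n) (lower≤upper n)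
  -- Arithmetic on reals is termwise, so the n-th term of `E₁ w` is by definition `χ.E₁` at the n-th
  -- upper end.
  0≤E₁ : 0# ≤ E₁ w
  0≤E₁ = ≤⇒≤ℝ {0#} {E₁ w} λ n → proj₁ (P-upper n)
  0≤E₂ : 0# ≤ E₂ w
  0≤E₂ = ≤⇒≤ℝ {0#} {E₂ w} λ n → proj₁ (proj₂ (P-upper n))
  GG≤E₁E₂ : G w * G w ≤ E₁ w * E₂ w
  GG≤E₁E₂ = ≤⇒≤ℝ {G w * G w} {E₁ w * E₂ w} λ n → proj₂ (proj₂ (P-upper n))
  eventually-≥ : ∀ {x y} → ¬ x ≤ y → ¬ ¬ Eventually λ n → seq y n ℚ.≤ seq x n
  eventually-≥ {x} {y} x≰y k = ≰⇒gap {x} {y} x≰y λ (δ , δ>0 , N , h) →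
    k (N , λ n N≤n → ℚ.≤-trans (p≤p+ε (seq y n) δ>0) (h n N≤n))
  -- Where E₁ E₂ > G², the factors E₁, E₂ ≥ 0 are positive, so points just below the root are Good.
  E₁E₂≤GG : E₁ w * E₂ w ≤ G w * G w
  E₁E₂≤GG = ≤-stable {E₁ w * E₂ w} {G w * G w} λ E₁E₂≰GG →
    let w′ = limitˡ
        w≈w′ : w ≈ w′
        w≈w′ = sym {w′} {w} limits-equal
        E₁≈ = E₁-cong {w} {w′} w≈w′
        E₂≈ = E₂-cong {w} {w′} w≈w′
        G≈  = G-cong {w} {w′} w≈w′
        0≤GG = square-nonneg (G w)
    in eventually-≥ {E₁ w′} {0#} (λ le → E₁E₂≰GG (≤-trans {E₁ w * E₂ w} {0#} {G w * G w}
         (≤-reflexive {E₁ w * E₂ w} {0#} (trans {E₁ w * E₂ w} {0# * E₂ w} {0#}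
           (*-congʳ {E₂ w} {E₁ w} {0#} (≤-antisym {E₁ w} {0#} (≤-respˡ {E₁ w′} {E₁ w} {0#} (sym {E₁ w} {E₁ w′} E₁≈) le) 0≤E₁))
           (*-zeroˡ (E₂ w)))) 0≤GG)) λ ev₁ →
       eventually-≥ {E₂ w′} {0#} (λ le → E₁E₂≰GG (≤-trans {E₁ w * E₂ w} {0#} {G w * G w}
         (≤-reflexive {E₁ w * E₂ w} {0#} (trans {E₁ w * E₂ w} {E₁ w * 0#} {0#}
           (*-congˡ {E₁ w} {E₂ w} {0#} (≤-antisym {E₂ w} {0#} (≤-respˡ {E₂ w′} {E₂ w} {0#} (sym {E₂ w} {E₂ w′} E₂≈) le) 0≤E₂))
           (*-zeroʳ (E₁ w)))) 0≤GG)) λ ev₂ →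
       eventually-≥ {E₁ w′ * E₂ w′} {G w′ * G w′} (λ le → E₁E₂≰GG
         (≤-resp {E₁ w′ * E₂ w′} {E₁ w * E₂ w} {G w′ * G w′} {G w * G w}
           (sym {E₁ w * E₂ w} {E₁ w′ * E₂ w′} (*-cong {E₁ w} {E₁ w′} {E₂ w} {E₂ w′} E₁≈ E₂≈))
           (sym {G w * G w} {G w′ * G w′} (*-cong {G w} {G w′} {G w} {G w′} G≈ G≈)) le)) λ ev₃ →
       let n , 0≤E₁ , 0≤E₂ , GG≤ = eventually-instance (eventually-× ev₁ (eventually-× ev₂ ev₃))
       in ¬P-lower n (0≤E₁ , 0≤E₂ , GG≤)
  E₁E₂≈GG : E₁ w * E₂ w ≈ G w * G w
  E₁E₂≈GG = ≤-antisym {E₁ w * E₂ w} {G w * G w} E₁E₂≤GG GG≤E₁E₂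
  -- If one factor were at most zero, so would be E₁E₂, which is at least G² > 0.
  0<E₁ : 0# < E₁ w
  0<E₁ le = *-positive {G w} {G w} (0<G {w} 1≤w) (0<G {w} 1≤w) (≤-trans {G w * G w} {E₁ w * E₂ w} {0#} GG≤E₁E₂
    (≤-respʳ {E₁ w * E₂ w} {0# * E₂ w} {0#} (*-zeroˡ (E₂ w)) (*-monoʳ-≤ {E₁ w} {0#} {E₂ w} 0≤E₂ le)))
  0<E₂ : 0# < E₂ w
  0<E₂ le = *-positive {G w} {G w} (0<G {w} 1≤w) (0<G {w} 1≤w) (≤-trans {G w * G w} {E₁ w * E₂ w} {0#} GG≤E₁E₂
    (≤-respʳ {E₁ w * E₂ w} {E₁ w * 0#} {0#} (*-zeroʳ (E₁ w)) (*-monoˡ-≤ {E₂ w} {0#} {E₁ w} 0≤E₁ le)))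

-- Graphs and spanning trees

-- Finiteness is essential: the double negations are removed one index at a time. This lets the
-- signs of all entries of a vector be chosen together.
Fin-¬¬-choice : ∀ {n} {P : Fin n → Set} → (∀ i → ¬ ¬ P i) → ¬ ¬ (∀ i → P i)
Fin-¬¬-choice {zero}  f k = k λ ()
Fin-¬¬-choice {suc n} f k = f zero λ p₀ → Fin-¬¬-choice (f ∘ suc) λ p → k λ { zero → p₀ ; (suc i) → p i }

missed : ∀ {m n} → m ℕ.< n → (f : Fin m → Fin n) → ∃[ y ] ∀ i → f i ≢ y
missed m<n f with any? (λ y → all? (λ i → ¬? (f i ≟ y)))
... | yes found = found
... | no  none  =
  let i , j , i<j , gi≡gj = pigeonhole m<n g
  in contradiction (≡.trans (≡.sym (f∘g i)) (≡.trans (≡.cong f gi≡gj) (f∘g j))) (Fin.<⇒≢ i<j)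
  where
  preimage : ∀ y → ∃[ i ] f i ≡ y
  preimage y with any? (λ i → f i ≟ y)
  ... | yes found = found
  ... | no  none′ = contradiction (y , λ i eq → none′ (i , eq)) none
  g = proj₁ ∘ preimage
  f∘g : ∀ y → f (g y) ≡ y
  f∘g = proj₂ ∘ preimage

cons : ∀ {A : Set} {n} → A → (Fin n → A) → Fin (suc n) → A
cons a f zero    = a
cons a f (suc i) = f i

cons-injective : ∀ {A : Set} {n} {a : A} {f : Fin n → A} → (∀ i → f i ≢ a) → Injective _≡_ _≡_ f → Injective _≡_ _≡_ (cons a f)
cons-injective a∉f f-inj {zero}  {zero}  eq = ≡.refl
cons-injective a∉f f-inj {zero}  {suc j} eq = contradiction (≡.sym eq) (a∉f j)
cons-injective a∉f f-inj {suc i} {zero}  eq = contradiction eq (a∉f i)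
cons-injective a∉f f-inj {suc i} {suc j} eq = ≡.cong suc (f-inj eq)

injective⇒surjective : ∀ {n} (f : Fin n → Fin n) → Injective _≡_ _≡_ f → ∀ y → ∃[ i ] f i ≡ y
injective⇒surjective f f-inj y with any? (λ i → f i ≟ y)
... | yes found = found
... | no  none  = contradiction (injective⇒≤ (cons-injective {f = f} (λ i eq → none (i , eq)) f-inj)) ℕ.1+n≰n

injective⇒permutation : ∀ {n} (f : Fin n → Fin n) → Injective _≡_ _≡_ f → Permutation n n
injective⇒permutation f f-inj = permutation f (λ y → proj₁ (onto y))
  (λ y → proj₂ (onto y)) (λ i → f-inj (proj₂ (onto (f i))))
  where onto = injective⇒surjective f f-inj

record Complement {a n} (δ : Fin a → Fin n) (b : ℕ) : Set where
  field
    rest           : Fin b → Fin n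
    rest-injective : Injective _≡_ _≡_ rest
    disjoint       : ∀ i j → δ i ≢ rest j

complement : ∀ {a n} b (δ : Fin a → Fin n) → Injective _≡_ _≡_ δ → a ℕ.+ b ≡ n → Complement δ b
complement zero δ δ-inj eq = record
  { rest = λ () ; rest-injective = λ { {()} } ; disjoint = λ i () }
complement {a} {n} (suc b) δ δ-inj eq = record
  { rest           = cons y rest
  ; rest-injective = cons-injective (λ i → disjoint zero i ∘ ≡.sym) rest-injective
  ; disjoint       = λ { i zero → y∉δ i ; i (suc j) → disjoint (suc i) j }
  }
  where
  new = missed (≡.subst (suc a ℕ.≤_) (≡.trans (≡.sym (ℕ.+-suc a b)) eq) (ℕ.s≤s (ℕ.m≤m+n a b))) δ
  y = proj₁ new
  y∉δ = proj₂ new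
  open Complement (complement b (cons y δ) (cons-injective y∉δ δ-inj) (≡.trans (≡.sym (ℕ.+-suc a b)) eq))

module _ {a b n} {δ : Fin a → Fin n} (δ-inj : Injective _≡_ _≡_ δ) (C : Complement δ b) where

  open Complement C

  joined : Fin (a ℕ.+ b) → Fin n
  joined = [ δ , rest ]′ ∘ splitAt a

  joined-injective : Injective _≡_ _≡_ joined
  joined-injective {i} {j} eq = splitAt-injective (merge (splitAt a i) (splitAt a j) eq)
    where
    splitAt-injective : splitAt a i ≡ splitAt a j → i ≡ j
    splitAt-injective eq = ≡.trans (≡.sym (Fin.join-splitAt a b i)) (≡.trans (≡.cong (join a b) eq) (Fin.join-splitAt a b j))
    merge : ∀ u v → [ δ , rest ]′ u ≡ [ δ , rest ]′ v → u ≡ v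
    merge (inj₁ i) (inj₁ j) eq = ≡.cong inj₁ (δ-inj eq)
    merge (inj₁ i) (inj₂ j) eq = contradiction eq (disjoint i j)
    merge (inj₂ i) (inj₁ j) eq = contradiction (≡.sym eq) (disjoint j i)
    merge (inj₂ i) (inj₂ j) eq = ≡.cong inj₂ (rest-injective eq)

record Graph (n s : ℕ) : Set where
  field
    end₁ end₂ : Fin s → Fin n
    proper    : ∀ e → end₁ e ≢ end₂ e

  Joins : Fin s → Fin n → Fin n → Set
  Joins e a b = (end₁ e ≡ a × end₂ e ≡ b) ⊎ (end₁ e ≡ b × end₂ e ≡ a)

  field
    simple : ∀ {e f a b} → Joins e a b → Joins f a b → e ≡ f

  _∼_ : Fin n → Fin n → Set
  a ∼ b = ∃[ e ] Joins e a b

  _∼?_ : ∀ a b → Dec (a ∼ b)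
  a ∼? b = any? λ e → ((end₁ e ≟ a) ×-dec (end₂ e ≟ b)) ⊎-dec ((end₁ e ≟ b) ×-dec (end₂ e ≟ a))

  joins-self : ∀ e → Joins e (end₁ e) (end₂ e)
  joins-self e = inj₁ (≡.refl , ≡.refl)

  joins-sym : ∀ {e a b} → Joins e a b → Joins e b a
  joins-sym (inj₁ p) = inj₂ p
  joins-sym (inj₂ p) = inj₁ p

  ∼-sym : ∀ {a b} → a ∼ b → b ∼ a
  ∼-sym (e , j) = e , joins-sym j

  joins-distinct : ∀ {e a b} → Joins e a b → a ≢ b
  joins-distinct (inj₁ (≡.refl , ≡.refl)) = proper _
  joins-distinct (inj₂ (≡.refl , ≡.refl)) = proper _ ∘ ≡.sym

  ∼-irrefl : ∀ {a b} → a ∼ b → a ≢ b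
  ∼-irrefl (e , j) = joins-distinct j

  joins-unique : ∀ {e a b c d} → Joins e a b → Joins e c d → (a ≡ c × b ≡ d) ⊎ (a ≡ d × b ≡ c)
  joins-unique (inj₁ (≡.refl , ≡.refl)) (inj₁ (≡.refl , ≡.refl)) = inj₁ (≡.refl , ≡.refl)
  joins-unique (inj₁ (≡.refl , ≡.refl)) (inj₂ (≡.refl , ≡.refl)) = inj₂ (≡.refl , ≡.refl)
  joins-unique (inj₂ (≡.refl , ≡.refl)) (inj₁ (≡.refl , ≡.refl)) = inj₂ (≡.refl , ≡.refl)
  joins-unique (inj₂ (≡.refl , ≡.refl)) (inj₂ (≡.refl , ≡.refl)) = inj₁ (≡.refl , ≡.refl)

  -- Indexed by the exact length of a walk, which makes it decidable and yields the distance as the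
  -- least index.
  Reach : Fin n → ℕ → Fin n → Set
  Reach r zero    v = r ≡ v
  Reach r (suc i) v = ∃[ u ] Reach r i u × u ∼ v

  Reach? : ∀ r i v → Dec (Reach r i v)
  Reach? r zero    v = r ≟ v
  Reach? r (suc i) v = any? λ u → Reach? r i u ×-dec (u ∼? v)

least : ∀ {P : ℕ → Set} → (∀ i → Dec (P i)) → ∀ {n} → P n → ∃[ i ] P i × (∀ {j} → P j → i ℕ.≤ j)
least P? {zero} p = zero , p , λ _ → ℕ.z≤n
least {P} P? {suc n} p with P? zero
... | yes p₀ = zero , p₀ , λ _ → ℕ.z≤n
... | no ¬p₀ = let i , pᵢ , min = least (P? ∘ suc) p in suc i , pᵢ , λ { {zero} p₀ → contradiction p₀ ¬p₀ ; {suc j} pⱼ → ℕ.s≤s (min pⱼ) }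

module BreadthFirst {n s} (Γ : Graph n s) (r : Fin n) (connected : ∀ v → ∃[ i ] Graph.Reach Γ r i v) where

  open Graph Γ

  private
    distance : ∀ v → ∃[ i ] Reach r i v × (∀ {j} → Reach r j v → i ℕ.≤ j)
    distance v = least (λ i → Reach? r i v) (proj₂ (connected v))

    d : Fin n → ℕ
    d v = proj₁ (distance v)

    minimal : ∀ v {j} → Reach r j v → d v ℕ.≤ j
    minimal v = proj₂ (proj₂ (distance v))

    record Parent (v : Fin n) : Set where
      field
        edge   : Fin s
        vertex : Fin n
        joins  : Joins edge v vertex
        closer : d vertex ℕ.< d v

    find : ∀ v → v ≢ r → Parent v
    find v v≢r with distance v in eq
    ... | zero  , r≡v , _ = contradiction (≡.sym r≡v) v≢r
    ... | suc i , (u , reach , e , j) , _ = record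
      { edge = e ; vertex = u ; joins = joins-sym j
      ; closer = ≡.subst (λ z → d u ℕ.< proj₁ z) (≡.sym eq) (ℕ.s≤s (minimal u reach)) }

  parent : ∀ v → v ≢ r → Fin n
  parent v v≢r = Parent.vertex (find v v≢r)

  up : ∀ v → v ≢ r → Fin s
  up v v≢r = Parent.edge (find v v≢r)

  up-joins : ∀ v v≢r → Joins (up v v≢r) v (parent v v≢r)
  up-joins v v≢r = Parent.joins (find v v≢r)

  -- Sharing an edge would make two distinct vertices parents of each other, while a parent is
  -- strictly closer to the root.
  up-injective : ∀ {u v} u≢r v≢r → up u u≢r ≡ up v v≢r → u ≡ v
  up-injective {u} {v} u≢r v≢r eq with joins-unique (≡.subst (λ e → Joins e u _) eq (up-joins u u≢r)) (up-joins v v≢r)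
  ... | inj₁ (u≡v , _) = u≡v
  ... | inj₂ (u≡pv , pu≡v) = contradiction
    (≡.subst (λ z → d z ℕ.< d u) pu≡v (Parent.closer (find u u≢r)))
    (ℕ.<-asym (≡.subst (λ z → d z ℕ.< d v) (≡.sym u≡pv) (Parent.closer (find v v≢r))))

  -- The reason for a breadth-first tree: a neighbour of the root has distance at most 1, so its
  -- parent has distance 0. Hence every edge at the root is a tree edge, and the two edges outside
  -- the tree avoid the root.
  parent-of-neighbour : ∀ v v≢r → r ∼ v → parent v v≢r ≡ r
  parent-of-neighbour v v≢r r∼v with d (parent v v≢r) in eq | proj₁ (proj₂ (distance (parent v v≢r)))
  ... | zero  | r≡p = ≡.sym r≡p
  ... | suc i | _   = contradiction (ℕ.≤-trans (Parent.closer (find v v≢r)) (minimal v {1} (r , ≡.refl , r∼v)))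
    (ℕ.<⇒≱ (≡.subst (λ z → 1 ℕ.< suc z) (≡.sym eq) (ℕ.s≤s (ℕ.s≤s ℕ.z≤n))))

  root-edge : ∀ {e v} v≢r → Joins e r v → up v v≢r ≡ e
  root-edge {e} {v} v≢r j = simple (≡.subst (Joins (up v v≢r) v) (parent-of-neighbour v v≢r (e , j)) (up-joins v v≢r)) (joins-sym j)

module Sums (R : OrderedRing) where

  open OrderedRingProperties R

  when : Bool → Carrier → Carrier
  when b x = if b then x else 0#

  when-cong : ∀ b {x y} → x ≈ y → when b x ≈ when b y
  when-cong false x≈y = refl
  when-cong true  x≈y = x≈y

  *-when : ∀ b x y → x * when b y ≈ when b (x * y)
  *-when false x y = *-zeroʳ x
  *-when true  x y = refl

  when-yes : ∀ {P : Set} (P? : Dec P) {x} → P → when (does P?) x ≡ x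
  when-yes (yes _) p = ≡.refl
  when-yes (no ¬p) p = contradiction p ¬p

  when-no : ∀ {P : Set} (P? : Dec P) {x} → ¬ P → when (does P?) x ≡ 0#
  when-no (yes p) ¬p = contradiction p ¬p
  when-no (no _)  ¬p = ≡.refl

  sum-δ : ∀ {n} (j : Fin n) (g : Fin n → Carrier) → sum (λ i → when (does (i ≟ j)) (g i)) ≈ g j
  sum-δ {suc n} zero g = trans (+-congˡ (sum-zero {n} {λ _ → 0#} λ i → refl)) (+-identityʳ (g zero))
  sum-δ (suc j) g = trans (+-identityˡ _) (trans (sum-cong λ i → reflexive (suc-≟ i)) (sum-δ j (g ∘ suc)))
    where
    suc-≟ : ∀ i → when (does (suc i ≟ suc j)) (g (suc i)) ≡ when (does (i ≟ j)) (g (suc i))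
    suc-≟ i with i ≟ j
    ... | yes _ = ≡.refl
    ... | no  _ = ≡.refl

  sum-const : ∀ n x → sum {n} (λ _ → x) ≈ fromℕ n * x
  sum-const zero    x = sym (trans (*-congʳ fromℤ-0) (*-zeroˡ x))
  sum-const (suc n) x = trans (+-cong (sym (*-identityˡ x)) (sum-const n x))
    (trans (sym (distribʳ x 1# (fromℕ n))) (*-congʳ (sym (fromℕ-suc n))))

  sum-injective : ∀ {n} (f : Fin n → Carrier) (ψ : Fin n → Fin n) → Injective _≡_ _≡_ ψ → sum f ≈ sum (f ∘ ψ)
  sum-injective f ψ ψ-inj = sum-permute f (injective⇒permutation ψ ψ-inj)

  sum-injective-≡ : ∀ {m n} (f : Fin n → Carrier) (ψ : Fin m → Fin n) → Injective _≡_ _≡_ ψ → m ≡ n → sum f ≈ sum (f ∘ ψ)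
  sum-injective-≡ f ψ ψ-inj ≡.refl = sum-injective f ψ ψ-inj

  -- Doubly negated because the entries cannot be compared effectively. The predicate `P` allows the
  -- next largest vertices to be picked in turn.
  argmax : ∀ {n} (x : Fin n → Carrier) {P : Fin n → Set} (P? : ∀ i → Dec (P i)) → ∃[ i ] P i →
    ¬ ¬ (∃[ i ] P i × (∀ j → P j → x j ≤ x i))
  argmax {suc n} x {P} P? (i₀ , p) k with any? (P? ∘ suc) | P? zero
  ... | no none | yes p₀ = k (zero , p₀ , λ { zero _ → ≤-refl ; (suc j) pⱼ → contradiction (j , pⱼ) none })
  ... | no none | no ¬p₀ = contradiction p (λ p → none′ i₀ p)
    where
    none′ : ∀ i → ¬ P i
    none′ zero    p = ¬p₀ p
    none′ (suc i) p = none (i , p)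
  ... | yes found | p₀? = argmax (x ∘ suc) (P? ∘ suc) found λ (i , pᵢ , max) → compare i pᵢ max p₀?
    where
    compare : ∀ i → P (suc i) → (∀ j → P (suc j) → x (suc j) ≤ x (suc i)) → Dec (P zero) → ⊥
    compare i pᵢ max (no ¬p₀) = k (suc i , pᵢ , λ { zero p₀ → contradiction p₀ ¬p₀ ; (suc j) → max j })
    compare i pᵢ max (yes p₀) = ≤-total (x zero) (x (suc i)) λ where
      (inj₁ x₀≤xᵢ) → k (suc i , pᵢ , λ { zero _ → x₀≤xᵢ ; (suc j) → max j })
      (inj₂ xᵢ≤x₀) → k (zero , p₀ , λ { zero _ → ≤-refl ; (suc j) pⱼ → ≤-trans (max j pⱼ) xᵢ≤x₀ })

-- tree v is the edge from v to its parent in a spanning tree, and e₁, e₂ are the two edges outside it. The root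
-- has no parent, so tree r is set to e₁: then tree and e₂ together enumerate all edges.
record Skeleton {n} (Γ : Graph n (suc n)) (r : Fin n) : Set where
  open Graph Γ
  field
    e₁ e₂          : Fin (suc n)
    tree           : Fin n → Fin (suc n)
    tree-root      : tree r ≡ e₁
    tree-injective : Injective _≡_ _≡_ tree
    tree≢e₂        : ∀ j → tree j ≢ e₂
    tree-joins     : ∀ j → j ≢ r → ∃[ p ] Joins (tree j) j p × tree j ≢ e₁
    tree-neighbour : ∀ j → r ∼ j → Joins (tree j) r j
    e₁-avoids      : ∀ {j} → ¬ Joins e₁ r j
    e₂-avoids      : ∀ {j} → ¬ Joins e₂ r j

  e₁≢e₂ : e₁ ≢ e₂
  e₁≢e₂ eq = tree≢e₂ r (≡.trans tree-root eq)

  all-edges : Fin (suc n) → Fin (suc n)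
  all-edges = cons e₂ tree

  all-edges-injective : Injective _≡_ _≡_ all-edges
  all-edges-injective = cons-injective tree≢e₂ tree-injective

module BreadthFirstSkeleton {n} (Γ : Graph n (suc n)) (r u : Fin n) (u≢r : u ≢ r)
                (connected : ∀ v → ∃[ i ] Graph.Reach Γ r i v) where

  open Graph Γ
  open BreadthFirst Γ r connected

  private
    tree? : Fin (suc n) → ∀ j → Dec (j ≡ r) → Fin (suc n)
    tree? e j (yes _)  = e
    tree? e j (no j≢r) = up j j≢r

    -- `missed` needs a value at the root as well. Repeating the tree edge of `u` there keeps the
    -- image among the tree edges, and n values leave out one of the n + 1 edges.
    new₁ = missed ℕ.≤-refl (λ j → tree? (up u u≢r) j (j ≟ r))

  e₁ : Fin (suc n)
  e₁ = proj₁ new₁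

  tree : Fin n → Fin (suc n)
  tree j = tree? e₁ j (j ≟ r)

  tree-root : tree r ≡ e₁
  tree-root with r ≟ r
  ... | yes _  = ≡.refl
  ... | no r≢r = contradiction ≡.refl r≢r

  up≢e₁ : ∀ j j≢r → up j j≢r ≢ e₁
  up≢e₁ j j≢r eq with j ≟ r | proj₂ new₁ j
  ... | yes j≡r | _  = j≢r j≡r
  ... | no j≢r′ | ne = ne (≡.trans (≡.cong (up j) ≡.refl) eq)

  tree-up : ∀ j (j≢r : j ≢ r) → ∃[ j≢r ] tree j ≡ up j j≢r
  tree-up j j≢r with j ≟ r
  ... | yes j≡r = contradiction j≡r j≢r
  ... | no j≢r′ = j≢r′ , ≡.refl

  tree-injective : Injective _≡_ _≡_ tree
  tree-injective {i} {j} eq with i ≟ r | j ≟ r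
  ... | yes i≡r | yes j≡r = ≡.trans i≡r (≡.sym j≡r)
  ... | yes _   | no j≢r  = contradiction (≡.sym eq) (up≢e₁ j j≢r)
  ... | no i≢r  | yes _   = contradiction eq (up≢e₁ i i≢r)
  ... | no i≢r  | no j≢r  = up-injective i≢r j≢r eq

  private
    new₂ = missed ℕ.≤-refl tree

  e₂ : Fin (suc n)
  e₂ = proj₁ new₂

  tree≢e₂ : ∀ j → tree j ≢ e₂
  tree≢e₂ = proj₂ new₂

  tree-joins : ∀ j → j ≢ r → ∃[ p ] Joins (tree j) j p × tree j ≢ e₁
  tree-joins j j≢r with tree-up j j≢r
  ... | j≢r′ , eq = parent j j≢r′ , ≡.subst (λ e → Joins e j _) (≡.sym eq) (up-joins j j≢r′) ,
    λ eq′ → up≢e₁ j j≢r′ (≡.trans (≡.sym eq) eq′)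

  tree-neighbour : ∀ j → r ∼ j → Joins (tree j) r j
  tree-neighbour j r∼j with tree-up j (∼-irrefl r∼j ∘ ≡.sym)
  ... | j≢r , eq = ≡.subst (λ e → Joins e r j) (≡.sym (≡.trans eq (root-edge j≢r (proj₂ r∼j)))) (proj₂ r∼j)

  e₁-avoids : ∀ {j} → ¬ Joins e₁ r j
  e₁-avoids {j} joins with tree-up j (joins-distinct joins ∘ ≡.sym)
  ... | j≢r , _ = up≢e₁ j j≢r (root-edge j≢r joins)

  e₂-avoids : ∀ {j} → ¬ Joins e₂ r j
  e₂-avoids {j} joins with tree-up j (joins-distinct joins ∘ ≡.sym)
  ... | j≢r , eq = tree≢e₂ j (≡.trans eq (root-edge j≢r joins))

  skeleton : Skeleton Γ r
  skeleton = record
    { e₁ = e₁ ; e₂ = e₂ ; tree = tree ; tree-root = tree-root ; tree-injective = tree-injective ; tree≢e₂ = tree≢e₂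
    ; tree-joins = tree-joins ; tree-neighbour = tree-neighbour ; e₁-avoids = e₁-avoids ; e₂-avoids = e₂-avoids }

-- Quadratic forms

module Energy (R : OrderedRing) (t Q : OrderedRing.Carrier R)
              (0<t : OrderedRingProperties._<_ R (OrderedRing.0# R) t) (0≤Q : OrderedRing._≤_ R (OrderedRing.0# R) Q) where

  open OrderedRingProperties R

  private
    0≤t : 0# ≤ t
    0≤t = <⇒≤ 0<t

  -- One edge's share of the quadratic form of tA + QD, with D the diagonal matrix of the degrees.
  φ : Carrier → Carrier → Carrier
  φ a b = t * (a * b + a * b) + Q * (a * a + b * b)

  φᵖ : ∀ {n} → (t Q a b : Polynomial n) → Polynomial n
  φᵖ t Q a b = t :* (a :* b :+ a :* b) :+ Q :* (a :* a :+ b :* b)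

  φ-comm : ∀ a b → φ a b ≈ φ b a
  φ-comm = solve 4 (λ t Q a b → φᵖ t Q a b := φᵖ t Q b a) refl t Q

  φ-monoʳ : ∀ a {b b′} → 0# ≤ a → 0# ≤ b → b ≤ b′ → φ a b ≤ φ a b′
  φ-monoʳ a {b} {b′} 0≤a 0≤b b≤b′ = ≤-by
    (+-nonneg (*-nonneg 0≤t (+-nonneg (*-nonneg 0≤a (0≤y-x b≤b′)) (*-nonneg 0≤a (0≤y-x b≤b′))))
      (*-nonneg 0≤Q (*-nonneg (+-nonneg 0≤b (≤-trans 0≤b b≤b′)) (0≤y-x b≤b′))))
    (solve 5 (λ t Q a b b′ → φᵖ t Q a b′ := φᵖ t Q a b :+
       (t :* (a :* (b′ :- b) :+ a :* (b′ :- b)) :+ Q :* ((b :+ b′) :* (b′ :- b)))) refl t Q a b b′)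

  φ-monoʳ-< : ∀ a {b b′} → 0# < a → 0# ≤ b → b < b′ → φ a b < φ a b′
  φ-monoʳ-< a {b} {b′} 0<a 0≤b b<b′ = <-by
    (+-pos-nonneg (*-positive 0<t (+-pos-nonneg (*-positive 0<a (0<y-x b<b′)) (<⇒≤ (*-positive 0<a (0<y-x b<b′)))))
      (*-nonneg 0≤Q (*-nonneg (+-nonneg 0≤b (≤-trans 0≤b (<⇒≤ b<b′))) (<⇒≤ (0<y-x b<b′)))))
    (solve 5 (λ t Q a b b′ → φᵖ t Q a b′ := φᵖ t Q a b :+
       (t :* (a :* (b′ :- b) :+ a :* (b′ :- b)) :+ Q :* ((b :+ b′) :* (b′ :- b)))) refl t Q a b b′)

  φ-mono : ∀ {a a′ b b′} → 0# ≤ a → 0# ≤ b → a ≤ a′ → b ≤ b′ → φ a b ≤ φ a′ b′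
  φ-mono {a} {a′} {b} {b′} 0≤a 0≤b a≤a′ b≤b′ = ≤-trans (φ-monoʳ a 0≤a 0≤b b≤b′)
    (≤-resp (φ-comm b′ a) (φ-comm b′ a′) (φ-monoʳ b′ (≤-trans 0≤b b≤b′) 0≤a a≤a′))

  -- The rearrangement inequality: the squares cancel and 2t(a - a′)(b - b′) remains.
  φ-rearrange : ∀ {a a′ b b′} → a′ ≤ a → b′ ≤ b → φ a b′ + φ a′ b ≤ φ a b + φ a′ b′
  φ-rearrange {a} {a′} {b} {b′} a′≤a b′≤b = ≤-by
    (*-nonneg 0≤t (+-nonneg (*-nonneg (0≤y-x a′≤a) (0≤y-x b′≤b)) (*-nonneg (0≤y-x a′≤a) (0≤y-x b′≤b))))
    (solve 6 (λ t Q a a′ b b′ → φᵖ t Q a b :+ φᵖ t Q a′ b′ := (φᵖ t Q a b′ :+ φᵖ t Q a′ b) :+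
      t :* ((a :- a′) :* (b :- b′) :+ (a :- a′) :* (b :- b′))) refl t Q a a′ b b′)

-- The form of T₁C(ℓ,0,1,0) as a sum of squares: eliminate the leaves first, then the vertices a and b of
-- degree 2; the remaining form in h and c is degenerate because E₁ E₂ = G².
module ExtremalForm (R : OrderedRing) (q ℓ : ℕ) (root : CharacteristicRoot R q ℓ) where

  open OrderedRingProperties R
  open Sums R
  open CharacteristicRoot root
  private module χ = Characteristic R q ℓ
  open χ using (Q; L; 0≤Q; 0≤L)

  t κ E₁ E₂ G B : Carrier
  t  = χ.t w
  κ  = χ.κ w
  E₁ = χ.E₁ w
  E₂ = χ.E₂ w
  G  = χ.G w
  B  = t * w + Q

  0<w : 0# < w
  0<w = χ.0<w 1≤w
  0<t : 0# < t
  0<t = χ.0<t 1≤w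
  0<κ : 0# < κ
  0<κ = χ.0<κ 1≤w
  0<G : 0# < G
  0<G = χ.0<G 1≤w

  open Energy R t Q 0<t 0≤Q public

  -- The eigenvector equations at the hub and at the vertex of degree 4 follow from those at the other vertices
  -- and from E₂h = Gc.
  module Relations (h c a b u : Carrier) (p : Fin ℓ → Carrier) (E₂h≈Gc : E₂ * h ≈ G * c)
    (κa≈ : κ * a ≈ t * (h + c)) (κb≈ : κ * b ≈ t * (h + c)) (wu≈c : w * u ≈ c) (wp≈h : ∀ i → w * p i ≈ h) where

    E₁c≈Gh : E₁ * c ≈ G * h
    E₁c≈Gh = *-cancelˡ-≈ 0<E₂ (trans (solve 3 (λ E₁ E₂ c → E₂ :* (E₁ :* c) := (E₁ :* E₂) :* c) refl E₁ E₂ c)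
      (trans (*-congʳ E₁E₂≈GG) (trans (solve 2 (λ G c → (G :* G) :* c := G :* (G :* c)) refl G c)
        (trans (*-congˡ (sym E₂h≈Gc)) (solve 3 (λ G E₂ h → G :* (E₂ :* h) := E₂ :* (G :* h)) refl G E₂ h)))))

    centre-eq : (t * w - (Q + Q + Q)) * c ≈ t * (h + (a + a + u))
    centre-eq = *-cancelˡ-≈ (*-positive 0<κ 0<w) (trans
      (solve 5 (λ w t Q h c → let κ = t :* w :- Q in
        (κ :* w) :* ((t :* w :- (Q :+ Q :+ Q)) :* c) :=
        ((t :* w :- (Q :+ Q :+ Q)) :* (κ :* w) :- t :* (t :* w :+ t :* w :+ κ)) :* c :+ t :* (t :* w :+ t :* w :+ κ) :* c) refl w t Q h c)
      (trans (+-congʳ E₁c≈Gh) (trans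
      (solve 5 (λ w t Q h c → let κ = t :* w :- Q in
        (t :* w :* (κ :+ t :+ t)) :* h :+ t :* (t :* w :+ t :* w :+ κ) :* c :=
        (κ :* w) :* (t :* h) :+ t :* w :* (t :* (h :+ c) :+ t :* (h :+ c)) :+ t :* κ :* c) refl w t Q h c)
      (trans (+-cong (+-congˡ (*-congˡ (+-cong (sym κa≈) (sym κa≈)))) (*-congˡ (sym wu≈c)))
      (solve 6 (λ w t κ h a u → (κ :* w) :* (t :* h) :+ t :* w :* (κ :* a :+ κ :* a) :+ t :* κ :* (w :* u) :=
        (κ :* w) :* (t :* (h :+ (a :+ a :+ u)))) refl w t κ h a u)))))

    hub-eq : B * h ≈ (t * c + Q * h) + ((t * a + Q * h) + ((t * b + Q * h) + sum (λ i → t * p i + Q * h)))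
    hub-eq = trans step₁ (sym (+-congˡ (+-congˡ (+-congˡ (trans (∑-distrib-+ {ℓ} (λ i → t * p i) (λ _ → Q * h)) (+-cong (sym (*-distribˡ-sum t p)) (sum-const ℓ (Q * h))))))))
      where
      wΣp≈Lh : w * sum p ≈ L * h
      wΣp≈Lh = trans (*-distribˡ-sum w p) (trans (sum-cong wp≈h) (sum-const ℓ h))
      step₁ : B * h ≈ (t * c + Q * h) + ((t * a + Q * h) + ((t * b + Q * h) + (t * sum p + L * (Q * h))))
      step₁ = *-cancelˡ-≈ (*-positive 0<κ 0<w) (trans
        (solve 5 (λ w t Q L h → let κ = t :* w :- Q in
          (κ :* w) :* ((t :* w :+ Q) :* h) :=
          ((t :* w :- (L :* Q :+ Q :+ Q)) :* (κ :* w) :- t :* (t :* w :+ t :* w :+ L :* κ)) :* h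
            :+ ((L :* Q :+ Q :+ Q :+ Q) :* (κ :* w) :+ t :* (t :* w :+ t :* w :+ L :* κ)) :* h) refl w t Q L h)
        (trans (+-congʳ E₂h≈Gc) (trans
        (solve 6 (λ w t Q L h c → let κ = t :* w :- Q in
          (t :* w :* (κ :+ t :+ t)) :* c :+ ((L :* Q :+ Q :+ Q :+ Q) :* (κ :* w) :+ t :* (t :* w :+ t :* w :+ L :* κ)) :* h :=
          κ :* w :* (t :* c) :+ t :* w :* (t :* (h :+ c) :+ t :* (h :+ c)) :+ t :* κ :* (L :* h) :+ (L :* Q :+ Q :+ Q :+ Q) :* (κ :* w) :* h)
          refl w t Q L h c)
        (trans (+-congʳ (+-cong (+-congˡ (*-congˡ (+-cong (sym κa≈) (sym κb≈)))) (*-congˡ (sym wΣp≈Lh))))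
        (solve 10 (λ w t κ Q L h c a b P →
          κ :* w :* (t :* c) :+ t :* w :* (κ :* a :+ κ :* b) :+ t :* κ :* (w :* P) :+ (L :* Q :+ Q :+ Q :+ Q) :* (κ :* w) :* h :=
          (κ :* w) :* ((t :* c :+ Q :* h) :+ ((t :* a :+ Q :* h) :+ ((t :* b :+ Q :* h) :+ (t :* P :+ L :* (Q :* h))))))
          refl w t κ Q L h c a b (sum p))))))

  module _ (h c a b u : Carrier) (p : Fin ℓ → Carrier) where

    energy : Carrier
    energy = (φ h c + φ h a + φ h b + sum (λ i → φ h (p i))) + (φ c a + φ c b + φ c u)

    norm : Carrier
    norm = h * h + (c * c + (a * a + (b * b + (u * u + sum (λ i → p i * p i)))))

    squares : Carrier
    squares = E₂ * (κ * (t * sum (λ i → (w * p i - h) * (w * p i - h))) + κ * (t * ((w * u - c) * (w * u - c)))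
                + w * ((κ * a - t * (h + c)) * (κ * a - t * (h + c))) + w * ((κ * b - t * (h + c)) * (κ * b - t * (h + c))))
              + (E₂ * h - G * c) * (E₂ * h - G * c)

    private
      leaf : ∀ x y → w * (B * (y * y) - φ x y) ≈ t * ((w * y - x) * (w * y - x)) - (t + w * Q) * (x * x)
      leaf = solve 5 (λ w t Q x y → w :* ((t :* w :+ Q) :* (y :* y) :- φᵖ t Q x y)
        := t :* ((w :* y :- x) :* (w :* y :- x)) :- (t :+ w :* Q) :* (x :* x)) refl w t Q

      leaves : w * (B * sum (λ i → p i * p i) - sum (λ i → φ h (p i))) ≈
        t * sum (λ i → (w * p i - h) * (w * p i - h)) - L * ((t + w * Q) * (h * h))
      leaves = trans (*-congˡ (trans (+-congʳ (*-distribˡ-sum B (λ i → p i * p i))) (sym (sum-- {ℓ} _ _))))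
        (trans (*-distribˡ-sum w (λ i → B * (p i * p i) - φ h (p i)))
        (trans (sum-cong λ i → leaf h (p i))
        (trans (sum-- {ℓ} _ _)
        (+-cong (sym (*-distribˡ-sum t (λ i → (w * p i - h) * (w * p i - h)))) (-‿cong (sum-const ℓ _))))))

      degree2 : ∀ y → κ * (B * (y * y) - (φ h y + φ c y)) ≈
        (κ * y - t * (h + c)) * (κ * y - t * (h + c)) - ((t * (h + c)) * (t * (h + c)) + κ * (Q * (h * h + c * c)))
      degree2 = solve 6 (λ w t Q h c y → let κ = t :* w :- Q in
        κ :* ((t :* w :+ Q) :* (y :* y) :- (φᵖ t Q h y :+ φᵖ t Q c y)) :=
        (κ :* y :- t :* (h :+ c)) :* (κ :* y :- t :* (h :+ c)) :- ((t :* (h :+ c)) :* (t :* (h :+ c)) :+ κ :* (Q :* (h :* h :+ c :* c))))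
        refl w t Q h c

      core : κ * (w * (B * (h * h + c * c) - φ h c)) - κ * ((t + w * Q) * (c * c)) - κ * (L * ((t + w * Q) * (h * h)))
          - (w * ((t * (h + c)) * (t * (h + c)) + κ * (Q * (h * h + c * c))) + w * ((t * (h + c)) * (t * (h + c)) + κ * (Q * (h * h + c * c))))
          ≈ E₂ * (h * h) - (G * (h * c) + G * (h * c)) + E₁ * (c * c)
      core = solve 6 (λ w t Q L h c →
        let κ = t :* w :- Q
            d = w :* ((t :* (h :+ c)) :* (t :* (h :+ c)) :+ κ :* (Q :* (h :* h :+ c :* c)))
            E₁ = (t :* w :- (Q :+ Q :+ Q)) :* (κ :* w) :- t :* (t :* w :+ t :* w :+ κ)
            E₂ = (t :* w :- (L :* Q :+ Q :+ Q)) :* (κ :* w) :- t :* (t :* w :+ t :* w :+ L :* κ)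
            G = t :* w :* (κ :+ t :+ t)
        in κ :* (w :* ((t :* w :+ Q) :* (h :* h :+ c :* c) :- φᵖ t Q h c)) :- κ :* ((t :+ w :* Q) :* (c :* c)) :- κ :* (L :* ((t :+ w :* Q) :* (h :* h)))
          :- (d :+ d) := E₂ :* (h :* h) :- (G :* (h :* c) :+ G :* (h :* c)) :+ E₁ :* (c :* c)) refl w t Q L h c

      regroup : ∀ κ w B h² c² a² b² u² P hc ha hb hp ca cb cu →
        κ * (w * (B * (h² + (c² + (a² + (b² + (u² + P))))) - ((hc + ha + hb + hp) + (ca + cb + cu)))) ≈
        κ * (w * (B * (h² + c²) - hc)) + w * (κ * (B * a² - (ha + ca))) + w * (κ * (B * b² - (hb + cb)))
          + κ * (w * (B * u² - cu)) + κ * (w * (B * P - hp))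
      regroup κ w B h² c² a² b² u² P hc ha hb hp ca cb cu =
        solve 16 (λ κ w B h² c² a² b² u² P hc ha hb hp ca cb cu →
          κ :* (w :* (B :* (h² :+ (c² :+ (a² :+ (b² :+ (u² :+ P))))) :- ((hc :+ ha :+ hb :+ hp) :+ (ca :+ cb :+ cu)))) :=
          κ :* (w :* (B :* (h² :+ c²) :- hc)) :+ w :* (κ :* (B :* a² :- (ha :+ ca))) :+ w :* (κ :* (B :* b² :- (hb :+ cb)))
            :+ κ :* (w :* (B :* u² :- cu)) :+ κ :* (w :* (B :* P :- hp)))
          refl κ w B h² c² a² b² u² P hc ha hb hp ca cb cu

    -- The factor clears the denominators of the successive completions: w for the leaves, κ for the
    -- vertices of degree 2, E₂ for the form in h and c. What is left over is (E₁E₂ - G²)c², zero at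
    -- the root.
    squares-eq : E₂ * (κ * (w * (B * norm - energy))) ≈ squares
    squares-eq = trans (*-congˡ (trans
        (regroup κ w B (h * h) (c * c) (a * a) (b * b) (u * u) (sum (λ i → p i * p i))
          (φ h c) (φ h a) (φ h b) (sum (λ i → φ h (p i))) (φ c a) (φ c b) (φ c u))
        (trans (+-cong (+-cong (+-cong (+-congˡ (*-congˡ (degree2 a))) (*-congˡ (degree2 b))) (*-congˡ (leaf c u))) (*-congˡ leaves))
          (trans (collect κ w _ _ _ _ _ _ _ _) (+-congʳ core)))))
      (trans (complete E₁ E₂ G h c _) (trans (+-congˡ (trans (*-congʳ (trans (+-congʳ E₁E₂≈GG) (-‿inverseʳ (G * G)))) (*-zeroˡ (c * c)))) (+-identityʳ _)))
      where
      collect : ∀ κ w X A₁ A₂ d U S m l →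
        κ * X + w * (A₁ - d) + w * (A₂ - d) + κ * (U - m) + κ * (S - l) ≈
        (κ * X - κ * m - κ * l - (w * d + w * d)) + (κ * S + κ * U + w * A₁ + w * A₂)
      collect = solve 10 (λ κ w X A₁ A₂ d U S m l →
        κ :* X :+ w :* (A₁ :- d) :+ w :* (A₂ :- d) :+ κ :* (U :- m) :+ κ :* (S :- l) :=
        (κ :* X :- κ :* m :- κ :* l :- (w :* d :+ w :* d)) :+ (κ :* S :+ κ :* U :+ w :* A₁ :+ w :* A₂)) refl
      complete : ∀ E₁ E₂ G h c Z → E₂ * (E₂ * (h * h) - (G * (h * c) + G * (h * c)) + E₁ * (c * c) + Z) ≈
        E₂ * Z + (E₂ * h - G * c) * (E₂ * h - G * c) + (E₁ * E₂ - G * G) * (c * c)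
      complete = solve 6 (λ E₁ E₂ G h c Z → E₂ :* (E₂ :* (h :* h) :- (G :* (h :* c) :+ G :* (h :* c)) :+ E₁ :* (c :* c) :+ Z) :=
        E₂ :* Z :+ (E₂ :* h :- G :* c) :* (E₂ :* h :- G :* c) :+ (E₁ :* E₂ :- G :* G) :* (c :* c)) refl

    private
      0≤S  = sum-nonneg λ i → square-nonneg (w * p i - h)
      0≤κtS = *-nonneg (<⇒≤ 0<κ) (*-nonneg (<⇒≤ 0<t) 0≤S)
      0≤κtU = *-nonneg (<⇒≤ 0<κ) (*-nonneg (<⇒≤ 0<t) (square-nonneg (w * u - c)))
      0≤wA  = *-nonneg (<⇒≤ 0<w) (square-nonneg (κ * a - t * (h + c)))
      0≤wB  = *-nonneg (<⇒≤ 0<w) (square-nonneg (κ * b - t * (h + c)))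
      0≤Z   = +-nonneg (+-nonneg (+-nonneg 0≤κtS 0≤κtU) 0≤wA) 0≤wB

    energy≤B*norm : energy ≤ B * norm
    energy≤B*norm = 0≤y-x⇒x≤y (0≤-cancelˡ 0<w (0≤-cancelˡ 0<κ (0≤-cancelˡ 0<E₂ (≤-respʳ (sym squares-eq)
      (+-nonneg (*-nonneg (<⇒≤ 0<E₂) 0≤Z) (square-nonneg (E₂ * h - G * c)))))))

    -- Equality annihilates every square, so the values satisfy the eigenvector equations of the
    -- extremal graph. From these come positivity and the strict order u, p < a = b < c, by which
    -- the edges of Γ are identified later.
    module Tight (tight : B * norm ≤ energy) (0<h : 0# < h) (c≤h : c ≤ h) where

      private
        squares≤0 : squares ≤ 0#
        squares≤0 = ≤-respˡ squares-eq (≤-respʳ (trans (*-congˡ (trans (*-congˡ (*-zeroʳ w)) (*-zeroʳ κ))) (*-zeroʳ E₂))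
          (*-monoˡ-≤ (<⇒≤ 0<E₂) (*-monoˡ-≤ (<⇒≤ 0<κ) (*-monoˡ-≤ (<⇒≤ 0<w) (x≤y⇒x-y≤0 tight)))))
        Z≤0 = ≤0-cancelˡ 0<E₂ (+≤0⇒≤0ˡ (square-nonneg (E₂ * h - G * c)) squares≤0)
        Z₃≤0 = +≤0⇒≤0ˡ 0≤wB Z≤0
        Z₂≤0 = +≤0⇒≤0ˡ 0≤wA Z₃≤0
        square≈0 : ∀ {x y} → (x - y) * (x - y) ≤ 0# → x ≈ y
        square≈0 le = x-y≈0⇒x≈y (x*x≤0⇒x≈0 le)

      E₂h≈Gc : E₂ * h ≈ G * c
      E₂h≈Gc = square≈0 (+≤0⇒≤0ʳ (*-nonneg (<⇒≤ 0<E₂) 0≤Z) squares≤0)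

      κb≈ : κ * b ≈ t * (h + c)
      κb≈ = square≈0 (≤0-cancelˡ 0<w (+≤0⇒≤0ʳ (+-nonneg (+-nonneg 0≤κtS 0≤κtU) 0≤wA) Z≤0))

      κa≈ : κ * a ≈ t * (h + c)
      κa≈ = square≈0 (≤0-cancelˡ 0<w (+≤0⇒≤0ʳ (+-nonneg 0≤κtS 0≤κtU) Z₃≤0))

      wu≈c : w * u ≈ c
      wu≈c = square≈0 (≤0-cancelˡ 0<t (≤0-cancelˡ 0<κ (+≤0⇒≤0ʳ 0≤κtS Z₂≤0)))

      wp≈h : ∀ i → w * p i ≈ h
      wp≈h i = square≈0 (≤-reflexive (sum≤0⇒≈0 (λ i → square-nonneg (w * p i - h))
        (≤0-cancelˡ 0<t (≤0-cancelˡ 0<κ (+≤0⇒≤0ˡ 0≤κtU Z₂≤0))) i))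

      open Relations h c a b u p E₂h≈Gc κa≈ κb≈ wu≈c wp≈h public

      a≈b : a ≈ b
      a≈b = *-cancelˡ-≈ 0<κ (trans κa≈ (sym κb≈))

      0<c : 0# < c
      0<c c≤0 = *-positive 0<E₂ 0<h (≤-respˡ (sym E₂h≈Gc)
        (≤-respʳ (*-zeroʳ G) (*-monoˡ-≤ (<⇒≤ 0<G) c≤0)))

      0<a : 0# < a
      0<a a≤0 = *-positive 0<t (+-pos-nonneg 0<h (<⇒≤ 0<c)) (≤-respˡ κa≈ (≤-respʳ (*-zeroʳ κ) (*-monoˡ-≤ (<⇒≤ 0<κ) a≤0)))

      private
        pos-quotient : ∀ {x y} → w * x ≈ y → 0# < y → 0# < x
        pos-quotient {x} eq 0<y x≤0 = 0<y (≤-respˡ eq (≤-respʳ (*-zeroʳ w) (*-monoˡ-≤ (<⇒≤ 0<w) x≤0)))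

      0<u : 0# < u
      0<u = pos-quotient wu≈c 0<c

      0<p : ∀ i → 0# < p i
      0<p i = pos-quotient (wp≈h i) 0<h

      -- κ ≤ tw, so wa = tw(h + c)/κ ≥ h + c.
      h<wa : h < w * a
      h<wa wa≤h = *-positive 0<κ 0<c (≤-respˡ (trans (+-congʳ (distribˡ κ h c)) (solve 2 (λ x y → (x :+ y) :- x := y) refl (κ * h) (κ * c)))
        (x≤y⇒x-y≤0 (≤-trans (≤-trans (≤-by (*-nonneg 0≤Q (+-nonneg (<⇒≤ 0<h) (<⇒≤ 0<c)))
            (solve 5 (λ w t Q h c → (t :* w) :* (h :+ c) := (t :* w :- Q) :* (h :+ c) :+ Q :* (h :+ c)) refl w t Q h c))
          (≤-reflexive (trans (solve 4 (λ w t h c → (t :* w) :* (h :+ c) := w :* (t :* (h :+ c))) refl w t h c)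
            (trans (*-congˡ (sym κa≈)) (solve 3 (λ w κ a → w :* (κ :* a) := κ :* (w :* a)) refl w κ a)))))
          (*-monoˡ-≤ (<⇒≤ 0<κ) wa≤h))))

      p<a : ∀ i → p i < a
      p<a i a≤p = h<wa (≤-respʳ (wp≈h i) (*-monoˡ-≤ (<⇒≤ 0<w) a≤p))

      u<a : u < a
      u<a a≤u = h<wa (≤-trans (≤-respʳ wu≈c (*-monoˡ-≤ (<⇒≤ 0<w) a≤u)) c≤h)

      -- Otherwise (tw - 3Q)c ≤ κc ≤ κa = t(h + c) ≤ t(h + a), against centre-eq.
      a<c : a < c
      a<c c≤a = *-positive 0<t (+-pos-nonneg 0<a (<⇒≤ 0<u)) (≤-respˡ
        (solve 4 (λ t h a u → t :* (h :+ (a :+ a :+ u)) :- t :* (h :+ a) := t :* (a :+ u)) refl t h a u)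
        (x≤y⇒x-y≤0 (≤-trans (≤-reflexive (sym centre-eq)) (≤-trans
          (≤-by (*-nonneg (+-nonneg 0≤Q 0≤Q) (<⇒≤ 0<c))
            (solve 4 (λ w t Q c → (t :* w :- Q) :* c := (t :* w :- (Q :+ Q :+ Q)) :* c :+ (Q :+ Q) :* c) refl w t Q c))
          (≤-trans (*-monoˡ-≤ (<⇒≤ 0<κ) c≤a) (≤-trans (≤-reflexive κa≈) (*-monoˡ-≤ (<⇒≤ 0<t) (+-monoʳ-≤ h c≤a))))))))

-- Labelled vertices and the extremal graph

four : ∀ {A : Set} → A → A → A → A → Fin 4 → A
four a b c d = cons a (cons b (cons c (cons d λ ())))

five : ∀ {A : Set} → A → A → A → A → A → Fin 5 → A
five a b c d e = cons a (four b c d e)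

four-injective : ∀ {A : Set} {a b c d : A} → b ≢ a → c ≢ a → d ≢ a → c ≢ b → d ≢ b → d ≢ c → Injective _≡_ _≡_ (four a b c d)
four-injective ba ca da cb db dc =
  cons-injective {n = 3} (λ { 0F → ba ; 1F → ca ; 2F → da }) (cons-injective {n = 2} (λ { 0F → cb ; 1F → db })
    (cons-injective {n = 1} (λ { 0F → dc }) (cons-injective {n = 0} (λ ()) λ { {()} })))

five-injective : ∀ {A : Set} {a b c d e : A} → b ≢ a → c ≢ a → d ≢ a → e ≢ a →
  c ≢ b → d ≢ b → e ≢ b → d ≢ c → e ≢ c → e ≢ d → Injective _≡_ _≡_ (five a b c d e)
five-injective ba ca da ea cb db eb dc ec ed =
  cons-injective {n = 4} (λ { 0F → ba ; 1F → ca ; 2F → da ; 3F → ea }) (four-injective cb db eb dc ec ed)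

module _ {n s} (Γ : Graph n s) where

  open Graph Γ

  -- Γ contains the graph of T₁C(ℓ,0,1,0) with hub h; c is the other vertex of degree at least 3.
  ExtremalShape : Fin n → Fin n → Fin n → Fin n → Fin n → Set
  ExtremalShape h c a b u = Injective _≡_ _≡_ (five h c a b u) × (∀ j → j ≢ h → j ≢ u → h ∼ j) × c ∼ a × c ∼ b × c ∼ u

  Extremal : Set
  Extremal = ∃[ h ] ∃[ c ] ∃[ a ] ∃[ b ] ∃[ u ] ExtremalShape h c a b u

  -- The argument over the reals yields only `¬ ¬ Extremal Γ`; a finite search removes the double
  -- negation.
  extremal? : Dec Extremal
  extremal? = any? λ h → any? λ c → any? λ a → any? λ b → any? λ u →
    injective? (five h c a b u) ×-dec ((all? λ j → ¬? (j ≟ h) →-dec (¬? (j ≟ u) →-dec (h ∼? j))) ×-dec ((c ∼? a) ×-dec ((c ∼? b) ×-dec (c ∼? u))))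
    where
    injective? : ∀ {m} (f : Fin m → Fin n) → Dec (Injective _≡_ _≡_ f)
    injective? f with all? (λ i → all? λ j → (f i ≟ f j) →-dec (i ≟ j))
    ... | yes inj = yes λ {i} {j} → inj i j
    ... | no ¬inj = no λ inj → ¬inj λ i j → inj

  joins? : ∀ e a b → Dec (Joins e a b)
  joins? e a b = ((end₁ e ≟ a) ×-dec (end₂ e ≟ b)) ⊎-dec ((end₁ e ≟ b) ×-dec (end₂ e ≟ a))

module GraphForm (R : OrderedRing) {n s} (Γ : Graph n s) (t Q : OrderedRing.Carrier R)
  (0<t : OrderedRingProperties._<_ R (OrderedRing.0# R) t) (0≤Q : OrderedRing._≤_ R (OrderedRing.0# R) Q)
  (x : Fin n → OrderedRing.Carrier R) where

  open OrderedRingProperties R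
  open Sums R
  open Energy R t Q 0<t 0≤Q
  open Graph Γ

  -- The contribution of the edge e to ((tA + QD)x)ᵥ.
  flow : Fin s → Fin n → Carrier
  flow e v = when (does (v ≟ end₁ e)) (t * x (end₂ e) + Q * x v) + when (does (v ≟ end₂ e)) (t * x (end₁ e) + Q * x v)

  edge-energy : Fin s → Carrier
  edge-energy e = φ (x (end₁ e)) (x (end₂ e))

  -- Both sides are xᵀ(tA + QD)x, collected by vertices and by edges.
  flow-energy : sum (λ v → x v * sum (λ e → flow e v)) ≈ sum edge-energy
  flow-energy = trans (sum-cong λ v → *-distribˡ-sum (x v) (λ e → flow e v))
    (trans (∑-comm (λ v e → x v * flow e v)) (sum-cong per-edge))
    where
    per-edge : ∀ e → sum (λ v → x v * flow e v) ≈ edge-energy e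
    per-edge e = trans (sum-cong λ v → trans (distribˡ (x v) _ _) (+-cong (*-when _ (x v) _) (*-when _ (x v) _)))
      (trans (∑-distrib-+ {n} (λ v → when (does (v ≟ end₁ e)) (x v * (t * x (end₂ e) + Q * x v)))
                              (λ v → when (does (v ≟ end₂ e)) (x v * (t * x (end₁ e) + Q * x v))))
      (trans (+-cong (sum-δ (end₁ e) λ v → x v * (t * x (end₂ e) + Q * x v)) (sum-δ (end₂ e) λ v → x v * (t * x (end₁ e) + Q * x v)))
        (solve 4 (λ t Q a b → a :* (t :* b :+ Q :* a) :+ b :* (t :* a :+ Q :* b) := φᵖ t Q a b) refl t Q (x (end₁ e)) (x (end₂ e)))))

  flow-joins : ∀ {e v j} → Joins e v j → flow e v ≈ t * x j + Q * x v
  flow-joins {e} (inj₁ (≡.refl , ≡.refl)) = trans (+-cong (reflexive (when-yes (end₁ e ≟ end₁ e) ≡.refl))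
    (reflexive (when-no (end₁ e ≟ end₂ e) (proper e)))) (+-identityʳ _)
  flow-joins {e} (inj₂ (≡.refl , ≡.refl)) = trans (+-cong (reflexive (when-no (end₂ e ≟ end₁ e) (proper e ∘ ≡.sym)))
    (reflexive (when-yes (end₂ e ≟ end₂ e) ≡.refl))) (+-identityˡ _)

  flow-avoids : ∀ {e v} → (∀ {j} → ¬ Joins e v j) → flow e v ≈ 0#
  flow-avoids {e} {v} avoids = trans (+-cong
    (reflexive (when-no (v ≟ end₁ e) λ eq → avoids (inj₁ (≡.sym eq , ≡.refl))))
    (reflexive (when-no (v ≟ end₂ e) λ eq → avoids (inj₂ (≡.refl , ≡.sym eq))))) (+-identityˡ 0#)

  energy-joins : ∀ {e a b} → Joins e a b → edge-energy e ≈ φ (x a) (x b)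
  energy-joins (inj₁ (≡.refl , ≡.refl)) = refl
  energy-joins (inj₂ (≡.refl , ≡.refl)) = φ-comm _ _

-- Comparison of a graph with the extremal form

module SpectralCore (R : OrderedRing) (q : ℕ) {n} (Γ : Graph n (suc n))
  (root : CharacteristicRoot R q (n ∸ 5))
  (x : Fin n → OrderedRing.Carrier R)
  (0≤x : ∀ v → OrderedRing._≤_ R (OrderedRing.0# R) (x v))
  where

  open OrderedRingProperties R
  open Sums R
  open Graph Γ
  open ExtremalForm R q (n ∸ 5) root
  open Characteristic R q (n ∸ 5) using (Q; 0≤Q)
  open GraphForm R Γ t Q 0<t 0≤Q x

  Avoids : Fin (suc n) → Fin n → Set
  Avoids e r = ∀ {j} → ¬ Joins e r j

  -- Only the four largest places are ranked. `v₅` stays free because it has two uses: as a vertex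
  -- not adjacent to `r`, or as the largest of the remaining ones. The five play the roles of h, c,
  -- a, b and u in the extremal form; the other n - 5 = k - 6 vertices play those of the leaves at
  -- the hub.
  module Ordered (r v₂ v₃ v₄ v₅ : Fin n) (distinct : Injective _≡_ _≡_ (five r v₂ v₃ v₄ v₅))
    (≤x₁ : ∀ j → x j ≤ x r)
    (≤x₂ : ∀ j → j ≢ r → x j ≤ x v₂)
    (≤x₃ : ∀ j → j ≢ r → j ≢ v₂ → x j ≤ x v₃)
    (≤x₄ : ∀ j → j ≢ r → j ≢ v₂ → j ≢ v₃ → x j ≤ x v₄) where

    private
      _apart_ : ∀ i j → i ≢ j → five r v₂ v₃ v₄ v₅ i ≢ five r v₂ v₃ v₄ v₅ j
      (i apart j) i≢j eq = i≢j (distinct eq)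

      5+[n∸5]≡n : 5 ℕ.+ (n ∸ 5) ≡ n
      5+[n∸5]≡n = ℕ.m+[n∸m]≡n (injective⇒≤ distinct)

      others : Complement (five r v₂ v₃ v₄ v₅) (n ∸ 5)
      others = complement (n ∸ 5) (five r v₂ v₃ v₄ v₅) distinct 5+[n∸5]≡n

    open Complement others public

    h c a b u : Carrier
    h = x r
    c = x v₂
    a = x v₃
    b = x v₄
    u = x v₅

    p : Fin (n ∸ 5) → Carrier
    p = x ∘ rest

    v₂≢r : v₂ ≢ r
    v₂≢r = (1F apart 0F) λ ()
    v₃≢r : v₃ ≢ r
    v₃≢r = (2F apart 0F) λ ()
    v₃≢v₂ : v₃ ≢ v₂
    v₃≢v₂ = (2F apart 1F) λ ()
    v₄≢r : v₄ ≢ r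
    v₄≢r = (3F apart 0F) λ ()
    v₄≢v₂ : v₄ ≢ v₂
    v₄≢v₂ = (3F apart 1F) λ ()
    v₄≢v₃ : v₄ ≢ v₃
    v₄≢v₃ = (3F apart 2F) λ ()
    v₅≢r : v₅ ≢ r
    v₅≢r = (4F apart 0F) λ ()
    v₅≢v₂ : v₅ ≢ v₂
    v₅≢v₂ = (4F apart 1F) λ ()
    v₅≢v₃ : v₅ ≢ v₃
    v₅≢v₃ = (4F apart 2F) λ ()
    v₅≢v₄ : v₅ ≢ v₄
    v₅≢v₄ = (4F apart 3F) λ ()

    c≤h : c ≤ h
    c≤h = ≤x₁ v₂
    a≤c : a ≤ c
    a≤c = ≤x₂ v₃ v₃≢r
    b≤a : b ≤ a
    b≤a = ≤x₃ v₄ v₄≢r v₄≢v₂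
    b≤c : b ≤ c
    b≤c = ≤-trans b≤a a≤c
    u≤b : u ≤ b
    u≤b = ≤x₄ v₅ v₅≢r v₅≢v₂ v₅≢v₃

    rest≢r : ∀ i → rest i ≢ r
    rest≢r i = disjoint 0F i ∘ ≡.sym

    sum-labels : ∀ (g : Fin n → Carrier) →
      sum g ≈ g r + (g v₂ + (g v₃ + (g v₄ + (g v₅ + sum (g ∘ rest)))))
    sum-labels g = sum-injective-≡ g (joined distinct others) (joined-injective distinct others) 5+[n∸5]≡n

    other-vertex : ∀ j → j ≢ r → j ≢ v₂ → j ≢ v₃ → j ≢ v₄ → j ≡ v₅ ⊎ ∃[ i ] rest i ≡ j
    other-vertex j j≢r j≢v₂ j≢v₃ j≢v₄ = classify (onto (joined distinct others) (joined-injective distinct others) 5+[n∸5]≡n j)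
      where
      onto : ∀ {m n} (f : Fin m → Fin n) → Injective _≡_ _≡_ f → m ≡ n → ∀ y → ∃[ i ] f i ≡ y
      onto f f-inj ≡.refl = injective⇒surjective f f-inj
      classify : ∃[ i ] joined distinct others i ≡ j → j ≡ v₅ ⊎ ∃[ i ] rest i ≡ j
      classify (0F , eq) = contradiction (≡.sym eq) j≢r
      classify (1F , eq) = contradiction (≡.sym eq) j≢v₂
      classify (2F , eq) = contradiction (≡.sym eq) j≢v₃
      classify (3F , eq) = contradiction (≡.sym eq) j≢v₄
      classify (4F , eq) = inj₁ (≡.sym eq)
      classify (suc (suc (suc (suc (suc i)))) , eq) = inj₂ (i , eq)

    data Location (e : Fin (suc n)) : Set where
      at-v₂ : ∀ j → Joins e v₂ j → j ≢ r → j ≢ v₂ → Location e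
      away  : edge-energy e ≤ φ a b → Location e

    -- Among the vertices other than `r`, only `v₂` can exceed the value a. Without `v₂`, the ends
    -- are two distinct vertices, whose values are bounded by a and b in one order or the other.
    locate : ∀ e → Avoids e r → Location e
    locate e avoids with end₁ e ≟ v₂ | end₂ e ≟ v₂
    ... | yes eq | _ = at-v₂ (end₂ e) (inj₁ (eq , ≡.refl)) (λ eq′ → avoids (inj₂ (≡.refl , eq′))) (λ eq′ → proper e (≡.trans eq (≡.sym eq′)))
    ... | no _ | yes eq = at-v₂ (end₁ e) (inj₂ (≡.refl , eq)) (λ eq′ → avoids (inj₁ (eq′ , ≡.refl))) (λ eq′ → proper e (≡.trans eq′ (≡.sym eq)))
    ... | no ne₁ | no ne₂ = away (bound (end₁ e ≟ v₃))
      where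
      1≢r : end₁ e ≢ r
      1≢r eq = avoids (inj₁ (eq , ≡.refl))
      2≢r : end₂ e ≢ r
      2≢r eq = avoids (inj₂ (≡.refl , eq))
      bound : Dec (end₁ e ≡ v₃) → edge-energy e ≤ φ a b
      bound (yes eq) = φ-mono (0≤x _) (0≤x _) (≤x₃ _ 1≢r ne₁)
        (≤x₄ _ 2≢r ne₂ λ eq′ → proper e (≡.trans eq (≡.sym eq′)))
      bound (no ne) = ≤-respˡ (φ-comm _ _) (φ-mono (0≤x _) (0≤x _) (≤x₃ _ 2≢r ne₂) (≤x₄ _ 1≢r ne₁ ne))

    φab≤φcb : φ a b ≤ φ c b
    φab≤φcb = φ-mono (0≤x _) (0≤x _) a≤c ≤-refl

    energy≤ca : ∀ e → Avoids e r → edge-energy e ≤ φ c a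
    energy≤ca e avoids with locate e avoids
    ... | at-v₂ j joins j≢r j≢v₂ = ≤-respˡ (sym (energy-joins joins)) (φ-mono (0≤x _) (0≤x _) ≤-refl (≤x₃ j j≢r j≢v₂))
    ... | away le = ≤-trans le (≤-trans φab≤φcb (φ-mono (0≤x _) (0≤x _) ≤-refl b≤a))

    energy≤cb : ∀ e → Avoids e r → ¬ Joins e v₂ v₃ → edge-energy e ≤ φ c b
    energy≤cb e avoids not-v₃ with locate e avoids
    ... | at-v₂ j joins j≢r j≢v₂ = ≤-respˡ (sym (energy-joins joins))
      (φ-mono (0≤x _) (0≤x _) ≤-refl (≤x₄ j j≢r j≢v₂ λ { ≡.refl → not-v₃ joins }))
    ... | away le = ≤-trans le φab≤φcb

    -- Γ is simple, so at most one of two distinct edges is v₂v₃; the other is bounded by φ c b.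
    energy-pair : ∀ e f → e ≢ f → Avoids e r → Avoids f r → edge-energy e + edge-energy f ≤ φ c a + φ c b
    energy-pair e f e≢f e-avoids f-avoids with joins? Γ e v₂ v₃
    ... | yes joins = +-mono-≤ (energy≤ca e e-avoids) (energy≤cb f f-avoids λ joins′ → e≢f (simple joins joins′))
    ... | no ¬joins = ≤-respʳ (+-comm _ _) (+-mono-≤ (energy≤cb e e-avoids ¬joins) (energy≤ca f f-avoids))

    -- Next to `e₁` and `e₂`, the tree edge of the non-neighbour `u₀` is a third edge avoiding `r`.
    -- These three are weighed against the three edges that join c to a, b and u.
    module Labelled (S : Skeleton Γ r) (u₀ : Fin n) (u₀≢r : u₀ ≢ r) (r≁u₀ : ¬ r ∼ u₀)
      (star : ∀ v → B * x v ≤ sum (λ e → flow e v)) where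

      open Skeleton S public

      joins-r⇒∼ : ∀ j → j ≢ r → ∀ {k} → Joins (tree j) r k → r ∼ j
      joins-r⇒∼ j j≢r joins with tree-joins j j≢r
      ... | p , joins′ , _ with joins-unique joins joins′
      ...   | inj₁ (r≡j , _) = contradiction (≡.sym r≡j) j≢r
      ...   | inj₂ (≡.refl , _) = tree j , joins-sym joins′

      s₀-avoids : Avoids (tree u₀) r
      s₀-avoids joins = r≁u₀ (joins-r⇒∼ u₀ u₀≢r joins)

      s₀≢e₁ : tree u₀ ≢ e₁
      s₀≢e₁ = proj₂ (proj₂ (tree-joins u₀ u₀≢r))

      s₀≢e₂ : tree u₀ ≢ e₂
      s₀≢e₂ = tree≢e₂ u₀

      tree-energy : ∀ j → j ≢ r → edge-energy (tree j) ≤ φ h (x j)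
      tree-energy j j≢r with tree-joins j j≢r
      ... | p , joins , _ = ≤-respˡ (sym (trans (energy-joins joins) (φ-comm _ _))) (φ-mono (0≤x _) (0≤x _) (≤x₁ p) ≤-refl)

      total-energy : sum edge-energy ≈ edge-energy e₂ + (edge-energy e₁ + (edge-energy (tree v₂) + (edge-energy (tree v₃)
        + (edge-energy (tree v₄) + (edge-energy (tree v₅) + sum (λ i → edge-energy (tree (rest i))))))))
      total-energy = trans (sum-injective edge-energy all-edges all-edges-injective)
        (+-congˡ (trans (sum-labels (edge-energy ∘ tree)) (+-congʳ (reflexive (≡.cong edge-energy tree-root)))))

      B*norm≤total : B * norm h c a b u p ≤ sum edge-energy
      B*norm≤total = ≤-resp
        (trans (sum-cong λ v → trans (sym (*-assoc (x v) B (x v))) (trans (*-congʳ (*-comm (x v) B)) (*-assoc B (x v) (x v))))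
          (trans (sym (*-distribˡ-sum B (λ v → x v * x v))) (*-congˡ (sum-labels λ v → x v * x v))))
        flow-energy (sum-mono λ v → *-monoˡ-≤ (0≤x v) (star v))

      spoke? : ∀ j → Dec (r ∼ j) → Carrier
      spoke? j (yes _) = t * x j + Q * h
      spoke? j (no _)  = 0#

      spoke : Fin n → Carrier
      spoke j = spoke? j (r ∼? j)

      spoke≤ : ∀ j → spoke j ≤ t * x j + Q * h
      spoke≤ j = helper (r ∼? j)
        where
        helper : ∀ d → spoke? j d ≤ t * x j + Q * h
        helper (yes _) = ≤-refl
        helper (no _)  = +-nonneg (*-nonneg (<⇒≤ 0<t) (0≤x j)) (*-nonneg 0≤Q (0≤x r))

      -- A vertex not adjacent to `r` contributes zero, less than the positive amount required. In
      -- this way equality in the hub equation is read as adjacency.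
      spoke-∼ : ∀ j → 0# < x j → t * x j + Q * h ≤ spoke j → r ∼ j
      spoke-∼ j 0<xⱼ = helper (r ∼? j)
        where
        helper : ∀ d → t * x j + Q * h ≤ spoke? j d → r ∼ j
        helper (yes r∼j) le = r∼j
        helper (no _)    le = contradiction le (+-pos-nonneg (*-positive 0<t 0<xⱼ) (*-nonneg 0≤Q (0≤x r)))

      spoke-u₀ : spoke u₀ ≈ 0#
      spoke-u₀ = helper (r ∼? u₀)
        where
        helper : ∀ d → spoke? u₀ d ≈ 0#
        helper (yes r∼u₀) = contradiction r∼u₀ r≁u₀
        helper (no _)     = refl

      flow-tree : ∀ j → j ≢ r → flow (tree j) r ≈ spoke j
      flow-tree j j≢r = helper (r ∼? j)
        where
        helper : ∀ d → flow (tree j) r ≈ spoke? j d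
        helper (yes r∼j) = flow-joins (tree-neighbour j r∼j)
        helper (no r≁j)  = flow-avoids λ joins → r≁j (joins-r⇒∼ j j≢r joins)

      hub-≤ : B * h ≤ spoke v₂ + (spoke v₃ + (spoke v₄ + (spoke v₅ + sum (spoke ∘ rest))))
      hub-≤ = ≤-respʳ (trans (sum-injective (λ e → flow e r) all-edges all-edges-injective)
        (trans (+-cong (flow-avoids e₂-avoids) (trans (sum-labels λ j → flow (tree j) r)
            (+-cong (trans (reflexive (≡.cong (λ e → flow e r) tree-root)) (flow-avoids e₁-avoids))
              (+-cong (flow-tree v₂ v₂≢r) (+-cong (flow-tree v₃ v₃≢r) (+-cong (flow-tree v₄ v₄≢r) (+-cong (flow-tree v₅ v₅≢r)
                (sum-cong λ i → flow-tree (rest i) (rest≢r i)))))))))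
          (trans (+-identityˡ _) (+-identityˡ _)))) (star r)

      rim : Carrier
      rim = edge-energy (tree v₂) + edge-energy (tree v₃) + edge-energy (tree v₄) + sum (λ i → edge-energy (tree (rest i)))

      rest≤ : sum (λ i → edge-energy (tree (rest i))) ≤ sum (λ i → φ h (p i))
      rest≤ = sum-mono λ i → tree-energy (rest i) (rest≢r i)

      rim≤ : rim ≤ φ h c + φ h a + φ h b + sum (λ i → φ h (p i))
      rim≤ = +-mono-≤ (+-mono-≤ (+-mono-≤ (tree-energy v₂ v₂≢r) (tree-energy v₃ v₃≢r)) (tree-energy v₄ v₄≢r)) rest≤

      total-energy′ : sum edge-energy ≈ rim + (edge-energy e₁ + edge-energy e₂ + edge-energy (tree v₅))
      total-energy′ = trans total-energy (solve 7 (λ e₂ e₁ t₂ t₃ t₄ t₅ Σ →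
        e₂ :+ (e₁ :+ (t₂ :+ (t₃ :+ (t₄ :+ (t₅ :+ Σ))))) := (t₂ :+ t₃ :+ t₄ :+ Σ) :+ (e₁ :+ e₂ :+ t₅)) refl _ _ _ _ _ _ _)

      e₁+e₂≤ : edge-energy e₁ + edge-energy e₂ ≤ φ c a + φ c b
      e₁+e₂≤ = energy-pair e₁ e₂ e₁≢e₂ e₁-avoids e₂-avoids

    module Strict (0<c : 0# < c) (0<b : 0# < b) (0<u : 0# < u) (a≈b : a ≈ b) (a<c : a < c) (u<a : u < a) (p<a : ∀ i → p i < a) where

      other<b : ∀ j → j ≡ v₅ ⊎ ∃[ i ] rest i ≡ j → x j < b
      other<b j (inj₁ ≡.refl)       = <-respʳ a≈b u<a
      other<b j (inj₂ (i , ≡.refl)) = <-respʳ a≈b (p<a i)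

      strict : ∀ e → Avoids e r → ¬ Joins e v₂ v₃ → ¬ Joins e v₂ v₄ → edge-energy e < φ c b
      strict e avoids ¬v₃ ¬v₄ = case (locate e avoids)
        where
        case : Location e → edge-energy e < φ c b
        case (away le) = ≤-<-trans le (<-respʳ (φ-comm b c) (≤-<-trans (≤-reflexive (φ-comm a b)) (φ-monoʳ-< b 0<b (0≤x v₃) a<c)))
        case (at-v₂ j joins j≢r j≢v₂) = ≤-<-trans (≤-reflexive (energy-joins joins)) (φ-monoʳ-< c 0<c (0≤x j)
          (other<b j (other-vertex j j≢r j≢v₂ (λ { ≡.refl → ¬v₃ joins }) (λ { ≡.refl → ¬v₄ joins }))))

      -- An edge other than v₂v₃ and v₂v₄ has energy strictly below φ c b, and its partner cannot
      -- exceed φ c a to make up for it.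
      optimal : ∀ e f → Avoids e r → Avoids f r → φ c a + φ c b ≤ edge-energy e + edge-energy f → Joins e v₂ v₃ ⊎ Joins e v₂ v₄
      optimal e f e-avoids f-avoids le = case (joins? Γ e v₂ v₃) (joins? Γ e v₂ v₄)
        where
        case : Dec (Joins e v₂ v₃) → Dec (Joins e v₂ v₄) → Joins e v₂ v₃ ⊎ Joins e v₂ v₄
        case (yes joins) _           = inj₁ joins
        case (no _)      (yes joins) = inj₂ joins
        case (no ¬v₃)    (no ¬v₄)    = contradiction
          (+-cancel-≤ˡ (energy≤ca f f-avoids) (≤-respˡ (+-comm (φ c a) (φ c b)) le)) (strict e e-avoids ¬v₃ ¬v₄)

      optimal-pair : ∀ e f → e ≢ f → Avoids e r → Avoids f r → φ c a + φ c b ≤ edge-energy e + edge-energy f → v₂ ∼ v₃ × v₂ ∼ v₄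
      optimal-pair e f e≢f e-avoids f-avoids le =
        case (optimal e f e-avoids f-avoids le) (optimal f e f-avoids e-avoids (≤-respʳ (+-comm (edge-energy e) (edge-energy f)) le))
        where
        case : Joins e v₂ v₃ ⊎ Joins e v₂ v₄ → Joins f v₂ v₃ ⊎ Joins f v₂ v₄ → v₂ ∼ v₃ × v₂ ∼ v₄
        case (inj₁ j₁) (inj₁ j₂) = contradiction (simple j₁ j₂) e≢f
        case (inj₁ j₁) (inj₂ j₂) = (e , j₁) , (f , j₂)
        case (inj₂ j₁) (inj₁ j₂) = (f , j₂) , (e , j₁)
        case (inj₂ j₁) (inj₂ j₂) = contradiction (simple j₁ j₂) e≢f

      -- If the other end were not `v₂`, its value would be at most a < c, and φ is strictly
      -- monotone since u is positive.
      optimal-leaf : ∀ {s k} → Joins s v₅ k → k ≢ r → φ c u ≤ edge-energy s → v₂ ∼ v₅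
      optimal-leaf {s} {k} joins k≢r le = case (k ≟ v₂)
        where
        case : Dec (k ≡ v₂) → v₂ ∼ v₅
        case (yes ≡.refl) = s , joins-sym joins
        case (no k≢v₂)    = contradiction (≤-resp (φ-comm c u) (energy-joins joins) le)
          (≤-<-trans (φ-monoʳ u (0≤x v₅) (0≤x k) (≤x₃ k k≢r k≢v₂)) (φ-monoʳ-< u 0<u (0≤x v₃) a<c))

    hub-spokes : r ∼ v₂ → r ∼ v₃ → r ∼ v₄ → (∀ i → r ∼ rest i) → ∀ j → j ≢ r → j ≢ v₅ → r ∼ j
    hub-spokes r∼v₂ r∼v₃ r∼v₄ r∼rest j j≢r j≢v₅ = case (j ≟ v₂) (j ≟ v₃) (j ≟ v₄)
      where
      far : j ≡ v₅ ⊎ ∃[ i ] rest i ≡ j → r ∼ j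
      far (inj₁ j≡v₅)         = contradiction j≡v₅ j≢v₅
      far (inj₂ (i , ≡.refl)) = r∼rest i
      case : Dec (j ≡ v₂) → Dec (j ≡ v₃) → Dec (j ≡ v₄) → r ∼ j
      case (yes ≡.refl) _ _ = r∼v₂
      case (no _) (yes ≡.refl) _ = r∼v₃
      case (no _) (no _) (yes ≡.refl) = r∼v₄
      case (no j≢v₂) (no j≢v₃) (no j≢v₄) = far (other-vertex j j≢r j≢v₂ j≢v₃ j≢v₄)

    -- If r is not adjacent to a vertex outside the top four, that vertex becomes the leaf at v₂.
    far-case : Skeleton Γ r → ¬ r ∼ v₅ → (∀ v → B * x v ≤ sum (λ e → flow e v)) → 0# < h → Extremal Γ
    far-case S r≁v₅ star 0<h = r , v₂ , v₃ , v₄ , v₅ , distinct ,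
      hub-spokes r∼v₂ r∼v₃ r∼v₄ r∼rest , proj₁ c∼a∧b , proj₂ c∼a∧b , optimal-leaf s₀-joins k≢r (+-cancel-≤ʳ e₁+e₂≤ three≥)
      where
      open Labelled S v₅ v₅≢r r≁v₅ star
      k : Fin n
      k = proj₁ (tree-joins v₅ v₅≢r)
      s₀-joins : Joins (tree v₅) v₅ k
      s₀-joins = proj₁ (proj₂ (tree-joins v₅ v₅≢r))
      k≢r : k ≢ r
      k≢r k≡r = s₀-avoids (joins-sym (≡.subst (Joins (tree v₅) v₅) k≡r s₀-joins))
      s₀≤ : edge-energy (tree v₅) ≤ φ c u
      s₀≤ = ≤-resp (sym (energy-joins s₀-joins)) (φ-comm u c) (φ-mono (0≤x v₅) (0≤x k) ≤-refl (≤x₂ k k≢r))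
      total≤ : sum edge-energy ≤ energy h c a b u p
      total≤ = ≤-respˡ (sym total-energy′) (+-mono-≤ rim≤ (+-mono-≤ e₁+e₂≤ s₀≤))
      tight : B * norm h c a b u p ≤ energy h c a b u p
      tight = ≤-trans B*norm≤total total≤
      module T = Tight h c a b u p tight 0<h c≤h
      -- The reverse bound: the form of Γ is at least `B * norm`, which by the sum of squares is at
      -- least the extremal form. Cancelling the hub edges leaves the three others.
      three≥ : φ c a + φ c b + φ c u ≤ edge-energy e₁ + edge-energy e₂ + edge-energy (tree v₅)
      three≥ = +-cancel-≤ʳ rim≤ (≤-respʳ total-energy′ (≤-trans (energy≤B*norm h c a b u p) B*norm≤total))
      two≥ : φ c a + φ c b ≤ edge-energy e₁ + edge-energy e₂
      two≥ = +-cancel-≤ˡ s₀≤ three≥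
      -- For the extremal graph the hub equation holds exactly for these values; the hub inequality
      -- of Γ lacks the term of `v₅`, so no further term can be missing from it.
      spokes≥ : (t * c + Q * h) + ((t * a + Q * h) + ((t * b + Q * h) + sum (λ i → t * p i + Q * h)))
        ≤ spoke v₂ + (spoke v₃ + (spoke v₄ + sum (spoke ∘ rest)))
      spokes≥ = ≤-resp T.hub-eq (+-congˡ (+-congˡ (+-congˡ (trans (+-congʳ spoke-u₀) (+-identityˡ (sum (spoke ∘ rest))))))) hub-≤
      Σspoke≤ : sum (spoke ∘ rest) ≤ sum (λ i → t * p i + Q * h)
      Σspoke≤ = sum-mono λ i → spoke≤ (rest i)
      spokes≥₃ : (t * a + Q * h) + ((t * b + Q * h) + sum (λ i → t * p i + Q * h)) ≤ spoke v₃ + (spoke v₄ + sum (spoke ∘ rest))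
      spokes≥₃ = +-cancel-≤ʳ (spoke≤ v₂) spokes≥
      spokes≥₄ : (t * b + Q * h) + sum (λ i → t * p i + Q * h) ≤ spoke v₄ + sum (spoke ∘ rest)
      spokes≥₄ = +-cancel-≤ʳ (spoke≤ v₃) spokes≥₃
      0<b : 0# < b
      0<b = <-respʳ T.a≈b T.0<a
      r∼v₂ : r ∼ v₂
      r∼v₂ = spoke-∼ v₂ T.0<c (+-cancel-≤ˡ (+-mono-≤ (spoke≤ v₃) (+-mono-≤ (spoke≤ v₄) Σspoke≤)) spokes≥)
      r∼v₃ : r ∼ v₃
      r∼v₃ = spoke-∼ v₃ T.0<a (+-cancel-≤ˡ (+-mono-≤ (spoke≤ v₄) Σspoke≤) spokes≥₃)
      r∼v₄ : r ∼ v₄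
      r∼v₄ = spoke-∼ v₄ 0<b (+-cancel-≤ˡ Σspoke≤ spokes≥₄)
      r∼rest : ∀ i → r ∼ rest i
      r∼rest i = spoke-∼ (rest i) (T.0<p i) (sum-cancel-≤ (λ i → spoke≤ (rest i)) (+-cancel-≤ʳ (spoke≤ v₄) spokes≥₄) i)
      open Strict T.0<c 0<b T.0<u T.a≈b T.a<c T.u<a T.p<a
      c∼a∧b : v₂ ∼ v₃ × v₂ ∼ v₄
      c∼a∧b = optimal-pair e₁ e₂ e₁≢e₂ e₁-avoids e₂-avoids two≥

    -- Otherwise v₅, the largest of the remaining vertices, can still serve as the leaf, but then the bound is strict.
    module _ (≤x₅ : ∀ j → j ≢ r → j ≢ v₂ → j ≢ v₃ → j ≢ v₄ → x j ≤ u) where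

      -- At `v₂`, the other end has value at most u. For an edge that misses `v₂` too, φ c b + φ h u
      -- is traded for φ c u + φ h b by rearrangement, since c ≤ h and u ≤ b.
      low : ∀ e → Avoids e r → ¬ Joins e v₂ v₃ → ¬ Joins e v₂ v₄ → edge-energy e + φ h u ≤ φ c u + φ h b
      low e avoids ¬v₃ ¬v₄ with locate e avoids
      ... | at-v₂ j joins j≢r j≢v₂ = +-mono-≤ (≤-respˡ (sym (energy-joins joins)) (φ-mono (0≤x _) (0≤x _) ≤-refl
              (≤x₅ j j≢r j≢v₂ (λ { ≡.refl → ¬v₃ joins }) (λ { ≡.refl → ¬v₄ joins }))))
            (φ-mono (0≤x _) (0≤x _) ≤-refl u≤b)
      ... | away le = ≤-trans (+-monoˡ-≤ (φ h u) (≤-trans le φab≤φcb))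
            (≤-resp (+-comm _ _) (+-comm _ _) (φ-rearrange c≤h u≤b))

      -- At most two of three distinct edges are v₂v₃ and v₂v₄, so one falls under `low` and the
      -- remaining two under `energy-pair`.
      three≤ : ∀ e f g → e ≢ f → e ≢ g → f ≢ g → Avoids e r → Avoids f r → Avoids g r →
        edge-energy e + edge-energy f + edge-energy g + φ h u ≤ φ c a + φ c b + φ c u + φ h b
      three≤ e f g e≢f e≢g f≢g ae af ag with joins? Γ e v₂ v₃ | joins? Γ e v₂ v₄ | joins? Γ f v₂ v₃ | joins? Γ f v₂ v₄ | joins? Γ g v₂ v₃ | joins? Γ g v₂ v₄
      ... | no e₃ | no e₄ | _ | _ | _ | _ = ≤-resp
        (solve 4 (λ e f g h → (f :+ g) :+ (e :+ h) := e :+ f :+ g :+ h) refl _ _ _ _)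
        (solve 4 (λ a b c d → (a :+ b) :+ (c :+ d) := a :+ b :+ c :+ d) refl _ _ _ _)
        (+-mono-≤ (energy-pair f g f≢g af ag) (low e ae e₃ e₄))
      ... | _ | _ | no f₃ | no f₄ | _ | _ = ≤-resp
        (solve 4 (λ e f g h → (e :+ g) :+ (f :+ h) := e :+ f :+ g :+ h) refl _ _ _ _)
        (solve 4 (λ a b c d → (a :+ b) :+ (c :+ d) := a :+ b :+ c :+ d) refl _ _ _ _)
        (+-mono-≤ (energy-pair e g e≢g ae ag) (low f af f₃ f₄))
      ... | _ | _ | _ | _ | no g₃ | no g₄ = ≤-resp
        (solve 4 (λ e f g h → (e :+ f) :+ (g :+ h) := e :+ f :+ g :+ h) refl _ _ _ _)
        (solve 4 (λ a b c d → (a :+ b) :+ (c :+ d) := a :+ b :+ c :+ d) refl _ _ _ _)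
        (+-mono-≤ (energy-pair e f e≢f ae af) (low g ag g₃ g₄))
      ... | yes e₃ | _ | yes f₃ | _ | _ | _ = contradiction (simple e₃ f₃) e≢f
      ... | yes e₃ | _ | _ | _ | yes g₃ | _ = contradiction (simple e₃ g₃) e≢g
      ... | _ | _ | yes f₃ | _ | yes g₃ | _ = contradiction (simple f₃ g₃) f≢g
      ... | _ | yes e₄ | _ | yes f₄ | _ | _ = contradiction (simple e₄ f₄) e≢f
      ... | _ | yes e₄ | _ | _ | _ | yes g₄ = contradiction (simple e₄ g₄) e≢g
      ... | _ | _ | _ | yes f₄ | _ | yes g₄ = contradiction (simple f₄ g₄) f≢g

      near-case : Skeleton Γ r → ∀ u₀ → u₀ ≡ v₂ ⊎ u₀ ≡ v₃ ⊎ u₀ ≡ v₄ → ¬ r ∼ u₀ → (∀ v → B * x v ≤ sum (λ e → flow e v)) → ¬ (0# < h)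
      near-case S u₀ which r≁u₀ star 0<h = <-≤-trans T.u<a (≤-trans (≤-reflexive T.a≈b) (b≤ which)) x[u₀]≤u
        where
        u₀≢r : u₀ ≢ r
        u₀≢r = case which
          where
          case : u₀ ≡ v₂ ⊎ u₀ ≡ v₃ ⊎ u₀ ≡ v₄ → u₀ ≢ r
          case (inj₁ ≡.refl) = v₂≢r
          case (inj₂ (inj₁ ≡.refl)) = v₃≢r
          case (inj₂ (inj₂ ≡.refl)) = v₄≢r
        open Labelled S u₀ u₀≢r r≁u₀ star
        b≤ : u₀ ≡ v₂ ⊎ u₀ ≡ v₃ ⊎ u₀ ≡ v₄ → b ≤ x u₀
        b≤ (inj₁ ≡.refl)        = b≤c
        b≤ (inj₂ (inj₁ ≡.refl)) = b≤a
        b≤ (inj₂ (inj₂ ≡.refl)) = ≤-refl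
        E : Fin (suc n) → Carrier
        E = edge-energy
        -- The tree edge of `u₀` is released, to be counted with `e₁` and `e₂`. The edge from the
        -- hub to `u₀` that takes its place has energy at least φ h b.
        four≤ : E (tree v₂) + E (tree v₃) + E (tree v₄) + E (tree v₅) + φ h b ≤ φ h c + φ h a + φ h b + φ h u + E (tree u₀)
        four≤ = case which
          where
          case : u₀ ≡ v₂ ⊎ u₀ ≡ v₃ ⊎ u₀ ≡ v₄ →
            E (tree v₂) + E (tree v₃) + E (tree v₄) + E (tree v₅) + φ h b ≤ φ h c + φ h a + φ h b + φ h u + E (tree u₀)
          case (inj₁ ≡.refl) = ≤-resp
            (solve 5 (λ t₂ t₃ t₄ t₅ m → m :+ t₃ :+ t₄ :+ t₅ :+ t₂ := t₂ :+ t₃ :+ t₄ :+ t₅ :+ m) refl (E (tree v₂)) (E (tree v₃)) (E (tree v₄)) (E (tree v₅)) (φ h b)) refl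
            (+-monoˡ-≤ (E (tree v₂)) (+-mono-≤ (+-mono-≤ (+-mono-≤ (φ-mono (0≤x r) (0≤x v₄) ≤-refl b≤c) (tree-energy v₃ v₃≢r)) (tree-energy v₄ v₄≢r)) (tree-energy v₅ v₅≢r)))
          case (inj₂ (inj₁ ≡.refl)) = ≤-resp
            (solve 5 (λ t₂ t₃ t₄ t₅ m → t₂ :+ m :+ t₄ :+ t₅ :+ t₃ := t₂ :+ t₃ :+ t₄ :+ t₅ :+ m) refl (E (tree v₂)) (E (tree v₃)) (E (tree v₄)) (E (tree v₅)) (φ h b)) refl
            (+-monoˡ-≤ (E (tree v₃)) (+-mono-≤ (+-mono-≤ (+-mono-≤ (tree-energy v₂ v₂≢r) (φ-mono (0≤x r) (0≤x v₄) ≤-refl b≤a)) (tree-energy v₄ v₄≢r)) (tree-energy v₅ v₅≢r)))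
          case (inj₂ (inj₂ ≡.refl)) = ≤-resp
            (solve 5 (λ t₂ t₃ t₄ t₅ m → t₂ :+ t₃ :+ m :+ t₅ :+ t₄ := t₂ :+ t₃ :+ t₄ :+ t₅ :+ m) refl (E (tree v₂)) (E (tree v₃)) (E (tree v₄)) (E (tree v₅)) (φ h b)) refl
            (+-monoˡ-≤ (E (tree v₄)) (+-mono-≤ (+-mono-≤ (+-mono-≤ (tree-energy v₂ v₂≢r) (tree-energy v₃ v₃≢r)) ≤-refl) (tree-energy v₅ v₅≢r)))
        total≤ : sum edge-energy ≤ energy h c a b u p
        total≤ = ≤-respˡ (sym total-energy′) (+-cancelʳ-≤ (E (tree u₀) + φ h b + φ h u) (≤-resp
          (solve 10 (λ t₂ t₃ t₄ t₅ e₁ e₂ s hb hu Σ → ((t₂ :+ t₃ :+ t₄ :+ t₅ :+ hb) :+ Σ) :+ (s :+ e₁ :+ e₂ :+ hu) :=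
            ((t₂ :+ t₃ :+ t₄ :+ Σ) :+ (e₁ :+ e₂ :+ t₅)) :+ (s :+ hb :+ hu)) refl
            (E (tree v₂)) (E (tree v₃)) (E (tree v₄)) (E (tree v₅)) (E e₁) (E e₂) (E (tree u₀)) (φ h b) (φ h u) (sum (λ i → E (tree (rest i)))))
          (solve 9 (λ hc ha hb hu s Σ ca cb cu → ((hc :+ ha :+ hb :+ hu :+ s) :+ Σ) :+ (ca :+ cb :+ cu :+ hb) :=
            ((hc :+ ha :+ hb :+ Σ) :+ (ca :+ cb :+ cu)) :+ (s :+ hb :+ hu)) refl
            (φ h c) (φ h a) (φ h b) (φ h u) (E (tree u₀)) (sum (λ i → φ h (p i))) (φ c a) (φ c b) (φ c u))
          (+-mono-≤ (+-mono-≤ four≤ rest≤) (three≤ (tree u₀) e₁ e₂ s₀≢e₁ s₀≢e₂ e₁≢e₂ s₀-avoids e₁-avoids e₂-avoids))))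
        tight : B * norm h c a b u p ≤ energy h c a b u p
        tight = ≤-trans B*norm≤total total≤
        module T = Tight h c a b u p tight 0<h c≤h
        X : Fin n → Carrier
        X j = t * x j + Q * h
        spokes≥ : X v₂ + (X v₃ + X v₄) ≤ (spoke v₂ + (spoke v₃ + spoke v₄)) + X v₅
        spokes≥ = +-cancel-≤ˡ (sum-mono λ i → spoke≤ (rest i)) (≤-resp
          (trans T.hub-eq (solve 4 (λ a b c d → a :+ (b :+ (c :+ d)) := (a :+ (b :+ c)) :+ d) refl (X v₂) (X v₃) (X v₄) (sum (X ∘ rest))))
          (solve 5 (λ a b c d e → a :+ (b :+ (c :+ (d :+ e))) := ((a :+ (b :+ c)) :+ d) :+ e) refl (spoke v₂) (spoke v₃) (spoke v₄) (X v₅) (sum (spoke ∘ rest)))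
          (≤-trans hub-≤ (+-monoʳ-≤ (spoke v₂) (+-monoʳ-≤ (spoke v₃) (+-monoʳ-≤ (spoke v₄) (+-monoˡ-≤ (sum (spoke ∘ rest)) (spoke≤ v₅)))))))
        -- The hub inequality of Γ lacks the term of `u₀`, and only the term of `v₅` is available to
        -- compensate. This gives x u₀ ≤ u, contrary to u < b ≤ x u₀.
        Xu₀≤ : X u₀ ≤ X v₅
        Xu₀≤ = ≤-trans (case which) (≤-reflexive (trans (+-congʳ spoke-u₀) (+-identityˡ (X v₅))))
          where
          case : u₀ ≡ v₂ ⊎ u₀ ≡ v₃ ⊎ u₀ ≡ v₄ → X u₀ ≤ spoke u₀ + X v₅
          case (inj₁ ≡.refl) = +-cancel-≤ˡ (+-mono-≤ (spoke≤ v₃) (spoke≤ v₄)) (≤-respʳ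
            (solve 4 (λ a b c d → (a :+ (b :+ c)) :+ d := (a :+ d) :+ (b :+ c)) refl (spoke v₂) (spoke v₃) (spoke v₄) (X v₅)) spokes≥)
          case (inj₂ (inj₁ ≡.refl)) = +-cancel-≤ˡ (+-mono-≤ (spoke≤ v₂) (spoke≤ v₄)) (≤-resp
            (solve 3 (λ a b c → a :+ (b :+ c) := b :+ (a :+ c)) refl (X v₂) (X v₃) (X v₄))
            (solve 4 (λ a b c d → (a :+ (b :+ c)) :+ d := (b :+ d) :+ (a :+ c)) refl (spoke v₂) (spoke v₃) (spoke v₄) (X v₅)) spokes≥)
          case (inj₂ (inj₂ ≡.refl)) = +-cancel-≤ˡ (+-mono-≤ (spoke≤ v₂) (spoke≤ v₃)) (≤-resp
            (solve 3 (λ a b c → a :+ (b :+ c) := c :+ (a :+ b)) refl (X v₂) (X v₃) (X v₄))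
            (solve 4 (λ a b c d → (a :+ (b :+ c)) :+ d := (c :+ d) :+ (a :+ b)) refl (spoke v₂) (spoke v₃) (spoke v₄) (X v₅)) spokes≥)
        x[u₀]≤u : x u₀ ≤ u
        x[u₀]≤u = *-cancelˡ-≤ 0<t (+-cancelʳ-≤ (Q * h) Xu₀≤)

-- With at most four vertices there would be a universal vertex.
module FifthVertex {n} (Γ : Graph n (suc n)) (no-universal : ∀ r → ∃[ u ] u ≢ r × ¬ Graph._∼_ Γ r u) (r u : Fin n) (S : Skeleton Γ r)
  (connected : ∃[ i ] Graph.Reach Γ r i u) (u≢r : u ≢ r) (r≁u : ¬ Graph._∼_ Γ r u) where

  open Graph Γ
  open Skeleton S

  private
    Avoids : Fin (suc n) → Set
    Avoids e = ∀ {j} → ¬ Joins e r j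

    ends≢r : ∀ {e} → Avoids e → end₁ e ≢ r × end₂ e ≢ r
    ends≢r avoids = (λ eq → avoids (inj₁ (eq , ≡.refl))) , (λ eq → avoids (inj₂ (≡.refl , eq)))

    tree-avoids : Avoids (tree u)
    tree-avoids joins with tree-joins u u≢r
    ... | p , joins′ , _ with joins-unique joins joins′
    ...   | inj₁ (r≡u , _) = u≢r (≡.sym r≡u)
    ...   | inj₂ (≡.refl , _) = r≁u (tree u , joins-sym joins′)

    outside : ∀ {P : Fin n → Set} → (∀ j → Dec (P j)) → ¬ (∀ j → P j) → ∃[ j ] ¬ P j
    outside P? ¬all = ¬∀⟶∃¬ n _ P? ¬all

    neighbour : ∀ i {v} → Reach r i v → v ≡ r ⊎ ∃[ j ] r ∼ j
    neighbour zero    r≡v = inj₁ (≡.sym r≡v)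
    neighbour (suc i) (j , reach , j∼v) with neighbour i reach
    ... | inj₁ ≡.refl = inj₂ (_ , j∼v)
    ... | inj₂ found  = inj₂ found

  third : ∀ v₂ → ∃[ j ] j ≢ r × j ≢ v₂
  third v₂ with outside (λ j → (j ≟ r) ⊎-dec (j ≟ v₂)) covered
    where
    covered : ¬ (∀ j → j ≡ r ⊎ j ≡ v₂)
    covered all = proper e₁ (≡.trans (at (end₁ e₁) (proj₁ ends)) (≡.sym (at (end₂ e₁) (proj₂ ends))))
      where
      ends = ends≢r e₁-avoids
      at : ∀ j → j ≢ r → j ≡ v₂
      at j j≢r with all j
      ... | inj₁ j≡r = contradiction j≡r j≢r
      ... | inj₂ j≡v₂ = j≡v₂
  ... | j , ¬p = j , ¬p ∘ inj₁ , ¬p ∘ inj₂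

  fourth : ∀ v₂ v₃ → ∃[ j ] j ≢ r × j ≢ v₂ × j ≢ v₃
  fourth v₂ v₃ with outside (λ j → (j ≟ r) ⊎-dec ((j ≟ v₂) ⊎-dec (j ≟ v₃))) covered
    where
    covered : ¬ (∀ j → j ≡ r ⊎ j ≡ v₂ ⊎ j ≡ v₃)
    covered all = e₁≢e₂ (simple (joins e₁ e₁-avoids) (joins e₂ e₂-avoids))
      where
      at : ∀ j → j ≢ r → j ≡ v₂ ⊎ j ≡ v₃
      at j j≢r with all j
      ... | inj₁ j≡r = contradiction j≡r j≢r
      ... | inj₂ p = p
      joins : ∀ e → Avoids e → Joins e v₂ v₃
      joins e avoids with at (end₁ e) (proj₁ (ends≢r avoids)) | at (end₂ e) (proj₂ (ends≢r avoids))
      ... | inj₁ p | inj₁ q = contradiction (≡.trans p (≡.sym q)) (proper e)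
      ... | inj₁ p | inj₂ q = inj₁ (p , q)
      ... | inj₂ p | inj₁ q = inj₂ (p , q)
      ... | inj₂ p | inj₂ q = contradiction (≡.trans p (≡.sym q)) (proper e)
  ... | j , ¬p = j , ¬p ∘ inj₁ , ¬p ∘ inj₂ ∘ inj₁ , ¬p ∘ inj₂ ∘ inj₂

  -- On four vertices, three distinct edges avoiding `r` would form a triangle on the other three,
  -- and any neighbour of `r` would be universal.
  fifth : ∀ v₂ v₃ v₄ → ∃[ j ] j ≢ r × j ≢ v₂ × j ≢ v₃ × j ≢ v₄
  fifth v₂ v₃ v₄ with outside (λ j → (j ≟ r) ⊎-dec ((j ≟ v₂) ⊎-dec ((j ≟ v₃) ⊎-dec (j ≟ v₄)))) covered
    where
    covered : ¬ (∀ j → j ≡ r ⊎ j ≡ v₂ ⊎ j ≡ v₃ ⊎ j ≡ v₄)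
    covered all = universal
      where
      at : ∀ j → j ≢ r → j ≡ v₂ ⊎ j ≡ v₃ ⊎ j ≡ v₄
      at j j≢r with all j
      ... | inj₁ j≡r = contradiction j≡r j≢r
      ... | inj₂ p = p
      lo hi : Fin 3 → Fin n
      lo 0F = v₂
      lo 1F = v₂
      lo 2F = v₃
      hi 0F = v₃
      hi 1F = v₄
      hi 2F = v₄
      kind : ∀ e → Avoids e → ∃[ k ] Joins e (lo k) (hi k)
      kind e avoids with at (end₁ e) (proj₁ (ends≢r avoids)) | at (end₂ e) (proj₂ (ends≢r avoids))
      ... | inj₁ p        | inj₁ q        = contradiction (≡.trans p (≡.sym q)) (proper e)
      ... | inj₁ p        | inj₂ (inj₁ q) = 0F , inj₁ (p , q)
      ... | inj₁ p        | inj₂ (inj₂ q) = 1F , inj₁ (p , q)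
      ... | inj₂ (inj₁ p) | inj₁ q        = 0F , inj₂ (p , q)
      ... | inj₂ (inj₁ p) | inj₂ (inj₁ q) = contradiction (≡.trans p (≡.sym q)) (proper e)
      ... | inj₂ (inj₁ p) | inj₂ (inj₂ q) = 2F , inj₁ (p , q)
      ... | inj₂ (inj₂ p) | inj₁ q        = 1F , inj₂ (p , q)
      ... | inj₂ (inj₂ p) | inj₂ (inj₁ q) = 2F , inj₂ (p , q)
      ... | inj₂ (inj₂ p) | inj₂ (inj₂ q) = contradiction (≡.trans p (≡.sym q)) (proper e)
      three : Fin 3 → ∃[ e ] Avoids e
      three 0F = tree u , tree-avoids
      three 1F = e₁ , e₁-avoids
      three 2F = e₂ , e₂-avoids
      s₀≢e₁ : tree u ≢ e₁
      s₀≢e₁ = proj₂ (proj₂ (tree-joins u u≢r))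
      three-injective : ∀ i j → proj₁ (three i) ≡ proj₁ (three j) → i ≡ j
      three-injective 0F 0F eq = ≡.refl
      three-injective 0F 1F eq = contradiction eq s₀≢e₁
      three-injective 0F 2F eq = contradiction eq (tree≢e₂ u)
      three-injective 1F 0F eq = contradiction (≡.sym eq) s₀≢e₁
      three-injective 1F 1F eq = ≡.refl
      three-injective 1F 2F eq = contradiction eq e₁≢e₂
      three-injective 2F 0F eq = contradiction (≡.sym eq) (tree≢e₂ u)
      three-injective 2F 1F eq = contradiction (≡.sym eq) e₁≢e₂
      three-injective 2F 2F eq = ≡.refl
      kind₃ : ∀ i → ∃[ k ] Joins (proj₁ (three i)) (lo k) (hi k)
      kind₃ i = kind (proj₁ (three i)) (proj₂ (three i))
      kind₃-injective : Injective _≡_ _≡_ (proj₁ ∘ kind₃)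
      kind₃-injective {i} {j} eq = three-injective i j (simple (proj₂ (kind₃ i))
        (≡.subst (λ k → Joins (proj₁ (three j)) (lo k) (hi k)) (≡.sym eq) (proj₂ (kind₃ j))))
      triangle : ∀ k → lo k ∼ hi k
      triangle k = let i , eq = injective⇒surjective (proj₁ ∘ kind₃) kind₃-injective k in
        proj₁ (three i) , ≡.subst (λ k → Joins (proj₁ (three i)) (lo k) (hi k)) eq (proj₂ (kind₃ i))
      refute : ∀ {i j} → i ≡ v₂ ⊎ i ≡ v₃ ⊎ i ≡ v₄ → j ≡ v₂ ⊎ j ≡ v₃ ⊎ j ≡ v₄ → j ≢ i → i ∼ j
      refute (inj₁ ≡.refl)        (inj₁ ≡.refl)        ne = contradiction ≡.refl ne
      refute (inj₁ ≡.refl)        (inj₂ (inj₁ ≡.refl)) ne = triangle 0F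
      refute (inj₁ ≡.refl)        (inj₂ (inj₂ ≡.refl)) ne = triangle 1F
      refute (inj₂ (inj₁ ≡.refl)) (inj₁ ≡.refl)        ne = ∼-sym (triangle 0F)
      refute (inj₂ (inj₁ ≡.refl)) (inj₂ (inj₁ ≡.refl)) ne = contradiction ≡.refl ne
      refute (inj₂ (inj₁ ≡.refl)) (inj₂ (inj₂ ≡.refl)) ne = triangle 2F
      refute (inj₂ (inj₂ ≡.refl)) (inj₁ ≡.refl)        ne = ∼-sym (triangle 1F)
      refute (inj₂ (inj₂ ≡.refl)) (inj₂ (inj₁ ≡.refl)) ne = ∼-sym (triangle 2F)
      refute (inj₂ (inj₂ ≡.refl)) (inj₂ (inj₂ ≡.refl)) ne = contradiction ≡.refl ne
      universal : ⊥
      universal with neighbour (proj₁ connected) (proj₂ connected)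
      ... | inj₁ u≡r = u≢r u≡r
      ... | inj₂ (i , r∼i) with no-universal i
      ...   | j , j≢i , i≁j with j ≟ r
      ...     | yes ≡.refl = i≁j (∼-sym r∼i)
      ...     | no j≢r = i≁j (refute (at i (∼-irrefl r∼i ∘ ≡.sym)) (at j j≢r) j≢i)
  ... | j , ¬p = j , ¬p ∘ inj₁ , ¬p ∘ inj₂ ∘ inj₁ , ¬p ∘ inj₂ ∘ inj₂ ∘ inj₁ , ¬p ∘ inj₂ ∘ inj₂ ∘ inj₂

module SpectralBound (R : OrderedRing) (q : ℕ) {n} (Γ : Graph n (suc n))
  (connected : ∀ r v → ∃[ i ] Graph.Reach Γ r i v)
  (no-universal : ∀ r → ∃[ u ] u ≢ r × ¬ Graph._∼_ Γ r u)
  (root : CharacteristicRoot R q (n ∸ 5))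
  (x : Fin n → OrderedRing.Carrier R)
  (0≤x : ∀ v → OrderedRing._≤_ R (OrderedRing.0# R) (x v))
  where

  open OrderedRingProperties R
  open Sums R
  open Graph Γ
  open SpectralCore R q Γ root x 0≤x
  open ExtremalForm R q (n ∸ 5) root using (B; t; 0<t)
  open Characteristic R q (n ∸ 5) using (Q; 0≤Q)
  open GraphForm R Γ t Q 0<t 0≤Q x using (flow)

  private
    three? : ∀ (v₂ v₃ v₄ u : Fin n) → (u ≡ v₂ ⊎ u ≡ v₃ ⊎ u ≡ v₄) ⊎ (u ≢ v₂ × u ≢ v₃ × u ≢ v₄)
    three? v₂ v₃ v₄ u with u ≟ v₂ | u ≟ v₃ | u ≟ v₄
    ... | yes eq | _ | _ = inj₁ (inj₁ eq)
    ... | no _ | yes eq | _ = inj₁ (inj₂ (inj₁ eq))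
    ... | no _ | no _ | yes eq = inj₁ (inj₂ (inj₂ eq))
    ... | no n₂ | no n₃ | no n₄ = inj₂ (n₂ , n₃ , n₄)

  extremal : (∀ v → B * x v ≤ sum (λ e → flow e v)) → ¬ (∀ v → x v ≤ 0#) → ¬ ¬ Extremal Γ
  -- `x≰0` asks for a bound on `x v` at a given vertex; this `v` also provides the candidate without
  -- which `argmax` cannot start.
  extremal star x≰0 ¬extremal = x≰0 λ v → contradiction v no-vertex
    where
    no-vertex : ¬ Fin n
    no-vertex v = argmax x {λ _ → ⊤} (λ _ → yes tt) (v , tt) λ (r , _ , ≤x₁) →
      let u , u≢r , r≁u = no-universal r
          0<h : 0# < x r
          0<h h≤0 = x≰0 λ v → ≤-trans (≤x₁ v tt) h≤0
          S = BreadthFirstSkeleton.skeleton Γ r u u≢r (connected r)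
          open FifthVertex Γ no-universal r u S (connected r u) u≢r r≁u
      in argmax x {λ j → j ≢ r} (λ j → ¬? (j ≟ r)) (u , u≢r) λ (v₂ , v₂≢r , ≤x₂) →
         argmax x {λ j → j ≢ r × j ≢ v₂} (λ j → ¬? (j ≟ r) ×-dec ¬? (j ≟ v₂)) (third v₂) λ (v₃ , (v₃≢r , v₃≢v₂) , ≤x₃) →
         argmax x {λ j → j ≢ r × j ≢ v₂ × j ≢ v₃} (λ j → ¬? (j ≟ r) ×-dec (¬? (j ≟ v₂) ×-dec ¬? (j ≟ v₃))) (fourth v₂ v₃)
           λ (v₄ , (v₄≢r , v₄≢v₂ , v₄≢v₃) , ≤x₄) →
         finish r v₂ v₃ v₄ (λ j → ≤x₁ j tt) ≤x₂ (λ j a b → ≤x₃ j (a , b)) (λ j a b c → ≤x₄ j (a , b , c))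
           v₂≢r v₃≢r v₃≢v₂ v₄≢r v₄≢v₂ v₄≢v₃ S u u≢r r≁u 0<h (fifth v₂ v₃ v₄) (three? v₂ v₃ v₄ u)
      where
      finish : ∀ r v₂ v₃ v₄ → (∀ j → x j ≤ x r) → (∀ j → j ≢ r → x j ≤ x v₂) → (∀ j → j ≢ r → j ≢ v₂ → x j ≤ x v₃) →
        (∀ j → j ≢ r → j ≢ v₂ → j ≢ v₃ → x j ≤ x v₄) → v₂ ≢ r → v₃ ≢ r → v₃ ≢ v₂ → v₄ ≢ r → v₄ ≢ v₂ → v₄ ≢ v₃ →
        Skeleton Γ r → ∀ u → u ≢ r → ¬ r ∼ u → 0# < x r → ∃[ j ] j ≢ r × j ≢ v₂ × j ≢ v₃ × j ≢ v₄ →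
        (u ≡ v₂ ⊎ u ≡ v₃ ⊎ u ≡ v₄) ⊎ (u ≢ v₂ × u ≢ v₃ × u ≢ v₄) → ⊥
      finish r v₂ v₃ v₄ ≤x₁ ≤x₂ ≤x₃ ≤x₄ v₂≢r v₃≢r v₃≢v₂ v₄≢r v₄≢v₂ v₄≢v₃ S u u≢r r≁u 0<h _ (inj₂ (u≢v₂ , u≢v₃ , u≢v₄)) =
        ¬extremal (Ordered.far-case r v₂ v₃ v₄ u
          (five-injective v₂≢r v₃≢r v₄≢r u≢r v₃≢v₂ v₄≢v₂ u≢v₂ v₄≢v₃ u≢v₃ u≢v₄)
          ≤x₁ ≤x₂ ≤x₃ ≤x₄ S r≁u star 0<h)
      finish r v₂ v₃ v₄ ≤x₁ ≤x₂ ≤x₃ ≤x₄ v₂≢r v₃≢r v₃≢v₂ v₄≢r v₄≢v₂ v₄≢v₃ S u u≢r r≁u 0<h v (inj₁ which) =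
        argmax x {λ j → j ≢ r × j ≢ v₂ × j ≢ v₃ × j ≢ v₄}
          (λ j → ¬? (j ≟ r) ×-dec (¬? (j ≟ v₂) ×-dec (¬? (j ≟ v₃) ×-dec ¬? (j ≟ v₄)))) v
          λ (v₅ , (v₅≢r , v₅≢v₂ , v₅≢v₃ , v₅≢v₄) , ≤x₅) → Ordered.near-case r v₂ v₃ v₄ v₅
            (five-injective v₂≢r v₃≢r v₄≢r v₅≢r v₃≢v₂ v₄≢v₂ v₅≢v₂ v₄≢v₃ v₅≢v₃ v₅≢v₄)
            ≤x₁ ≤x₂ ≤x₃ ≤x₄ (λ j a b c d → ≤x₅ j (a , b , c , d)) S u which r≁u star 0<h

-- Power hypergraphs

open Inverse using (to; from; strictlyInverseˡ; strictlyInverseʳ)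
open Equivalence using () renaming (to to to⇔; from to from⇔)

Incident : ∀ {n s} → Graph n s → ∀ {q} → Fin n ⊎ Fin s × Fin q → Fin s → Set
Incident Γ (inj₁ v)       e = v ≡ Graph.end₁ Γ e ⊎ v ≡ Graph.end₂ Γ e
Incident Γ (inj₂ (f , _)) e = f ≡ e

-- H is the power hypergraph of Γ in which every edge receives q new vertices, up to renaming.
record Presentation (q : ℕ) {n s} (Γ : Graph n s) (H : Hypergraph) : Set where
  field
    vertices  : (Fin n ⊎ Fin s × Fin q) ↔ Fin (order H)
    edges     : Fin s ↔ Fin (size H)
    incidence : ∀ x e → Incident Γ x e ⇔ (to vertices x ∈ edge H (to edges e))

to-injective : ∀ {A B : Set} (f : A ↔ B) {x y} → to f x ≡ to f y → x ≡ y
to-injective f {x} {y} eq = ≡.trans (≡.sym (strictlyInverseʳ f x)) (≡.trans (≡.cong (from f) eq) (strictlyInverseʳ f y))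

infixr 9 _⨾_

_⨾_ : ∀ {A B C : Set} → A ↔ B → B ↔ C → A ↔ C
f ⨾ g = mk↔ₛ′ (to g ∘ to f) (from f ∘ from g)
  (λ z → ≡.trans (≡.cong (to g) (strictlyInverseˡ f (from g z))) (strictlyInverseˡ g z))
  (λ x → ≡.trans (≡.cong (from f) (strictlyInverseʳ g (to f x))) (strictlyInverseʳ f x))

inverse : ∀ {A B : Set} → A ↔ B → B ↔ A
inverse f = mk↔ₛ′ (from f) (to f) (strictlyInverseʳ f) (strictlyInverseˡ f)

≅-sym : ∀ {H K} → H ≅ K → K ≅ H
≅-sym {H} {K} iso = record
  { onVertices = inverse onVertices
  ; onEdges    = inverse onEdges
  ; incidence  = λ v e → mk⇔
      (λ v∈e → from⇔ (incidence (from onVertices v) (from onEdges e))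
        (≡.subst₂ (λ v e → v ∈ edge K e) (≡.sym (strictlyInverseˡ onVertices v)) (≡.sym (strictlyInverseˡ onEdges e)) v∈e))
      (λ v∈e → ≡.subst₂ (λ v e → v ∈ edge K e) (strictlyInverseˡ onVertices v) (strictlyInverseˡ onEdges e)
        (to⇔ (incidence (from onVertices v) (from onEdges e)) v∈e))
  }
  where open _≅_ iso

presentation-≅ : ∀ {q n s} {Γ : Graph n s} {H K} → H ≅ K → Presentation q Γ H → Presentation q Γ K
presentation-≅ iso P = record
  { vertices  = P.vertices ⨾ _≅_.onVertices iso
  ; edges     = P.edges ⨾ _≅_.onEdges iso
  ; incidence = λ x e → mk⇔
      (to⇔ (_≅_.incidence iso (to P.vertices x) (to P.edges e)) ∘ to⇔ (P.incidence x e))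
      (from⇔ (P.incidence x e) ∘ from⇔ (_≅_.incidence iso (to P.vertices x) (to P.edges e)))
  }
  where module P = Presentation P

presentations-≅ : ∀ {q n s} {Γ : Graph n s} {H K} → Presentation q Γ H → Presentation q Γ K → H ≅ K
presentations-≅ {H = H} {K} P P′ = record
  { onVertices = inverse P.vertices ⨾ P′.vertices
  ; onEdges    = inverse P.edges ⨾ P′.edges
  ; incidence  = λ v e → mk⇔
      (λ v∈e → to⇔ (P′.incidence (from P.vertices v) (from P.edges e)) (from⇔ (P.incidence (from P.vertices v) (from P.edges e))
        (≡.subst₂ (λ v e → v ∈ edge H e) (≡.sym (strictlyInverseˡ P.vertices v)) (≡.sym (strictlyInverseˡ P.edges e)) v∈e)))
      (λ v∈e → ≡.subst₂ (λ v e → v ∈ edge H e) (strictlyInverseˡ P.vertices v) (strictlyInverseˡ P.edges e)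
        (to⇔ (P.incidence (from P.vertices v) (from P.edges e)) (from⇔ (P′.incidence (from P.vertices v) (from P.edges e)) v∈e)))
  }
  where
  module P  = Presentation P
  module P′ = Presentation P′

Represents : (G : Hypergraph) → Graph (order G) (size G) → Set
Represents G Γ = ∀ v e → v ∈ edge G e ⇔ (v ≡ Graph.end₁ Γ e ⊎ v ≡ Graph.end₂ Γ e)

∈-++ˡ : ∀ {m n} (p : Subset m) (r : Subset n) i → i ∈ p ⇔ (i ↑ˡ n) ∈ (p ++ r)
∈-++ˡ {n = n} p r i = mk⇔
  (λ i∈p → lookup⇒[]= (i ↑ˡ n) (p ++ r) (≡.trans (lookup-++ˡ p r i) ([]=⇒lookup i∈p)))
  (λ i∈pr → lookup⇒[]= i p (≡.trans (≡.sym (lookup-++ˡ p r i)) ([]=⇒lookup i∈pr)))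

∈-++ʳ : ∀ {m n} (p : Subset m) (r : Subset n) i → i ∈ r ⇔ (m ↑ʳ i) ∈ (p ++ r)
∈-++ʳ {m = m} p r i = mk⇔
  (λ i∈r → lookup⇒[]= (m ↑ʳ i) (p ++ r) (≡.trans (lookup-++ʳ p r i) ([]=⇒lookup i∈r)))
  (λ i∈pr → lookup⇒[]= i r (≡.trans (≡.sym (lookup-++ʳ p r i)) ([]=⇒lookup i∈pr)))

∈-tabulate : ∀ {n} {P : Fin n → Set} (P? : ∀ i → Dec (P i)) i → P i ⇔ i ∈ tabulate (λ j → does (P? j))
∈-tabulate P? i = mk⇔
  (λ p → lookup⇒[]= i _ (≡.trans (lookup∘tabulate _ i) (does-true (P? i) p)))
  (λ i∈ → true-does (P? i) (≡.trans (≡.sym (lookup∘tabulate _ i)) ([]=⇒lookup i∈)))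
  where
  does-true : ∀ {P : Set} (P? : Dec P) → P → does P? ≡ true
  does-true (yes _) p = ≡.refl
  does-true (no ¬p) p = contradiction p ¬p
  true-does : ∀ {P : Set} (P? : Dec P) → does P? ≡ true → P
  true-does (yes p) eq = p

sum↔ : ∀ {A B : Set} {m n} → A ↔ Fin m → B ↔ Fin n → (A ⊎ B) ↔ Fin (m ℕ.+ n)
sum↔ {A} {B} {m} {n} f g = mk↔ₛ′ to′ from′ to-from from-to
  where
  to′ : A ⊎ B → Fin (m ℕ.+ n)
  to′ = [ (λ a → to f a ↑ˡ n) , (λ b → m ↑ʳ to g b) ]′
  split : Fin m ⊎ Fin n → A ⊎ B
  split = [ inj₁ ∘ from f , inj₂ ∘ from g ]′
  from′ : Fin (m ℕ.+ n) → A ⊎ B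
  from′ = split ∘ splitAt m
  to-split : ∀ u → to′ (split u) ≡ join m n u
  to-split (inj₁ i) = ≡.cong (_↑ˡ n) (strictlyInverseˡ f i)
  to-split (inj₂ j) = ≡.cong (m ↑ʳ_) (strictlyInverseˡ g j)
  to-from : ∀ k → to′ (from′ k) ≡ k
  to-from k = ≡.trans (to-split (splitAt m k)) (Fin.join-splitAt m n k)
  from-to : ∀ x → from′ (to′ x) ≡ x
  from-to (inj₁ a) = ≡.trans (≡.cong split (Fin.splitAt-↑ˡ m (to f a) n)) (≡.cong inj₁ (strictlyInverseʳ f a))
  from-to (inj₂ b) = ≡.trans (≡.cong split (Fin.splitAt-↑ʳ m n (to g b))) (≡.cong inj₂ (strictlyInverseʳ g b))

identity↔ : ∀ {A : Set} → A ↔ A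
identity↔ = mk↔ₛ′ id id (λ _ → ≡.refl) (λ _ → ≡.refl)

product↔ : ∀ {m n} → (Fin m × Fin n) ↔ Fin (m ℕ.* n)
product↔ {m} {n} = mk↔ₛ′ (λ (i , j) → combine i j) (remQuot n) (Fin.combine-remQuot {m} n) (λ (i , j) → Fin.remQuot-combine i j)

power-presentation : ∀ {q} G Γ → Represents G Γ → Presentation q Γ (power (suc (suc q)) G)
power-presentation {q} G Γ represents = record
  { vertices  = sum↔ identity↔ product↔
  ; edges     = identity↔
  ; incidence = λ where
      (inj₁ v) e → mk⇔
        (to⇔ (∈-++ˡ (edge G e) (new e) v) ∘ from⇔ (represents v e))
        (to⇔ (represents v e) ∘ from⇔ (∈-++ˡ (edge G e) (new e) v))
      (inj₂ (f , l)) e → mk⇔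
        (λ f≡e → to⇔ (∈-++ʳ (edge G e) (new e) (combine f l)) (to⇔ (∈new e (combine f l)) (≡.trans (quotient-combine f l) f≡e)))
        (λ ∈e → ≡.trans (≡.sym (quotient-combine f l)) (from⇔ (∈new e (combine f l)) (from⇔ (∈-++ʳ (edge G e) (new e) (combine f l)) ∈e)))
  }
  where
  new : Fin (size G) → Subset (size G ℕ.* q)
  new e = tabulate λ j → does (quotient q j ≟ e)
  ∈new : ∀ e j → quotient q j ≡ e ⇔ j ∈ new e
  ∈new e = ∈-tabulate (λ j → quotient q j ≟ e)
  quotient-combine : ∀ (f : Fin (size G)) (l : Fin q) → quotient q (combine f l) ≡ f
  quotient-combine f l = ≡.cong proj₁ (Fin.remQuot-combine f l)

∣p∣≡0⇒∉ : ∀ {n} (p : Subset n) → ∣ p ∣ ≡ 0 → ∀ {v} → ¬ v ∈ p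
∣p∣≡0⇒∉ (false ∷ p) eq (there v∈p) = ∣p∣≡0⇒∉ p eq v∈p

∣p∣≡1⇒ : ∀ {n} (p : Subset n) → ∣ p ∣ ≡ 1 → ∃[ a ] ∀ v → v ∈ p ⇔ v ≡ a
∣p∣≡1⇒ (true ∷ p) eq = zero , λ where
  zero    → mk⇔ (λ _ → ≡.refl) (λ _ → here)
  (suc v) → mk⇔ (λ { (there v∈p) → contradiction v∈p (∣p∣≡0⇒∉ p (ℕ.suc-injective eq)) }) λ ()
∣p∣≡1⇒ (false ∷ p) eq with ∣p∣≡1⇒ p eq
... | a , h = suc a , λ where
  zero    → mk⇔ (λ ()) (λ ())
  (suc v) → mk⇔ (λ { (there v∈p) → ≡.cong suc (to⇔ (h v) v∈p) }) (λ { ≡.refl → there (from⇔ (h v) ≡.refl) })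

∣p∣≡2⇒ : ∀ {n} (p : Subset n) → ∣ p ∣ ≡ 2 → ∃[ a ] ∃[ b ] a ≢ b × ∀ v → v ∈ p ⇔ (v ≡ a ⊎ v ≡ b)
∣p∣≡2⇒ (true ∷ p) eq with ∣p∣≡1⇒ p (ℕ.suc-injective eq)
... | a , h = zero , suc a , (λ ()) , λ where
  zero    → mk⇔ (λ _ → inj₁ ≡.refl) (λ _ → here)
  (suc v) → mk⇔ (λ { (there v∈p) → inj₂ (≡.cong suc (to⇔ (h v) v∈p)) }) (λ { (inj₂ ≡.refl) → there (from⇔ (h v) ≡.refl) })
∣p∣≡2⇒ (false ∷ p) eq with ∣p∣≡2⇒ p eq
... | a , b , a≢b , h = suc a , suc b , a≢b ∘ Fin.suc-injective , λ where
  zero    → mk⇔ (λ ()) (λ { (inj₁ ()) ; (inj₂ ()) })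
  (suc v) → mk⇔ (λ { (there v∈p) → Sum.map (≡.cong suc) (≡.cong suc) (to⇔ (h v) v∈p) })
      (λ { (inj₁ ≡.refl) → there (from⇔ (h v) (inj₁ ≡.refl)) ; (inj₂ ≡.refl) → there (from⇔ (h v) (inj₂ ≡.refl)) })

uniform-graph : ∀ G → Uniform 2 G → Σ (Graph (order G) (size G)) (Represents G)
uniform-graph G uniform = Γ , λ v e → proj₂ (proj₂ (proj₂ (ends e))) v
  where
  ends : ∀ e → ∃[ a ] ∃[ b ] a ≢ b × ∀ v → v ∈ edge G e ⇔ (v ≡ a ⊎ v ≡ b)
  ends e = ∣p∣≡2⇒ (edge G e) (uniform e)
  e₁ e₂ : Fin (size G) → Fin (order G)
  e₁ e = proj₁ (ends e)
  e₂ e = proj₁ (proj₂ (ends e))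
  JoinedBy : Fin (size G) → Fin (order G) → Fin (order G) → Set
  JoinedBy e a b = (e₁ e ≡ a × e₂ e ≡ b) ⊎ (e₁ e ≡ b × e₂ e ≡ a)
  members : ∀ e {a b} → JoinedBy e a b → ∀ v → v ∈ edge G e ⇔ (v ≡ a ⊎ v ≡ b)
  members e (inj₁ (≡.refl , ≡.refl)) v = proj₂ (proj₂ (proj₂ (ends e))) v
  members e (inj₂ (≡.refl , ≡.refl)) v = mk⇔ (Sum.swap ∘ to⇔ h) (from⇔ h ∘ Sum.swap)
    where
    h = proj₂ (proj₂ (proj₂ (ends e))) v
  Γ : Graph (order G) (size G)
  Γ = record
    { end₁   = e₁
    ; end₂   = e₂
    ; proper = λ e → proj₁ (proj₂ (proj₂ (ends e)))
    ; simple = λ {e} {f} je jf → distinct G (⊆-antisym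
        (λ {v} v∈e → from⇔ (members f jf v) (to⇔ (members e je v) v∈e))
        (λ {v} v∈f → from⇔ (members e je v) (to⇔ (members f jf v) v∈f)))
    }

attach : ∀ {n s} → Graph n s → Fin n → Graph (suc n) (suc s)
attach {n} {s} Γ a = record { end₁ = end₁′ ; end₂ = end₂′ ; proper = proper′ ; simple = λ {e} {f} → simple′ e f }
  where
  open Graph Γ
  end₁′ end₂′ : Fin (suc s) → Fin (suc n)
  end₁′ = cons zero (suc ∘ end₁)
  end₂′ = cons (suc a) (suc ∘ end₂)
  proper′ : ∀ e → end₁′ e ≢ end₂′ e
  proper′ zero    ()
  proper′ (suc e) eq = proper e (Fin.suc-injective eq)
  JoinedBy : Fin (suc s) → Fin (suc n) → Fin (suc n) → Set
  JoinedBy e x y = (end₁′ e ≡ x × end₂′ e ≡ y) ⊎ (end₁′ e ≡ y × end₂′ e ≡ x)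
  simple′ : ∀ e f {x y} → JoinedBy e x y → JoinedBy f x y → e ≡ f
  simple′ zero    zero    _ _ = ≡.refl
  simple′ zero    (suc f) (inj₁ (≡.refl , _)) (inj₁ (() , _))
  simple′ zero    (suc f) (inj₁ (≡.refl , _)) (inj₂ (_ , ()))
  simple′ zero    (suc f) (inj₂ (≡.refl , _)) (inj₁ (_ , ()))
  simple′ zero    (suc f) (inj₂ (≡.refl , _)) (inj₂ (() , _))
  simple′ (suc e) zero    (inj₁ (() , _))     (inj₁ (≡.refl , _))
  simple′ (suc e) zero    (inj₂ (_ , ()))     (inj₁ (≡.refl , _))
  simple′ (suc e) zero    (inj₁ (_ , ()))     (inj₂ (≡.refl , _))
  simple′ (suc e) zero    (inj₂ (() , _))     (inj₂ (≡.refl , _))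
  simple′ (suc e) (suc f) (inj₁ (≡.refl , ≡.refl)) (inj₁ (p , r)) =
    ≡.cong suc (simple (joins-self e) (inj₁ (Fin.suc-injective p , Fin.suc-injective r)))
  simple′ (suc e) (suc f) (inj₁ (≡.refl , ≡.refl)) (inj₂ (p , r)) =
    ≡.cong suc (simple (joins-self e) (inj₂ (Fin.suc-injective p , Fin.suc-injective r)))
  simple′ (suc e) (suc f) (inj₂ (≡.refl , ≡.refl)) (inj₁ (p , r)) =
    ≡.cong suc (simple (joins-self e) (inj₂ (Fin.suc-injective p , Fin.suc-injective r)))
  simple′ (suc e) (suc f) (inj₂ (≡.refl , ≡.refl)) (inj₂ (p , r)) =
    ≡.cong suc (simple (joins-self e) (inj₁ (Fin.suc-injective p , Fin.suc-injective r)))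

-- The vertices of the new edge are its new end zero and the q vertices that subdivide it.
attach-vertices : ∀ {n s q} → (Fin (suc n) ⊎ Fin (suc s) × Fin q) ↔ ((Fin n ⊎ Fin s × Fin q) ⊎ Fin (suc q))
attach-vertices = mk↔ₛ′
  (λ { (inj₁ zero) → inj₂ zero ; (inj₁ (suc v)) → inj₁ (inj₁ v) ; (inj₂ (zero , l)) → inj₂ (suc l) ; (inj₂ (suc e , l)) → inj₁ (inj₂ (e , l)) })
  (λ { (inj₂ zero) → inj₁ zero ; (inj₁ (inj₁ v)) → inj₁ (suc v) ; (inj₂ (suc l)) → inj₂ (zero , l) ; (inj₁ (inj₂ (e , l))) → inj₂ (suc e , l) })
  (λ { (inj₂ zero) → ≡.refl ; (inj₁ (inj₁ v)) → ≡.refl ; (inj₂ (suc l)) → ≡.refl ; (inj₁ (inj₂ (e , l))) → ≡.refl })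
  (λ { (inj₁ zero) → ≡.refl ; (inj₁ (suc v)) → ≡.refl ; (inj₂ (zero , l)) → ≡.refl ; (inj₂ (suc e , l)) → ≡.refl })

suc↔ : ∀ {m n} → Fin m ↔ Fin n → Fin (suc m) ↔ Fin (suc n)
suc↔ f = mk↔ₛ′ (cons zero (suc ∘ to f)) (cons zero (suc ∘ from f))
  (λ { zero → ≡.refl ; (suc i) → ≡.cong suc (strictlyInverseˡ f i) })
  (λ { zero → ≡.refl ; (suc i) → ≡.cong suc (strictlyInverseʳ f i) })

attach-presentation : ∀ {q n s} {Γ : Graph n s} {H} (P : Presentation q Γ H) a →
  Presentation q (attach Γ a) (attachPendant (suc (suc q)) H (to (Presentation.vertices P) (inj₁ a)))
attach-presentation {q} {n} {s} {Γ} {H} P a = record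
  { vertices  = verts
  ; edges     = edges′
  ; incidence = inc
  }
  where
  open Presentation P
  hub : Fin (order H)
  hub = to vertices (inj₁ a)
  K : Hypergraph
  K = attachPendant (suc (suc q)) H hub
  edges′ : Fin (suc s) ↔ Fin (suc (size H))
  edges′ = suc↔ edges
  verts : (Fin (suc n) ⊎ Fin (suc s) × Fin q) ↔ Fin (order H ℕ.+ suc q)
  verts = attach-vertices ⨾ sum↔ vertices identity↔
  suc-incident : ∀ x e → Incident Γ {q} x e ⇔ Incident (attach Γ a) (from attach-vertices (inj₁ x)) (suc e)
  suc-incident (inj₁ v) e = mk⇔ (Sum.map (≡.cong suc) (≡.cong suc)) (Sum.map Fin.suc-injective Fin.suc-injective)
  suc-incident (inj₂ (f , l)) e = mk⇔ (≡.cong suc) Fin.suc-injective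
  inc-old : ∀ x e → Incident (attach Γ a) (from attach-vertices (inj₁ x)) (suc e) ⇔ ((to vertices x ↑ˡ suc q) ∈ (edge H (to edges e) ++ empty))
  inc-old x e = mk⇔
    (to⇔ (∈-++ˡ (edge H (to edges e)) empty (to vertices x)) ∘ to⇔ (incidence x e) ∘ from⇔ (suc-incident x e))
    (to⇔ (suc-incident x e) ∘ from⇔ (incidence x e) ∘ from⇔ (∈-++ˡ (edge H (to edges e)) empty (to vertices x)))
  inc-new : ∀ (l : Fin (suc q)) → (order H ↑ʳ l) ∈ (⁅ hub ⁆ ++ full)
  inc-new l = to⇔ (∈-++ʳ ⁅ hub ⁆ full l) ∈⊤
  not-new : ∀ (l : Fin (suc q)) e → ¬ (order H ↑ʳ l) ∈ (edge H e ++ empty)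
  not-new l e = ∉⊥ ∘ from⇔ (∈-++ʳ (edge H e) empty l)
  at-hub : ∀ x → to vertices x ↑ˡ suc q ∈ (⁅ hub ⁆ ++ full) → x ≡ inj₁ a
  at-hub x x∈ = to-injective vertices (x∈⁅y⁆⇒x≡y hub (from⇔ (∈-++ˡ ⁅ hub ⁆ full (to vertices x)) x∈))
  inc : ∀ x e → Incident (attach Γ a) x e ⇔ (to verts x ∈ edge K (to edges′ e))
  inc (inj₁ zero)          zero    = mk⇔ (λ _ → inc-new zero) (λ _ → inj₁ ≡.refl)
  inc (inj₁ zero)          (suc e) = mk⇔ (λ { (inj₁ ()) ; (inj₂ ()) }) (λ ∈e → contradiction ∈e (not-new zero (to edges e)))
  inc (inj₁ (suc v))       zero    = mk⇔
    (λ { (inj₁ ()) ; (inj₂ ≡.refl) → to⇔ (∈-++ˡ ⁅ hub ⁆ full hub) (x∈⁅x⁆ hub) })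
    (λ v∈ → inj₂ (case (at-hub (inj₁ v) v∈)))
    where
    case : ∀ {v} → inj₁ v ≡ inj₁ a → suc v ≡ suc a
    case ≡.refl = ≡.refl
  inc (inj₁ (suc v))       (suc e) = inc-old (inj₁ v) e
  inc (inj₂ (zero , l))    zero    = mk⇔ (λ _ → inc-new (suc l)) (λ _ → ≡.refl)
  inc (inj₂ (zero , l))    (suc e) = mk⇔ (λ ()) (λ ∈e → contradiction ∈e (not-new (suc l) (to edges e)))
  inc (inj₂ (suc f , l))   zero    = mk⇔ (λ ()) (λ ∈e → case (at-hub (inj₂ (f , l)) ∈e))
    where
    case : ∀ {y} {A : Set} → inj₂ y ≡ inj₁ a → A
    case ()
  inc (inj₂ (suc f , l))   (suc e) = inc-old (inj₂ (f , l)) e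

-- The recursion mirrors `attachPendants`, so `attach-all` needs no casts; the closed formula enters
-- only at the end, through `grow-replicate`.
grow : ∀ {k} → List (Fin k) → ℕ → ℕ
grow []       n = n
grow (v ∷ vs) n = grow vs (suc n)

attach-all : ∀ {n s k} → Graph n s → (Fin k → Fin n) → ∀ vs → Graph (grow vs n) (grow vs s)
attach-all Γ ι []       = Γ
attach-all Γ ι (v ∷ vs) = attach-all (attach Γ (ι v)) (suc ∘ ι) vs

attach-all-presentation : ∀ {q n s k} {Γ : Graph n s} {H} (P : Presentation q Γ H) (ι : Fin k → Fin n) (ι′ : Fin k → Fin (order H)) →
  (∀ v → to (Presentation.vertices P) (inj₁ (ι v)) ≡ ι′ v) → ∀ vs →
  Presentation q (attach-all Γ ι vs) (attachPendants (suc (suc q)) H ι′ vs)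
attach-all-presentation P ι ι′ eq [] = P
attach-all-presentation {q} {Γ = Γ} {H} P ι ι′ eq (v ∷ vs) =
  step (ι′ v) (eq v)
  where
  step : ∀ a → to (Presentation.vertices P) (inj₁ (ι v)) ≡ a →
    Presentation q (attach-all (attach Γ (ι v)) (suc ∘ ι) vs) (attachPendants (suc (suc q)) (attachPendant (suc (suc q)) H a) ((_↑ˡ suc q) ∘ ι′) vs)
  step a ≡.refl = attach-all-presentation (attach-presentation P (ι v)) (suc ∘ ι) ((_↑ˡ suc q) ∘ ι′) (λ u → ≡.cong (_↑ˡ suc q) (eq u)) vs

diamond-graph : Σ (Graph 4 5) (Represents diamond)
diamond-graph = uniform-graph diamond (from-yes (all? λ e → ∣ diamondEdge e ∣ ℕ.≟ 2))

Γ◇ : Graph 4 5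
Γ◇ = proj₁ diamond-graph

T₁C-vertices : ℕ → ℕ → ℕ → ℕ → List (Fin 4)
T₁C-vertices l₁ l₂ l₃ l₄ = replicate l₁ 0F ++ˡ replicate l₂ 1F ++ˡ replicate l₃ 2F ++ˡ replicate l₄ 3F

T₁C-graph : ∀ l₁ l₂ l₃ l₄ → let vs = T₁C-vertices l₁ l₂ l₃ l₄ in Graph (grow vs 4) (grow vs 5)
T₁C-graph l₁ l₂ l₃ l₄ = attach-all Γ◇ id (T₁C-vertices l₁ l₂ l₃ l₄)

T₁C-presentation : ∀ q l₁ l₂ l₃ l₄ → Presentation q (T₁C-graph l₁ l₂ l₃ l₄) (T₁C (suc (suc q)) l₁ l₂ l₃ l₄)
T₁C-presentation q l₁ l₂ l₃ l₄ = attach-all-presentation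
  (power-presentation diamond Γ◇ (proj₂ diamond-graph)) id (_↑ˡ (5 ℕ.* q)) (λ _ → ≡.refl) (T₁C-vertices l₁ l₂ l₃ l₄)

-- Recognising T₁C hypergraphs by embeddings

record Embedding {n s n′ s′} (Γ : Graph n s) (Δ : Graph n′ s′) : Set where
  field
    σ           : Fin n → Fin n′
    σ-injective : Injective _≡_ _≡_ σ
    adjacent    : ∀ e → Graph._∼_ Δ (σ (Graph.end₁ Γ e)) (σ (Graph.end₂ Γ e))

  τ : Fin s → Fin s′
  τ e = proj₁ (adjacent e)

  τ-joins : ∀ e → Graph.Joins Δ (τ e) (σ (Graph.end₁ Γ e)) (σ (Graph.end₂ Γ e))
  τ-joins e = proj₂ (adjacent e)

  τ-injective : Injective _≡_ _≡_ τ
  τ-injective {e} {f} eq = Graph.simple Γ (Graph.joins-self Γ e)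
    (case (Graph.joins-unique Δ (τ-joins e) (≡.subst (λ g → Graph.Joins Δ g (σ (Graph.end₁ Γ f)) (σ (Graph.end₂ Γ f))) (≡.sym eq) (τ-joins f))))
    where
    case : _ → Graph.Joins Γ f (Graph.end₁ Γ e) (Graph.end₂ Γ e)
    case (inj₁ (p , r)) = inj₁ (≡.sym (σ-injective p) , ≡.sym (σ-injective r))
    case (inj₂ (p , r)) = inj₂ (≡.sym (σ-injective r) , ≡.sym (σ-injective p))

-- An embedding between graphs of equal size is an isomorphism.
embedding-presentation : ∀ {q n s n′ s′} {Γ : Graph n s} {Δ : Graph n′ s′} {H} → Embedding Γ Δ → n ≡ n′ → s ≡ s′ →
  Presentation q Δ H → Presentation q Γ H
embedding-presentation {q} {Γ = Γ} {Δ} {H} E ≡.refl ≡.refl P = record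
  { vertices  = relabel ⨾ P.vertices
  ; edges     = τ↔ ⨾ P.edges
  ; incidence = λ x e → mk⇔ (to⇔ (P.incidence (to relabel x) (τ e)) ∘ to⇔ (relabel-incident x e))
                            (from⇔ (relabel-incident x e) ∘ from⇔ (P.incidence (to relabel x) (τ e)))
  }
  where
  open Embedding E
  module P = Presentation P
  σ↔ = injective⇒permutation σ σ-injective
  τ↔ = injective⇒permutation τ τ-injective
  relabel : (Fin _ ⊎ Fin _ × Fin q) ↔ (Fin _ ⊎ Fin _ × Fin q)
  relabel = mk↔ₛ′ (Sum.map σ (λ (e , l) → τ e , l)) (Sum.map (from σ↔) (λ (e , l) → from τ↔ e , l))
    (λ { (inj₁ v) → ≡.cong inj₁ (strictlyInverseˡ σ↔ v) ; (inj₂ (e , l)) → ≡.cong (λ e → inj₂ (e , l)) (strictlyInverseˡ τ↔ e) })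
    (λ { (inj₁ v) → ≡.cong inj₁ (strictlyInverseʳ σ↔ v) ; (inj₂ (e , l)) → ≡.cong (λ e → inj₂ (e , l)) (strictlyInverseʳ τ↔ e) })
  ends : ∀ e → Graph.Joins Δ (τ e) (σ (Graph.end₁ Γ e)) (σ (Graph.end₂ Γ e)) → ∀ v →
    (v ≡ Graph.end₁ Γ e ⊎ v ≡ Graph.end₂ Γ e) ⇔ (σ v ≡ Graph.end₁ Δ (τ e) ⊎ σ v ≡ Graph.end₂ Δ (τ e))
  ends e (inj₁ (p , r)) v = mk⇔
    (Sum.map (λ { ≡.refl → ≡.sym p }) (λ { ≡.refl → ≡.sym r }))
    (Sum.map (λ eq → σ-injective (≡.trans eq p)) (λ eq → σ-injective (≡.trans eq r)))
  ends e (inj₂ (p , r)) v = mk⇔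
    (Sum.swap ∘ Sum.map (λ { ≡.refl → ≡.sym r }) (λ { ≡.refl → ≡.sym p }))
    (Sum.swap ∘ Sum.map (λ eq → σ-injective (≡.trans eq p)) (λ eq → σ-injective (≡.trans eq r)))
  relabel-incident : ∀ x e → Incident Γ {q} x e ⇔ Incident Δ (to relabel x) (τ e)
  relabel-incident (inj₁ v)       e = ends e (τ-joins e) v
  relabel-incident (inj₂ (f , l)) e = mk⇔ (≡.cong τ) τ-injective

attach-embedding : ∀ {n s n′ s′} {Γ : Graph n s} {Δ : Graph n′ s′} (E : Embedding Γ Δ) a y →
  (∀ v → Embedding.σ E v ≢ y) → Graph._∼_ Δ y (Embedding.σ E a) → Embedding (attach Γ a) Δ
attach-embedding E a y y∉σ y∼a = record
  { σ           = cons y σ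
  ; σ-injective = cons-injective y∉σ σ-injective
  ; adjacent    = λ { zero → y∼a ; (suc e) → adjacent e }
  }
  where open Embedding E

-- Choices of images for the pendant vertices, in the order of attachment. `Used` grows with each
-- choice, which keeps the embedding injective.
Leaves : ∀ {n s k} → Graph n s → (Fin k → Fin n) → (Fin n → Set) → List (Fin k) → Set
Leaves {n} Δ f Used []       = ⊤
Leaves {n} Δ f Used (v ∷ vs) = Σ (Fin n) λ y → ¬ Used y × Graph._∼_ Δ y (f v) × Leaves Δ f (λ z → Used z ⊎ z ≡ y) vs

attach-all-embedding : ∀ {n s n′ s′ k} {Γ : Graph n s} {Δ : Graph n′ s′} (E : Embedding Γ Δ) (ι : Fin k → Fin n) {Used} →
  (∀ v → Used (Embedding.σ E v)) → ∀ vs → Leaves Δ (Embedding.σ E ∘ ι) Used vs → Embedding (attach-all Γ ι vs) Δ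
attach-all-embedding E ι used [] _ = E
attach-all-embedding E ι {Used} used (v ∷ vs) (y , y∉ , y∼ , leaves) =
  attach-all-embedding (attach-embedding E (ι v) y (λ u eq → y∉ (≡.subst Used eq (used u))) y∼) (suc ∘ ι)
    (λ { zero → inj₂ ≡.refl ; (suc u) → inj₁ (used u) }) vs leaves

-- The continuation `last` is given only an inclusion for the used vertices, so the nested predicate
-- built up by the recursion never has to be described.
replicate-leaves : ∀ {n s k} (Δ : Graph n s) (f : Fin k → Fin n) v ℓ ws (Used : Fin n → Set) (rest : Fin ℓ → Fin n) →
  Injective _≡_ _≡_ rest → (∀ i → ¬ Used (rest i)) → (∀ i → Graph._∼_ Δ (rest i) (f v)) →
  (∀ Used′ → (∀ z → Used′ z → Used z ⊎ ∃[ i ] rest i ≡ z) → Leaves Δ f Used′ ws) →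
  Leaves Δ f Used (replicate ℓ v ++ˡ ws)
replicate-leaves Δ f v zero ws Used rest rest-inj unused adj last = last Used (λ z → inj₁)
replicate-leaves Δ f v (suc ℓ) ws Used rest rest-inj unused adj last =
  rest zero , unused zero , adj zero ,
  replicate-leaves Δ f v ℓ ws _ (rest ∘ suc) (Fin.suc-injective ∘ rest-inj)
    (λ { i (inj₁ used) → unused (suc i) used ; i (inj₂ eq) → contradiction (rest-inj eq) λ () }) (adj ∘ suc)
    λ Used′ Used′⊆ → last Used′ λ z used → case (Used′⊆ z used)
  where
  case : ∀ {z} → (Used z ⊎ z ≡ rest zero) ⊎ ∃[ i ] rest (suc i) ≡ z → Used z ⊎ ∃[ i ] rest i ≡ z
  case (inj₁ (inj₁ used)) = inj₁ used
  case (inj₁ (inj₂ eq))   = inj₂ (zero , ≡.sym eq)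
  case (inj₂ (i , eq))    = inj₂ (suc i , eq)

grow-replicate : ∀ {k} ℓ (v : Fin k) ws n → grow (replicate ℓ v ++ˡ ws) n ≡ grow ws (ℓ ℕ.+ n)
grow-replicate zero    v ws n = ≡.refl
grow-replicate (suc ℓ) v ws n = ≡.trans (grow-replicate ℓ v ws (suc n)) (≡.cong (grow ws) (ℕ.+-suc ℓ n))

module _ {q n} {Γ : Graph n (suc n)} {H} (P : Presentation q Γ H) where

  open Graph Γ

  private
    diamond-embedding : ∀ {h a c b} → Injective _≡_ _≡_ (four h a c b) → h ∼ a → h ∼ c → h ∼ b → c ∼ a → c ∼ b → Embedding Γ◇ Γ
    diamond-embedding {h} {a} {c} {b} inj h∼a h∼c h∼b c∼a c∼b = record
      { σ           = four h a c b
      ; σ-injective = inj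
      ; adjacent    = λ { 0F → h∼a ; 1F → ∼-sym c∼a ; 2F → h∼c ; 3F → c∼b ; 4F → h∼b }
      }

  -- An embedding suffices: the shape names n - 2 edges at h and 3 more at c, which are already all
  -- n + 1 edges, so counting makes it bijective on vertices and on edges.
  extremal-≅ : Extremal Γ → H ≅ T₁C (suc (suc q)) (suc n ∸ 6) 0 1 0
  extremal-≅ (h , c , a , b , u , distinct , spokes , c∼a , c∼b , c∼u) = presentations-≅
    (embedding-presentation embedding
      (≡.trans (grow-replicate (n ∸ 5) 0F (2F ∷ []) 4) (≡.trans (≡.sym (ℕ.+-suc (n ∸ 5) 4)) (ℕ.m∸n+n≡m 5≤n)))
      (≡.trans (grow-replicate (n ∸ 5) 0F (2F ∷ []) 5) (≡.cong suc (ℕ.m∸n+n≡m 5≤n))) P)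
    (T₁C-presentation q (suc n ∸ 6) 0 1 0)
    where
    5≤n : 5 ℕ.≤ n
    5≤n = injective⇒≤ distinct
    open Complement (complement (n ∸ 5) (five h c a b u) distinct (ℕ.m+[n∸m]≡n 5≤n))
    -- The diamond's v₁, v₂, v₃, v₄ are h, a, c, b, while the shape lists c before a.
    label : Fin 4 → Fin 5
    label = four 0F 2F 1F 3F
    label-injective : ∀ i j → label i ≡ label j → i ≡ j
    label-injective = from-yes (all? λ i → all? λ j → (label i ≟ label j) →-dec (i ≟ j))
    four≡ : ∀ i → four h a c b i ≡ five h c a b u (label i)
    four≡ 0F = ≡.refl
    four≡ 1F = ≡.refl
    four≡ 2F = ≡.refl
    four≡ 3F = ≡.refl
    ≢u : ∀ i → four h a c b i ≢ u
    ≢u i eq = contradiction (distinct {label i} {4F} (≡.trans (≡.sym (four≡ i)) eq)) (label≢4 i)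
      where
      label≢4 : ∀ i → label i ≢ 4F
      label≢4 = from-yes (all? λ i → ¬? (label i ≟ 4F))
    h∼_ : ∀ i → i ≢ 0F → i ≢ 4F → h ∼ five h c a b u i
    (h∼ i) i≢0 i≢4 = spokes _ (i≢0 ∘ distinct {i} {0F}) (i≢4 ∘ distinct {i} {4F})
    core : Embedding Γ◇ Γ
    core = diamond-embedding (λ {i} {j} eq → label-injective i j (distinct (≡.trans (≡.sym (four≡ i)) (≡.trans eq (four≡ j)))))
      ((h∼ 2F) (λ ()) (λ ())) ((h∼ 1F) (λ ()) (λ ())) ((h∼ 3F) (λ ()) (λ ())) c∼a c∼b
    Used : Fin n → Set
    Used z = ∃[ i ] four h a c b i ≡ z
    embedding : Embedding (T₁C-graph (suc n ∸ 6) 0 1 0) Γ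
    embedding = attach-all-embedding core id {Used} (λ i → i , ≡.refl) (T₁C-vertices (suc n ∸ 6) 0 1 0)
      (replicate-leaves Γ (four h a c b) 0F (n ∸ 5) (2F ∷ []) Used rest rest-injective
        (λ i (j , eq) → disjoint (label j) i (≡.trans (≡.sym (four≡ j)) eq))
        (λ i → ∼-sym (spokes (rest i) (disjoint 0F i ∘ ≡.sym) (disjoint 4F i ∘ ≡.sym)))
        (λ Used′ Used′⊆ → u , (λ used → unused (Used′⊆ u used)) , ∼-sym c∼u , tt))
      where
      unused : ¬ (Used u ⊎ ∃[ i ] rest i ≡ u)
      unused (inj₁ (i , eq)) = ≢u i eq
      unused (inj₂ (i , eq)) = disjoint 4F i (≡.sym eq)

  universal-≅ : ∀ {h a c b} → Injective _≡_ _≡_ (four h a c b) → (∀ j → j ≢ h → h ∼ j) → c ∼ a → c ∼ b →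
    H ≅ T₁C (suc (suc q)) (suc n ∸ 5) 0 0 0
  universal-≅ {h} {a} {c} {b} distinct spokes c∼a c∼b = presentations-≅
    (embedding-presentation embedding
      (≡.trans (grow-replicate (n ∸ 4) 0F [] 4) (ℕ.m∸n+n≡m 4≤n))
      (≡.trans (grow-replicate (n ∸ 4) 0F [] 5) (≡.trans (ℕ.+-suc (n ∸ 4) 4) (≡.cong suc (ℕ.m∸n+n≡m 4≤n)))) P)
    (T₁C-presentation q (suc n ∸ 5) 0 0 0)
    where
    4≤n : 4 ℕ.≤ n
    4≤n = injective⇒≤ distinct
    open Complement (complement (n ∸ 4) (four h a c b) distinct (ℕ.m+[n∸m]≡n 4≤n))
    h∼_ : ∀ i → i ≢ 0F → h ∼ four h a c b i
    (h∼ i) i≢0 = spokes _ (i≢0 ∘ distinct {i} {0F})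
    embedding : Embedding (T₁C-graph (suc n ∸ 5) 0 0 0) Γ
    embedding = attach-all-embedding
      (diamond-embedding distinct ((h∼ 1F) λ ()) ((h∼ 2F) λ ()) ((h∼ 3F) λ ()) c∼a c∼b) id
      {λ z → ∃[ i ] four h a c b i ≡ z} (λ i → i , ≡.refl) (T₁C-vertices (suc n ∸ 5) 0 0 0)
      (replicate-leaves Γ (four h a c b) 0F (n ∸ 4) [] _ rest rest-injective
        (λ i (j , eq) → disjoint j i eq) (λ i → ∼-sym (spokes (rest i) (disjoint 0F i ∘ ≡.sym))) (λ _ _ → tt))

-- Loose cycles


toℕ-cyclicSuc : ∀ {l} (i : Fin l) →
  (suc (toℕ i) ℕ.< l × toℕ (cyclicSuc i) ≡ suc (toℕ i)) ⊎ (suc (toℕ i) ≡ l × toℕ (cyclicSuc i) ≡ 0)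
toℕ-cyclicSuc {suc l} i with ℕ.m≤n⇒m<n∨m≡n (Fin.toℕ<n i)
... | inj₁ i+1<l = inj₁ (i+1<l , ≡.trans (Fin.toℕ-fromℕ< (m%n<n (suc (toℕ i)) (suc l))) (m<n⇒m%n≡m i+1<l))
... | inj₂ i+1≡l = inj₂ (i+1≡l , ≡.trans (Fin.toℕ-fromℕ< (m%n<n (suc (toℕ i)) (suc l)))
  (≡.trans (≡.cong (_% suc l) i+1≡l) (n%n≡0 (suc l))))

cyclicSuc-injective : ∀ {l} {i j : Fin l} → cyclicSuc i ≡ cyclicSuc j → i ≡ j
cyclicSuc-injective {i = i} {j} eq with toℕ-cyclicSuc i | toℕ-cyclicSuc j
... | inj₁ (_ , p) | inj₁ (_ , r) = Fin.toℕ-injective (ℕ.suc-injective (≡.trans (≡.sym p) (≡.trans (≡.cong toℕ eq) r)))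
... | inj₁ (_ , p) | inj₂ (_ , r) = contradiction (≡.trans (≡.sym p) (≡.trans (≡.cong toℕ eq) r)) λ ()
... | inj₂ (_ , p) | inj₁ (_ , r) = contradiction (≡.trans (≡.sym r) (≡.trans (≡.cong toℕ (≡.sym eq)) p)) λ ()
... | inj₂ (p , _) | inj₂ (r , _) = Fin.toℕ-injective (ℕ.suc-injective (≡.trans p (≡.sym r)))

cyclicSuc≢ : ∀ {l} → 3 ℕ.≤ l → (i : Fin l) → cyclicSuc i ≢ i
cyclicSuc≢ 3≤l i eq with toℕ-cyclicSuc i
... | inj₁ (_ , p)   = ℕ.1+n≢n (≡.trans (≡.sym p) (≡.cong toℕ eq))
... | inj₂ (i+1≡l , p) = contradiction
  (≡.subst (3 ℕ.≤_) (≡.trans (≡.sym i+1≡l) (≡.cong suc (≡.trans (≡.cong toℕ (≡.sym eq)) p))) 3≤l) λ { (ℕ.s≤s ()) }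

cyclicSuc²≢ : ∀ {l} → 3 ℕ.≤ l → (i : Fin l) → cyclicSuc (cyclicSuc i) ≢ i
cyclicSuc²≢ 3≤l i eq with toℕ-cyclicSuc i | toℕ-cyclicSuc (cyclicSuc i)
... | inj₁ (_ , p) | inj₁ (_ , r) = ℕ.m+1+n≢n 1 (≡.trans (≡.cong suc (≡.sym p)) (≡.trans (≡.sym r) (≡.cong toℕ eq)))
... | inj₁ (_ , p) | inj₂ (l≡ , r) = contradiction
  (≡.subst (3 ℕ.≤_) (≡.trans (≡.sym l≡) (≡.cong suc (≡.trans p (≡.cong suc (≡.trans (≡.cong toℕ (≡.sym eq)) r))))) 3≤l) λ { (ℕ.s≤s (ℕ.s≤s ())) }
... | inj₂ (l≡ , p) | inj₁ (_ , r) = contradiction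
  (≡.subst (3 ℕ.≤_) (≡.trans (≡.sym l≡) (≡.cong suc (≡.trans (≡.cong toℕ (≡.sym eq)) (≡.trans r (≡.cong suc p))))) 3≤l) λ { (ℕ.s≤s (ℕ.s≤s ())) }
... | inj₂ (_ , p) | inj₂ (l≡ , r) = contradiction
  (≡.subst (3 ℕ.≤_) (≡.trans (≡.sym l≡) (≡.cong suc p)) 3≤l) λ { (ℕ.s≤s ()) }

-- A loose cycle in a power hypergraph passes only through vertices of the underlying graph.
record GraphCycle {n s} (Γ : Graph n s) (l : ℕ) : Set where
  field
    length≥3       : 3 ℕ.≤ l
    E              : Fin l → Fin s
    W              : Fin l → Fin n
    E-injective    : Injective _≡_ _≡_ E
    W-injective    : Injective _≡_ _≡_ W
    onEdge         : ∀ i → Incident Γ {0} (inj₁ (W i)) (E i)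
    onPrevious     : ∀ i → Incident Γ {0} (inj₁ (W (cyclicSuc i))) (E i)
    meet           : ∀ i v → Incident Γ {0} (inj₁ v) (E i) → Incident Γ {0} (inj₁ v) (E (cyclicSuc i)) → v ≡ W (cyclicSuc i)
    nonconsecutive : ∀ i j v → i ≢ j → j ≢ cyclicSuc i → i ≢ cyclicSuc j →
      Incident Γ {0} (inj₁ v) (E i) → ¬ Incident Γ {0} (inj₁ v) (E j)

predecessor : ∀ {l} (i : Fin l) → ∃[ j ] cyclicSuc j ≡ i
predecessor = injective⇒surjective cyclicSuc cyclicSuc-injective

graph-cycle : ∀ {q n s} {Γ : Graph n s} {H} (P : Presentation q Γ H) {l} (C : LooseCycle H l) →
  Σ (GraphCycle Γ l) λ C′ → ∀ i → to (Presentation.edges P) (GraphCycle.E C′ i) ≡ LooseCycle.e C i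
graph-cycle {q} {n} {s} {Γ} {H} P {l} C = record
  { length≥3       = length≥3
  ; E              = E
  ; W              = W
  ; E-injective    = λ eq → e-distinct (≡.trans (≡.sym (to-E _)) (≡.trans (≡.cong (to edges) eq) (to-E _)))
  ; W-injective    = λ {i} {j} eq → v-distinct (≡.trans (≡.sym (to-W i)) (≡.trans (≡.cong (to vertices ∘ inj₁) eq) (to-W j)))
  ; onEdge         = λ i → from⇔ (incident (W i) i) (≡.subst (_∈ edge H (e i)) (≡.sym (to-W i)) (v∈e i))
  ; onPrevious     = λ i → from⇔ (incident (W (cyclicSuc i)) i) (≡.subst (_∈ edge H (e i)) (≡.sym (to-W (cyclicSuc i))) (proj₁ (v∈ i)))
  ; meet           = λ i u u∈ u∈′ → inj₁-injective (to-injective vertices (≡.trans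
      (x∈⁅y⁆⇒x≡y _ (≡.subst (to vertices (inj₁ u) ∈_) (consecutive i) (x∈p∩q⁺ (to⇔ (incident u i) u∈ , to⇔ (incident u (cyclicSuc i)) u∈′))))
      (≡.sym (to-W (cyclicSuc i)))))
  ; nonconsecutive = λ i j u i≢j j≢ i≢ u∈ u∈′ → nonconsecutive i j i≢j j≢ i≢
      (to vertices (inj₁ u) , x∈p∩q⁺ (to⇔ (incident u i) u∈ , to⇔ (incident u j) u∈′))
  } , to-E
  where
  open Presentation P
  open LooseCycle C
  E : Fin l → Fin s
  E i = from edges (e i)
  to-E : ∀ i → to edges (E i) ≡ e i
  to-E i = strictlyInverseˡ edges (e i)
  inj₁-injective : ∀ {A B : Set} {x y : A} → inj₁ {B = B} x ≡ inj₁ y → x ≡ y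
  inj₁-injective ≡.refl = ≡.refl
  v∈ : ∀ i → v (cyclicSuc i) ∈ edge H (e i) × v (cyclicSuc i) ∈ edge H (e (cyclicSuc i))
  v∈ i = x∈p∩q⁻ (edge H (e i)) (edge H (e (cyclicSuc i))) (≡.subst (v (cyclicSuc i) ∈_) (≡.sym (consecutive i)) (x∈⁅x⁆ (v (cyclicSuc i))))
  v∈e : ∀ i → v i ∈ edge H (e i)
  v∈e i = let j , eq = predecessor i in ≡.subst (λ k → v k ∈ edge H (e k)) eq (proj₂ (v∈ j))
  incident : ∀ u i → Incident Γ {0} (inj₁ u) (E i) ⇔ (to vertices (inj₁ u) ∈ edge H (e i))
  incident u i = ≡.subst (λ f → Incident Γ {0} (inj₁ u) (E i) ⇔ (to vertices (inj₁ u) ∈ edge H f)) (to-E i) (incidence (inj₁ u) (E i))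
  -- A new vertex lies in a single edge, whereas each vertex of the cycle lies in two consecutive,
  -- hence distinct, edges.
  old : ∀ i → ∃[ u ] to vertices (inj₁ u) ≡ v i
  old i with from vertices (v i) in eq
  ... | inj₁ u = u , ≡.trans (≡.cong (to vertices) (≡.sym eq)) (strictlyInverseˡ vertices (v i))
  ... | inj₂ (f , k) = contradiction (e-distinct e≡e) λ j≡i → cyclicSuc≢ length≥3 j (≡.trans (proj₂ (predecessor i)) (≡.sym j≡i))
    where
    j = proj₁ (predecessor i)
    v≡ : to vertices (inj₂ (f , k)) ≡ v i
    v≡ = ≡.trans (≡.cong (to vertices) (≡.sym eq)) (strictlyInverseˡ vertices (v i))
    f≡ : ∀ i′ → v i ∈ edge H (e i′) → f ≡ E i′
    f≡ i′ v∈ = from⇔ (incidence (inj₂ (f , k)) (E i′)) (≡.subst₂ (λ u f → u ∈ edge H f) (≡.sym v≡) (≡.sym (to-E i′)) v∈)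
    e≡e : e j ≡ e i
    e≡e = ≡.trans (≡.sym (to-E j)) (≡.trans (≡.cong (to edges) (≡.trans
      (≡.sym (f≡ j (≡.subst (λ k → v k ∈ edge H (e j)) (proj₂ (predecessor i)) (proj₁ (v∈ j))))) (f≡ i (v∈e i)))) (to-E i))
  W : Fin l → Fin n
  W i = proj₁ (old i)
  to-W : ∀ i → to vertices (inj₁ (W i)) ≡ v i
  to-W i = proj₂ (old i)

-- Two triangles sharing the universal vertex r: each cycle is the triangle of the edge opposite to r.
module Bowtie {n s} (Γ : Graph n s) (r : Fin n) (ε₁ ε₂ : Fin s)
  (disjoint : ∀ v → Incident Γ {0} (inj₁ v) ε₁ → ¬ Incident Γ {0} (inj₁ v) ε₂)
  (r∉ε₁ : ¬ Incident Γ {0} (inj₁ r) ε₁) (r∉ε₂ : ¬ Incident Γ {0} (inj₁ r) ε₂)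
  (spoke : ∀ e → e ≢ ε₁ → e ≢ ε₂ → Incident Γ {0} (inj₁ r) e) where

  open Graph Γ

  private
    _∈ₑ_ : Fin n → Fin s → Set
    v ∈ₑ e = Incident Γ {0} (inj₁ v) e

    Rim : Fin s → Set
    Rim e = e ≡ ε₁ ⊎ e ≡ ε₂

    rim? : ∀ e → Dec (Rim e)
    rim? e = (e ≟ ε₁) ⊎-dec (e ≟ ε₂)

    ¬rim⇒r∈ : ∀ {e} → ¬ Rim e → r ∈ₑ e
    ¬rim⇒r∈ ¬rim = spoke _ (¬rim ∘ inj₁) (¬rim ∘ inj₂)

    rim⇒r∉ : ∀ {e} → Rim e → ¬ r ∈ₑ e
    rim⇒r∉ (inj₁ ≡.refl) = r∉ε₁
    rim⇒r∉ (inj₂ ≡.refl) = r∉ε₂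

    rims-meet : ∀ {e f v} → Rim e → Rim f → v ∈ₑ e → v ∈ₑ f → e ≡ f
    rims-meet (inj₁ ≡.refl) (inj₁ ≡.refl) _ _ = ≡.refl
    rims-meet (inj₁ ≡.refl) (inj₂ ≡.refl) p r = contradiction r (disjoint _ p)
    rims-meet (inj₂ ≡.refl) (inj₁ ≡.refl) p r = contradiction p (disjoint _ r)
    rims-meet (inj₂ ≡.refl) (inj₂ ≡.refl) _ _ = ≡.refl

    ∈ₑ-joins : ∀ {e a b} → a ≢ b → a ∈ₑ e → b ∈ₑ e → Joins e a b
    ∈ₑ-joins a≢b (inj₁ p) (inj₁ r) = contradiction (≡.trans p (≡.sym r)) a≢b
    ∈ₑ-joins a≢b (inj₁ p) (inj₂ r) = inj₁ (≡.sym p , ≡.sym r)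
    ∈ₑ-joins a≢b (inj₂ p) (inj₁ r) = inj₂ (≡.sym r , ≡.sym p)
    ∈ₑ-joins a≢b (inj₂ p) (inj₂ r) = contradiction (≡.trans p (≡.sym r)) a≢b

    joins-∈ₑ : ∀ {e a b v} → Joins e a b → v ∈ₑ e → v ≡ a ⊎ v ≡ b
    joins-∈ₑ (inj₁ (≡.refl , ≡.refl)) v∈ = v∈
    joins-∈ₑ (inj₂ (≡.refl , ≡.refl)) v∈ = Sum.swap v∈

  -- The triangle is described by its edge opposite to `r`, without any cyclic labelling, so that
  -- cycles with the same opposite edge get the same edge set.
  Triangle : Fin s → Fin s → Set
  Triangle ε f = f ≡ ε ⊎ (r ∈ₑ f × ∃[ v ] v ∈ₑ ε × v ∈ₑ f)

  module _ {l} (C : GraphCycle Γ l) where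

    open GraphCycle C

    private
      s′ : Fin l → Fin l
      s′ = cyclicSuc

      through-r : ∀ i j → r ∈ₑ E i → r ∈ₑ E j → i ≡ j ⊎ j ≡ s′ i ⊎ i ≡ s′ j
      through-r i j r∈i r∈j with i ≟ j | j ≟ s′ i | i ≟ s′ j
      ... | yes p | _ | _ = inj₁ p
      ... | no _ | yes p | _ = inj₂ (inj₁ p)
      ... | no _ | no _ | yes p = inj₂ (inj₂ p)
      ... | no a | no b | no c = contradiction r∈j (nonconsecutive i j r a b c r∈i)

      next-to-rim : ∀ i → Rim (E i) → r ∈ₑ E (s′ i)
      next-to-rim i rim = ¬rim⇒r∈ λ rim′ → cyclicSuc≢ length≥3 i
        (E-injective (≡.sym (rims-meet rim rim′ (onPrevious i) (onEdge (s′ i)))))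

      before-rim : ∀ j → Rim (E (s′ j)) → r ∈ₑ E j
      before-rim j rim = ¬rim⇒r∈ λ rim′ → cyclicSuc≢ length≥3 j
        (E-injective (rims-meet rim rim′ (onEdge (s′ j)) (onPrevious j)))

      module _ (j : Fin l) (rim : Rim (E (s′ j))) where

        i = s′ j

        -- The edges before and after a rim edge both contain `r`. In a loose cycle they must then
        -- be consecutive, so the cycle closes after three steps.
        closing : j ≡ s′ (s′ i)
        closing with through-r j (s′ i) (before-rim j rim) (next-to-rim i rim)
        ... | inj₁ j≡s²j = contradiction (≡.sym j≡s²j) (cyclicSuc²≢ length≥3 j)
        ... | inj₂ (inj₁ si≡i) = contradiction si≡i (cyclicSuc≢ length≥3 i)
        ... | inj₂ (inj₂ eq) = eq

        only-spokes : ∀ k → r ∈ₑ E k → k ≡ j ⊎ k ≡ s′ i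
        only-spokes k r∈ with through-r k j r∈ (before-rim j rim)
        ... | inj₁ eq = inj₁ eq
        ... | inj₂ (inj₁ j≡sk) = inj₂ (cyclicSuc-injective (≡.trans (≡.sym j≡sk) closing))
        ... | inj₂ (inj₂ k≡i) = contradiction (≡.subst (λ k → r ∈ₑ E k) k≡i r∈) (rim⇒r∉ rim)

        only-edges : ∀ k → k ≡ i ⊎ k ≡ j ⊎ k ≡ s′ i
        only-edges k with rim? (E k)
        ... | no ¬rim = inj₂ (only-spokes k (¬rim⇒r∈ ¬rim))
        ... | yes rim′ with only-spokes (s′ k) (next-to-rim k rim′)
        ...   | inj₁ sk≡j = inj₂ (inj₂ (cyclicSuc-injective (≡.trans sk≡j closing)))
        ...   | inj₂ sk≡si = inj₁ (cyclicSuc-injective sk≡si)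

        ends : Joins (E i) (W i) (W (s′ i))
        ends = ∈ₑ-joins (λ eq → cyclicSuc≢ length≥3 i (≡.sym (W-injective eq))) (onEdge i) (onPrevious i)

        triangle : ∀ f → (∃[ k ] E k ≡ f) ⇔ Triangle (E i) f
        triangle f = mk⇔ (λ (k , eq) → forth k eq (only-edges k)) back
          where
          forth : ∀ k → E k ≡ f → k ≡ i ⊎ k ≡ j ⊎ k ≡ s′ i → Triangle (E i) f
          forth k ≡.refl (inj₁ ≡.refl) = inj₁ ≡.refl
          forth k ≡.refl (inj₂ (inj₁ ≡.refl)) = inj₂ (before-rim j rim , W i , onEdge i , onPrevious j)
          forth k ≡.refl (inj₂ (inj₂ ≡.refl)) = inj₂ (next-to-rim i rim , W (s′ i) , onPrevious i , onEdge (s′ i))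
          r≢ : ∀ {v} → v ∈ₑ E i → r ≢ v
          r≢ v∈ ≡.refl = rim⇒r∉ rim v∈
          back : Triangle (E i) f → ∃[ k ] E k ≡ f
          back (inj₁ f≡) = i , ≡.sym f≡
          back (inj₂ (r∈f , v , v∈ε , v∈f)) with joins-∈ₑ ends v∈ε
          ... | inj₁ ≡.refl = j , simple (∈ₑ-joins (r≢ v∈ε) (before-rim j rim) (onPrevious j)) (∈ₑ-joins (r≢ v∈ε) r∈f v∈f)
          ... | inj₂ ≡.refl = s′ i , simple (∈ₑ-joins (r≢ v∈ε) (next-to-rim i rim) (onEdge (s′ i))) (∈ₑ-joins (r≢ v∈ε) r∈f v∈f)

    -- If every edge passed through `r`, it would be the common vertex of all consecutive pairs,
    -- although these common vertices are distinct.
    some-rim : ∃[ j ] Rim (E (cyclicSuc j))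
    some-rim with any? (λ j → rim? (E (cyclicSuc j)))
    ... | yes found = found
    ... | no none = contradiction (W-injective (≡.trans (≡.sym (meet k r (r∈ _) (r∈ _))) (meet (s′ k) r (r∈ _) (r∈ _)))) (cyclicSuc≢ length≥3 (s′ k) ∘ ≡.sym)
      where
      k : Fin l
      k = fromℕ< (ℕ.≤-trans (ℕ.s≤s ℕ.z≤n) length≥3)
      r∈ : ∀ i → r ∈ₑ E i
      r∈ i = ¬rim⇒r∈ λ rim → let j , eq = predecessor i in none (j , ≡.subst (λ i → Rim (E i)) (≡.sym eq) rim)

    cycle-triangle : (∀ f → (∃[ k ] E k ≡ f) ⇔ Triangle ε₁ f) ⊎ (∀ f → (∃[ k ] E k ≡ f) ⇔ Triangle ε₂ f)
    cycle-triangle = case some-rim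
      where
      case : ∃[ j ] Rim (E (cyclicSuc j)) → _
      case (j , inj₁ eq) = inj₁ λ f → ≡.subst (λ ε → (∃[ k ] E k ≡ f) ⇔ Triangle ε f) eq (triangle j (inj₁ eq) f)
      case (j , inj₂ eq) = inj₂ λ f → ≡.subst (λ ε → (∃[ k ] E k ≡ f) ⇔ Triangle ε f) eq (triangle j (inj₂ eq) f)

  -- Only two edge sets are possible for a cycle, so two of the three would coincide.
  bowtie-not-tricyclic : ∀ {q H} → Presentation q Γ H → ¬ Tricyclic H
  bowtie-not-tricyclic {q} {H} P (C , C-injective , complete) = two-of-three (kind 0F) (kind 1F) (kind 2F)
    where
    open Presentation P
    Matches : Subset (size H) → Fin s → Set
    Matches S ε = ∀ f → f ∈ S ⇔ Triangle ε (from edges f)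
    transfer : ∀ {S l ε} (c : LooseCycle H l) → (∀ f → f ∈ S ⇔ (∃[ i ] LooseCycle.e c i ≡ f)) → (c′ : GraphCycle Γ l) →
      (∀ i → to edges (GraphCycle.E c′ i) ≡ LooseCycle.e c i) → (∀ f → (∃[ k ] GraphCycle.E c′ k ≡ f) ⇔ Triangle ε f) → Matches S ε
    transfer c h c′ to-E tri f = mk⇔
      (λ f∈ → let k , eq = to⇔ (h f) f∈ in to⇔ (tri (from edges f)) (k , to-injective edges
        (≡.trans (to-E k) (≡.trans eq (≡.sym (strictlyInverseˡ edges f))))))
      (λ t → let k , eq = from⇔ (tri (from edges f)) t in from⇔ (h f) (k ,
        ≡.trans (≡.sym (to-E k)) (≡.trans (≡.cong (to edges) eq) (strictlyInverseˡ edges f))))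
    kind : ∀ i → Matches (C i) ε₁ ⊎ Matches (C i) ε₂
    kind i =
      let l , c , h = from⇔ (complete (C i)) (i , ≡.refl)
          c′ , to-E = graph-cycle P c
      in Sum.map (transfer c h c′ to-E) (transfer c h c′ to-E) (cycle-triangle c′)
    same : ∀ {i j ε} → Matches (C i) ε → Matches (C j) ε → i ≡ j
    same mᵢ mⱼ = C-injective (⊆-antisym (λ {f} f∈ → from⇔ (mⱼ f) (to⇔ (mᵢ f) f∈)) (λ {f} f∈ → from⇔ (mᵢ f) (to⇔ (mⱼ f) f∈)))
    two-of-three : Matches (C 0F) ε₁ ⊎ Matches (C 0F) ε₂ → Matches (C 1F) ε₁ ⊎ Matches (C 1F) ε₂ → Matches (C 2F) ε₁ ⊎ Matches (C 2F) ε₂ → ⊥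
    two-of-three (inj₁ p) (inj₁ r) _ = contradiction (same p r) λ ()
    two-of-three (inj₂ p) (inj₂ r) _ = contradiction (same p r) λ ()
    two-of-three (inj₁ p) (inj₂ _) (inj₁ r) = contradiction (same p r) λ ()
    two-of-three (inj₁ _) (inj₂ p) (inj₂ r) = contradiction (same p r) λ ()
    two-of-three (inj₂ _) (inj₁ p) (inj₁ r) = contradiction (same p r) λ ()
    two-of-three (inj₂ p) (inj₁ _) (inj₂ r) = contradiction (same p r) λ ()

-- A walk in H may pass through new vertices; such a vertex counts as reached when the first end of
-- its edge is.
presentation-connected : ∀ {q n s} {Γ : Graph n s} {H} → Presentation q Γ H → Connected H → ∀ r v → ∃[ i ] Graph.Reach Γ r i v
presentation-connected {q} {n} {s} {Γ} {H} P connected r v =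
  ≡.subst Reached (strictlyInverseʳ vertices (inj₁ v)) (walk (connected (to vertices (inj₁ r)) (to vertices (inj₁ v)))
    (≡.subst Reached (≡.sym (strictlyInverseʳ vertices (inj₁ r))) (0 , ≡.refl)))
  where
  open Presentation P
  open Graph Γ
  Reached : Fin n ⊎ Fin s × Fin q → Set
  Reached (inj₁ v)       = ∃[ i ] Reach r i v
  Reached (inj₂ (f , _)) = ∃[ i ] Reach r i (end₁ f)
  to-end₁ : ∀ x f → Incident Γ x f → Reached x → ∃[ i ] Reach r i (end₁ f)
  to-end₁ (inj₁ v) f (inj₁ ≡.refl) reached = reached
  to-end₁ (inj₁ v) f (inj₂ ≡.refl) (i , reach) = suc i , v , reach , f , joins-sym (joins-self f)
  to-end₁ (inj₂ _) f ≡.refl        reached = reached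
  from-end₁ : ∀ x f → Incident Γ x f → ∃[ i ] Reach r i (end₁ f) → Reached x
  from-end₁ (inj₁ v) f (inj₁ ≡.refl) reached = reached
  from-end₁ (inj₁ v) f (inj₂ ≡.refl) (i , reach) = suc i , end₁ f , reach , f , joins-self f
  from-end₁ (inj₂ _) f ≡.refl        reached = reached
  incident : ∀ i e → i ∈ edge H e → Incident Γ (from vertices i) (from edges e)
  incident i e i∈e = from⇔ (incidence (from vertices i) (from edges e))
    (≡.subst₂ (λ i e → i ∈ edge H e) (≡.sym (strictlyInverseˡ vertices i)) (≡.sym (strictlyInverseˡ edges e)) i∈e)
  walk : ∀ {i j} → Star (Adjacent H) i j → Reached (from vertices i) → Reached (from vertices j)
  walk Walk.ε reached = reached
  walk ((_ , e , i∈e , j∈e) ◅ rest) reached =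
    walk rest (from-end₁ _ (from edges e) (incident _ e j∈e) (to-end₁ _ (from edges e) (incident _ e i∈e) reached))

module _ {q n} {Γ : Graph n (suc n)} {H} (P : Presentation q Γ H) (tricyclic : Tricyclic H) where

  open Graph Γ

  universal-vertex : ∀ r → (∀ j → j ≢ r → r ∼ j) → Skeleton Γ r → H ≅ T₁C (suc (suc q)) (suc n ∸ 5) 0 0 0
  universal-vertex r spokes S = cases (end₁ e₁ ≟ end₁ e₂) (end₁ e₁ ≟ end₂ e₂) (end₂ e₁ ≟ end₁ e₂) (end₂ e₁ ≟ end₂ e₂)
    where
    open Skeleton S
    ends≢r : ∀ e → (∀ {j} → ¬ Joins e r j) → end₁ e ≢ r × end₂ e ≢ r
    ends≢r e avoids = (λ eq → avoids (inj₁ (eq , ≡.refl))) , (λ eq → avoids (inj₂ (≡.refl , eq)))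
    spoke : ∀ e → e ≢ e₁ → e ≢ e₂ → Incident Γ {0} (inj₁ r) e
    spoke e e≢e₁ e≢e₂ with injective⇒surjective all-edges all-edges-injective e
    ... | zero  , e₂≡e = contradiction (≡.sym e₂≡e) e≢e₂
    ... | suc j , ≡.refl with j ≟ r
    ...   | yes ≡.refl = contradiction tree-root e≢e₁
    ...   | no j≢r with tree-neighbour j (spokes j j≢r)
    ...     | inj₁ (p , _) = inj₁ (≡.sym p)
    ...     | inj₂ (_ , p) = inj₂ (≡.sym p)
    shared : ∀ {c a b} → Joins e₁ c a → Joins e₂ c b → H ≅ T₁C (suc (suc q)) (suc n ∸ 5) 0 0 0
    shared j₁ j₂ = universal-≅ P
      (four-injective (≢r e₁ e₁-avoids (joins-sym j₁)) (≢r e₁ e₁-avoids j₁) (≢r e₂ e₂-avoids (joins-sym j₂))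
        (joins-distinct j₁) (λ { ≡.refl → e₁≢e₂ (simple j₁ j₂) }) (joins-distinct j₂ ∘ ≡.sym))
      spokes (e₁ , j₁) (e₂ , j₂)
      where
      ≢r : ∀ e → (∀ {j} → ¬ Joins e r j) → ∀ {x y} → Joins e x y → x ≢ r
      ≢r e avoids j ≡.refl = avoids j
    cases : Dec (end₁ e₁ ≡ end₁ e₂) → Dec (end₁ e₁ ≡ end₂ e₂) → Dec (end₂ e₁ ≡ end₁ e₂) → Dec (end₂ e₁ ≡ end₂ e₂) → H ≅ T₁C (suc (suc q)) (suc n ∸ 5) 0 0 0
    cases (yes p) _ _ _ = shared (joins-self e₁) (inj₁ (≡.sym p , ≡.refl))
    cases _ (yes p) _ _ = shared (joins-self e₁) (inj₂ (≡.refl , ≡.sym p))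
    cases _ _ (yes p) _ = shared (joins-sym (joins-self e₁)) (inj₁ (≡.sym p , ≡.refl))
    cases _ _ _ (yes p) = shared (joins-sym (joins-self e₁)) (inj₂ (≡.refl , ≡.sym p))
    cases (no p₁₁) (no p₁₂) (no p₂₁) (no p₂₂) = contradiction tricyclic (Bowtie.bowtie-not-tricyclic Γ r e₁ e₂
      (λ { v (inj₁ ≡.refl) (inj₁ eq) → p₁₁ eq ; v (inj₁ ≡.refl) (inj₂ eq) → p₁₂ eq
         ; v (inj₂ ≡.refl) (inj₁ eq) → p₂₁ eq ; v (inj₂ ≡.refl) (inj₂ eq) → p₂₂ eq })
      (λ { (inj₁ eq) → proj₁ (ends≢r e₁ e₁-avoids) (≡.sym eq) ; (inj₂ eq) → proj₂ (ends≢r e₁ e₁-avoids) (≡.sym eq) })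
      (λ { (inj₁ eq) → proj₁ (ends≢r e₂ e₂-avoids) (≡.sym eq) ; (inj₂ eq) → proj₂ (ends≢r e₂ e₂-avoids) (≡.sym eq) })
      spoke P)

  no-universal-vertex : (∀ r v → ∃[ i ] Reach r i v) → ¬ (H ≅ T₁C (suc (suc q)) (suc n ∸ 5) 0 0 0) → ∀ r → ∃[ u ] u ≢ r × ¬ r ∼ u
  no-universal-vertex connected ≇ r =
    let u , ¬p = ¬∀⟶∃¬ n (λ j → j ≡ r ⊎ r ∼ j) (λ j → (j ≟ r) ⊎-dec (r ∼? j)) (λ all → ≇ (universal-vertex r (adj all) S))
    in u , ¬p ∘ inj₁ , ¬p ∘ inj₂
    where
    adj : (∀ j → j ≡ r ⊎ r ∼ j) → ∀ j → j ≢ r → r ∼ j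
    adj all j j≢r with all j
    ... | inj₁ j≡r = contradiction j≡r j≢r
    ... | inj₂ r∼j = r∼j
    other : Dec (end₁ zero ≡ r) → ∃[ u ] u ≢ r
    other (no ≢r)  = end₁ zero , ≢r
    other (yes ≡r) = end₂ zero , λ eq → proper zero (≡.trans ≡r (≡.sym eq))
    S : Skeleton Γ r
    S = let u , u≢r = other (end₁ zero ≟ r) in BreadthFirstSkeleton.skeleton Γ r u u≢r (connected r)

-- Spectra


incident? : ∀ {n s} (Γ : Graph n s) v e → Dec (Incident Γ {0} (inj₁ v) e)
incident? Γ v e = (v ≟ Graph.end₁ Γ e) ⊎-dec (v ≟ Graph.end₂ Γ e)

module _ {q n s} {Γ : Graph n s} {H} (P : Presentation q Γ H) where

  open Presentation P
  open Graph Γ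

  private
    V : Fin n ⊎ Fin s × Fin q → Fin (order H)
    V = to vertices

  adjacent⇔ : ∀ x y → Adjacent H (V x) (V y) ⇔ (x ≢ y × ∃[ e ] Incident Γ x e × Incident Γ y e)
  adjacent⇔ x y = mk⇔
    (λ (x≢y , e , x∈e , y∈e) → x≢y ∘ ≡.cong V , from edges e ,
      from⇔ (incidence x (from edges e)) (≡.subst (λ f → V x ∈ edge H f) (≡.sym (strictlyInverseˡ edges e)) x∈e) ,
      from⇔ (incidence y (from edges e)) (≡.subst (λ f → V y ∈ edge H f) (≡.sym (strictlyInverseˡ edges e)) y∈e))
    (λ (x≢y , e , x∈e , y∈e) → x≢y ∘ to-injective vertices , to edges e , to⇔ (incidence x e) x∈e , to⇔ (incidence y e) y∈e)

  private
    endpoints-join : ∀ {a b e} → a ≢ b → (a ≡ end₁ e ⊎ a ≡ end₂ e) → (b ≡ end₁ e ⊎ b ≡ end₂ e) → Joins e a b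
    endpoints-join a≢b (inj₁ p) (inj₁ r) = contradiction (≡.trans p (≡.sym r)) a≢b
    endpoints-join a≢b (inj₁ p) (inj₂ r) = inj₁ (≡.sym p , ≡.sym r)
    endpoints-join a≢b (inj₂ p) (inj₁ r) = inj₂ (≡.sym r , ≡.sym p)
    endpoints-join a≢b (inj₂ p) (inj₂ r) = contradiction (≡.trans p (≡.sym r)) a≢b

    joins-endpoints : ∀ {a b e} → Joins e a b → (a ≡ end₁ e ⊎ a ≡ end₂ e) × (b ≡ end₁ e ⊎ b ≡ end₂ e)
    joins-endpoints (inj₁ (p , r)) = inj₁ (≡.sym p) , inj₂ (≡.sym r)
    joins-endpoints (inj₂ (p , r)) = inj₂ (≡.sym r) , inj₁ (≡.sym p)

  does-∼ : ∀ v v′ → does (adjacent? H (V (inj₁ v)) (V (inj₁ v′))) ≡ does (v ∼? v′)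
  does-∼ v v′ = does-⇔ (mk⇔
    (λ adj → let v≢ , e , p , r = to⇔ (adjacent⇔ (inj₁ v) (inj₁ v′)) adj in e , endpoints-join (v≢ ∘ ≡.cong inj₁) p r)
    (λ (e , j) → from⇔ (adjacent⇔ (inj₁ v) (inj₁ v′)) ((λ { ≡.refl → joins-distinct j ≡.refl }) , e , joins-endpoints j)))
    (adjacent? H (V (inj₁ v)) (V (inj₁ v′))) (v ∼? v′)

  does-old-new : ∀ v e l → does (adjacent? H (V (inj₁ v)) (V (inj₂ (e , l)))) ≡ does (incident? Γ v e)
  does-old-new v e l = does-⇔ (mk⇔
    (λ adj → let _ , f , p , e≡f = to⇔ (adjacent⇔ (inj₁ v) (inj₂ (e , l))) adj in ≡.subst (λ e → v ≡ end₁ e ⊎ v ≡ end₂ e) (≡.sym e≡f) p)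
    (λ p → from⇔ (adjacent⇔ (inj₁ v) (inj₂ (e , l))) ((λ ()) , e , p , ≡.refl)))
    (adjacent? H (V (inj₁ v)) (V (inj₂ (e , l)))) (incident? Γ v e)

  does-new-old : ∀ e l v → does (adjacent? H (V (inj₂ (e , l))) (V (inj₁ v))) ≡ does (incident? Γ v e)
  does-new-old e l v = does-⇔ (mk⇔
    (λ adj → let _ , f , e≡f , p = to⇔ (adjacent⇔ (inj₂ (e , l)) (inj₁ v)) adj in ≡.subst (λ e → v ≡ end₁ e ⊎ v ≡ end₂ e) (≡.sym e≡f) p)
    (λ p → from⇔ (adjacent⇔ (inj₂ (e , l)) (inj₁ v)) ((λ ()) , e , ≡.refl , p)))
    (adjacent? H (V (inj₂ (e , l))) (V (inj₁ v))) (incident? Γ v e)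

  does-new-new : ∀ e l e′ l′ → does (adjacent? H (V (inj₂ (e , l))) (V (inj₂ (e′ , l′)))) ≡ does ((e′ ≟ e) ×-dec ¬? (l′ ≟ l))
  does-new-new e l e′ l′ = does-⇔ (mk⇔
    (λ adj → let ne , f , e≡f , e′≡f = to⇔ (adjacent⇔ (inj₂ (e , l)) (inj₂ (e′ , l′))) adj
             in ≡.trans e′≡f (≡.sym e≡f) , λ l′≡l → ne (≡.cong₂ (λ e l → inj₂ (e , l)) (≡.trans e≡f (≡.sym e′≡f)) (≡.sym l′≡l)))
    (λ (e′≡e , l′≢l) → from⇔ (adjacent⇔ (inj₂ (e , l)) (inj₂ (e′ , l′))) ((λ { ≡.refl → l′≢l ≡.refl }) , e , ≡.refl , e′≡e)))
    (adjacent? H (V (inj₂ (e , l))) (V (inj₂ (e′ , l′)))) ((e′ ≟ e) ×-dec ¬? (l′ ≟ l))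

module BlockSums (R : OrderedRing) where

  open OrderedRingProperties R
  open Sums R

  sum-+ : ∀ m {k} (f : Fin (m ℕ.+ k) → Carrier) → sum f ≈ sum (λ i → f (i ↑ˡ k)) + sum (λ j → f (m ↑ʳ j))
  sum-+ zero    f = sym (+-identityˡ (sum f))
  sum-+ (suc m) f = trans (+-congˡ (sum-+ m (f ∘ suc))) (sym (+-assoc _ _ _))

  sum-* : ∀ m k (f : Fin (m ℕ.* k) → Carrier) → sum f ≈ sum (λ i → sum (λ j → f (combine {m} {k} i j)))
  sum-* zero    k f = refl
  sum-* (suc m) k f = trans (sum-+ k f) (+-congˡ (sum-* m k (λ j → f (k ↑ʳ j))))

  sum-when : ∀ {n} b (f : Fin n → Carrier) → sum (λ i → when b (f i)) ≈ when b (sum f)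
  sum-when {n} false f = sum-zero {n} {λ _ → 0#} λ _ → refl
  sum-when     true  f = refl

module Collapse (R : OrderedRing) {q n s} {Γ : Graph n s} {H} (P : Presentation q Γ H)
                (y : Fin (order H) → OrderedRing.Carrier R) where

  open OrderedRingProperties R
  open Sums R
  open BlockSums R
  open Presentation P
  open Graph Γ

  N : Fin (order H) → Carrier
  N i = sum (λ j → when (does (adjacent? H i j)) (y j))

  old : Fin n → Carrier
  old v = y (to vertices (inj₁ v))

  new : Fin s → Fin q → Carrier
  new e l = y (to vertices (inj₂ (e , l)))

  total : Fin s → Carrier
  total e = sum (new e)

  sum-vertices : ∀ (g : Fin (order H) → Carrier) →
    sum g ≈ sum (λ v → g (to vertices (inj₁ v))) + sum (λ e → sum (λ l → g (to vertices (inj₂ (e , l)))))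
  sum-vertices g = trans (sum-permute g (inverse blocks ⨾ vertices)) (trans (sum-+ n (λ k → g (to vertices (from blocks k))))
    (+-cong (sum-cong λ v → reflexive (≡.cong (g ∘ to vertices) (strictlyInverseʳ blocks (inj₁ v))))
      (trans (sum-* s q (λ k → g (to vertices (from blocks (n ↑ʳ k)))))
        (sum-cong λ e → sum-cong λ l → reflexive (≡.cong (g ∘ to vertices) (strictlyInverseʳ blocks (inj₂ (e , l))))))))
    where
    blocks : (Fin n ⊎ Fin s × Fin q) ↔ Fin (n ℕ.+ s ℕ.* q)
    blocks = sum↔ identity↔ product↔

  at-ends : Fin n → Fin s → Carrier → Carrier → Carrier
  at-ends v e a b = when (does (v ≟ end₁ e)) a + when (does (v ≟ end₂ e)) b

  at-ends-incident : ∀ v e x → when (does (incident? Γ v e)) x ≈ at-ends v e x x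
  at-ends-incident v e x with v ≟ end₁ e | v ≟ end₂ e
  ... | yes p | yes r = contradiction (≡.trans (≡.sym p) r) (proper e)
  ... | yes _ | no _  = sym (+-identityʳ x)
  ... | no _  | yes _ = sym (+-identityˡ x)
  ... | no _  | no _  = sym (+-identityˡ 0#)

  private
    pair-term : Fin n → Fin n → Carrier → Fin s → Carrier
    pair-term v v′ x e = at-ends v e (when (does (v′ ≟ end₂ e)) x) (when (does (v′ ≟ end₁ e)) x)

    pair-joins : ∀ {v v′} x {e} → Joins e v v′ → pair-term v v′ x e ≈ x
    pair-joins x {e} (inj₁ (≡.refl , ≡.refl)) = trans (+-cong
      (reflexive (≡.trans (when-yes (end₁ e ≟ end₁ e) ≡.refl) (when-yes (end₂ e ≟ end₂ e) ≡.refl)))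
      (reflexive (when-no (end₁ e ≟ end₂ e) (proper e)))) (+-identityʳ x)
    pair-joins x {e} (inj₂ (≡.refl , ≡.refl)) = trans (+-cong
      (reflexive (when-no (end₂ e ≟ end₁ e) (proper e ∘ ≡.sym)))
      (reflexive (≡.trans (when-yes (end₂ e ≟ end₂ e) ≡.refl) (when-yes (end₁ e ≟ end₁ e) ≡.refl)))) (+-identityˡ x)

    pair-no : ∀ {v v′} x {e} → ¬ Joins e v v′ → pair-term v v′ x e ≈ 0#
    pair-no {v} {v′} x {e} ¬j with v ≟ end₁ e | v′ ≟ end₂ e | v ≟ end₂ e | v′ ≟ end₁ e
    ... | yes p | yes r | _     | _     = contradiction (inj₁ (≡.sym p , ≡.sym r)) ¬j
    ... | _     | _     | yes p | yes r = contradiction (inj₂ (≡.sym r , ≡.sym p)) ¬j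
    ... | yes _ | no _  | yes _ | no _  = +-identityˡ 0#
    ... | yes _ | no _  | no _  | _     = +-identityˡ 0#
    ... | no _  | _     | yes _ | no _  = +-identityˡ 0#
    ... | no _  | _     | no _  | _     = +-identityˡ 0#

    sum-pairs : ∀ v v′ x → when (does (v ∼? v′)) x ≈ sum (pair-term v v′ x)
    sum-pairs v v′ x = sym (case (v ∼? v′))
      where
      case : ∀ (d : Dec (v ∼ v′)) → sum (pair-term v v′ x) ≈ when (does d) x
      case (no v≁v′) = sum-zero λ e → pair-no x λ j → v≁v′ (e , j)
      case (yes (e₀ , j₀)) = trans (sum-cong term) (sum-δ e₀ λ _ → x)
        where
        term : ∀ e → pair-term v v′ x e ≈ when (does (e ≟ e₀)) x
        term e with e ≟ e₀
        ... | yes ≡.refl = pair-joins x j₀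
        ... | no e≢e₀ = pair-no x λ j → e≢e₀ (simple j j₀)

    sum-at-ends : ∀ v e (f g : Fin n → Carrier) → sum (λ v′ → at-ends v e (f v′) (g v′)) ≈ at-ends v e (sum f) (sum g)
    sum-at-ends v e f g = trans (∑-distrib-+ {n} (λ v′ → when (does (v ≟ end₁ e)) (f v′)) (λ v′ → when (does (v ≟ end₂ e)) (g v′)))
      (+-cong (sum-when (does (v ≟ end₁ e)) f) (sum-when (does (v ≟ end₂ e)) g))

  -- Γ is simple, so exactly one edge leads to each neighbour and the sum can run over edges
  -- instead.
  sum-neighbours : ∀ v (g : Fin n → Carrier) →
    sum (λ v′ → when (does (v ∼? v′)) (g v′)) ≈ sum (λ e → at-ends v e (g (end₂ e)) (g (end₁ e)))
  sum-neighbours v g = trans (sum-cong λ v′ → sum-pairs v v′ (g v′))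
    (trans (∑-comm (λ v′ e → pair-term v v′ (g v′) e))
    (sum-cong λ e → trans (sum-at-ends v e (λ v′ → when (does (v′ ≟ end₂ e)) (g v′)) (λ v′ → when (does (v′ ≟ end₁ e)) (g v′)))
      (+-cong (when-cong (does (v ≟ end₁ e)) (sum-δ (end₂ e) g)) (when-cong (does (v ≟ end₂ e)) (sum-δ (end₁ e) g)))))

  when-+ : ∀ b x z → when b x + when b z ≈ when b (x + z)
  when-+ false x z = +-identityˡ 0#
  when-+ true  x z = refl

  N-old : ∀ v → N (to vertices (inj₁ v)) ≈ sum (λ e → at-ends v e (old (end₂ e) + total e) (old (end₁ e) + total e))
  N-old v = trans (sum-vertices _) (trans (+-cong
      (trans (sum-cong λ v′ → reflexive (≡.cong (λ b → when b (old v′)) (does-∼ P v v′))) (sum-neighbours v old))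
      (sum-cong λ e → trans (sum-cong λ l → reflexive (≡.cong (λ b → when b (new e l)) (does-old-new P v e l)))
        (trans (sum-when (does (incident? Γ v e)) (new e)) (at-ends-incident v e (total e)))))
    (trans (sym (∑-distrib-+ {s} _ _)) (sum-cong λ e → trans
      (solve 4 (λ a b c d → (a :+ b) :+ (c :+ d) := (a :+ c) :+ (b :+ d)) refl _ _ _ _)
      (+-cong (when-+ (does (v ≟ end₁ e)) (old (end₂ e)) (total e)) (when-+ (does (v ≟ end₂ e)) (old (end₁ e)) (total e))))))

  N-new : ∀ e l → N (to vertices (inj₂ (e , l))) ≈ (old (end₁ e) + old (end₂ e)) + (total e - new e l)
  N-new e l = trans (sum-vertices _) (+-cong
    (trans (sum-cong λ v → trans (reflexive (≡.cong (λ b → when b (old v)) (does-new-old P e l v))) (at-ends-incident v e (old v)))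
      (trans (∑-distrib-+ {n} (λ v → when (does (v ≟ end₁ e)) (old v)) (λ v → when (does (v ≟ end₂ e)) (old v)))
        (+-cong (sum-δ (end₁ e) old) (sum-δ (end₂ e) old))))
    (trans (sum-cong λ e′ → trans (sum-cong λ l′ → trans
        (reflexive (≡.cong (λ b → when b (new e′ l′)) (does-new-new P e l e′ l′))) (when-and (e′ ≟ e) (¬? (l′ ≟ l)) (new e′ l′)))
      (sum-when (does (e′ ≟ e)) (λ l′ → when (does (¬? (l′ ≟ l))) (new e′ l′))))
    (trans (sum-δ e (λ e′ → sum (λ l′ → when (does (¬? (l′ ≟ l))) (new e′ l′))))
      (trans (sum-cong λ l′ → when-¬ (l′ ≟ l) (new e l′)) (trans (sum-- {q} _ _) (+-congˡ (-‿cong (sum-δ l (new e)))))))))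
    where
    when-and : ∀ {A B : Set} (a? : Dec A) (b? : Dec B) x → when (does (a? ×-dec b?)) x ≈ when (does a?) (when (does b?) x)
    when-and (yes _) (yes _) x = refl
    when-and (yes _) (no _)  x = refl
    when-and (no _)  b?      x = refl
    when-¬ : ∀ {A : Set} (a? : Dec A) x → when (does (¬? a?)) x ≈ x - when (does a?) x
    when-¬ (yes _) x = sym (-‿inverseʳ x)
    when-¬ (no _)  x = sym (trans (+-congˡ (trans (sym (+-identityˡ (- 0#))) (-‿inverseʳ 0#))) (+-identityʳ x))

module PowerSpectrum (R : OrderedRing) {q n s} {Γ : Graph n s} {H} (P : Presentation q Γ H)
  (w : OrderedRing.Carrier R) (0≤w : OrderedRing._≤_ R (OrderedRing.0# R) w) where

  open OrderedRingProperties R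
  open Sums R
  open Presentation P
  open Graph Γ

  Q t : Carrier
  Q = fromℕ q
  t = w + fromℕ 1 + Q

  private
    w+1 : Carrier
    w+1 = w + fromℕ 1

    0≤Q : 0# ≤ Q
    0≤Q = 0≤fromℕ q

    0<w+1 : 0# < w+1
    0<w+1 = +-nonneg-pos 0≤w (<-respʳ (sym fromℤ-1) 0<1)

    0≤w+1 : 0# ≤ w+1
    0≤w+1 = <⇒≤ 0<w+1

    0<t : 0# < t
    0<t = +-pos-nonneg 0<w+1 0≤Q

    w+1-* : ∀ x → w+1 * x ≈ w * x + x
    w+1-* x = trans (distribʳ x w (fromℕ 1)) (+-congˡ (trans (*-congʳ fromℤ-1) (*-identityˡ x)))

  when-≡ : ∀ {A : Set} (d : Dec A) {a b} → (A → a ≤ b) → when (does d) a ≤ when (does d) b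
  when-≡ (yes p) a≤b = a≤b p
  when-≡ (no _)  a≤b = ≤-refl

  -- tw + Q = (w + 1)(w + Q): the equation for the eigenvalue w + Q is multiplied by w + 1, the
  -- denominator in the values of the new vertices.
  B≈ : ∀ x → (t * w + Q) * x ≈ w+1 * ((w + Q) * x)
  B≈ x = trans (solve 4 (λ w i Q x → ((w :+ i :+ Q) :* w :+ Q) :* x := (w :+ i) :* ((w :+ Q) :* x) :+ (Q :- i :* Q) :* x) refl w (fromℕ 1) Q x)
    (trans (+-congˡ (trans (*-congʳ (trans (+-congˡ (-‿cong (trans (*-congʳ fromℤ-1) (*-identityˡ Q)))) (-‿inverseʳ Q))) (*-zeroˡ x))) (+-identityʳ _))

  module Subsolution (y : Fin (order H) → Carrier) (0≤y : ∀ i → 0# ≤ y i) (r : Carrier) (w+Q≤r : w + Q ≤ r)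
    (r*y≤ : ∀ i → r * y i ≤ Collapse.N R P y i) where

    open Collapse R P y public
    open GraphForm R Γ t Q 0<t 0≤Q old using (flow)

    [w+Q]y≤N : ∀ i → (w + Q) * y i ≤ N i
    [w+Q]y≤N i = ≤-trans (*-monoʳ-≤ (0≤y i) w+Q≤r) (r*y≤ i)

    -- With X the sum of the two end values, adding the inequalities of the Q new vertices of an
    -- edge gives (w + Q)T ≤ QX + (Q - 1)T for their total T.
    total≤ : ∀ e → w+1 * total e ≤ Q * (old (end₁ e) + old (end₂ e))
    total≤ e = ≤-respˡ (sym (w+1-* T)) (+-cancelʳ-≤ (Q * T - T) (≤-resp
      (trans (sym (*-distribˡ-sum (w + Q) (new e))) (solve 3 (λ w Q T → (w :+ Q) :* T := (w :* T :+ T) :+ (Q :* T :- T)) refl w Q T))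
      (trans (∑-distrib-+ {q} (λ _ → X) (λ l → T - new e l)) (trans (+-cong (sum-const q X) (trans (sum-- {q} (λ _ → T) (new e)) (+-congʳ (sum-const q T)))) refl))
      (sum-mono λ l → ≤-respʳ (N-new e l) ([w+Q]y≤N (to vertices (inj₂ (e , l)))))))
      where
      T X : Carrier
      T = total e
      X = old (end₁ e) + old (end₂ e)

    star : ∀ v → (t * w + Q) * old v ≤ sum (λ e → flow e v)
    star v = ≤-respˡ (sym (B≈ (old v))) (≤-trans
      (*-monoˡ-≤ 0≤w+1 (≤-respʳ (N-old v) ([w+Q]y≤N (to vertices (inj₁ v)))))
      (≤-respˡ (sym (*-distribˡ-sum w+1 (λ e → at-ends v e (old (end₂ e) + total e) (old (end₁ e) + total e)))) (sum-mono λ e → ≤-respˡ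
        (sym (trans (distribˡ w+1 _ _) (+-cong (*-when (does (v ≟ end₁ e)) w+1 (old (end₂ e) + total e)) (*-when (does (v ≟ end₂ e)) w+1 (old (end₁ e) + total e)))))
        (+-mono-≤ (when-≡ (v ≟ end₁ e) λ { ≡.refl → bound (old (end₂ e)) (≤-respʳ (*-congˡ (+-comm _ _)) (total≤ e)) })
                  (when-≡ (v ≟ end₂ e) λ { ≡.refl → bound (old (end₁ e)) (total≤ e) })))))
      where
      bound : ∀ {T a} b → w+1 * T ≤ Q * (b + a) → w+1 * (b + T) ≤ t * b + Q * a
      bound {T} {a} b le = ≤-resp (sym (distribˡ w+1 b T))
        (solve 4 (λ w+1 Q a b → w+1 :* b :+ Q :* (b :+ a) := (w+1 :+ Q) :* b :+ Q :* a) refl w+1 Q a b) (+-monoʳ-≤ (w+1 * b) le)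

    -- By `total≤`, ends with values at most zero force the total of the nonnegative new values, and
    -- with it each of them, to be at most zero.
    old-nonzero : ¬ (∀ i → y i ≤ 0#) → ¬ (∀ v → old v ≤ 0#)
    old-nonzero y≰0 old≤0 = y≰0 λ i → ≡.subst (λ j → y j ≤ 0#) (strictlyInverseˡ vertices i) (all (from vertices i))
      where
      new≤0 : ∀ e l → new e l ≤ 0#
      new≤0 e l = ≤-trans (term≤sum (λ l → 0≤y (to vertices (inj₂ (e , l)))) l) (≤0-cancelˡ 0<w+1 (≤-trans (total≤ e)
        (≤-respʳ (*-zeroʳ Q) (*-monoˡ-≤ 0≤Q (≤-respʳ (+-identityʳ 0#) (+-mono-≤ (old≤0 (end₁ e)) (old≤0 (end₂ e))))))))
      all : ∀ x → y (to vertices x) ≤ 0#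
      all (inj₁ v)       = old≤0 v
      all (inj₂ (e , l)) = new≤0 e l

  module Eigenvector (z : Fin n → Carrier) where

    open GraphForm R Γ t Q 0<t 0≤Q z using (flow)

    -- All values are scaled by w + 1, which avoids the division at the new vertices.
    value : Fin n ⊎ Fin s × Fin q → Carrier
    value (inj₁ v)       = w+1 * z v
    value (inj₂ (e , _)) = z (end₁ e) + z (end₂ e)

    lifted : Fin (order H) → Carrier
    lifted i = value (from vertices i)

    open Collapse R P lifted

    private
      lifted-to : ∀ x → lifted (to vertices x) ≈ value x
      lifted-to x = reflexive (≡.cong value (strictlyInverseʳ vertices x))

      total≈ : ∀ e → total e ≈ Q * (z (end₁ e) + z (end₂ e))
      total≈ e = trans (sum-cong λ l → lifted-to (inj₂ (e , l))) (sum-const q (z (end₁ e) + z (end₂ e)))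

      when-≈ : ∀ {A : Set} (d : Dec A) {a b} → (A → a ≈ b) → when (does d) a ≈ when (does d) b
      when-≈ (yes p) a≈b = a≈b p
      when-≈ (no _)  a≈b = refl

    eigen : (∀ v → (t * w + Q) * z v ≈ sum (λ e → flow e v)) → ∀ i → N i ≈ (w + Q) * lifted i
    eigen eq i = ≡.subst (λ j → N j ≈ (w + Q) * lifted j) (strictlyInverseˡ vertices i) (case (from vertices i))
      where
      case : ∀ x → N (to vertices x) ≈ (w + Q) * lifted (to vertices x)
      case (inj₁ v) = trans (N-old v) (trans (sum-cong λ e → +-cong
          (when-≈ (v ≟ end₁ e) λ { ≡.refl → trans (+-cong (lifted-to (inj₁ (end₂ e))) (total≈ e))
            (solve 4 (λ w+1 Q a b → w+1 :* b :+ Q :* (a :+ b) := (w+1 :+ Q) :* b :+ Q :* a) refl w+1 Q (z (end₁ e)) (z (end₂ e))) })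
          (when-≈ (v ≟ end₂ e) λ { ≡.refl → trans (+-cong (lifted-to (inj₁ (end₁ e))) (total≈ e))
            (solve 4 (λ w+1 Q a b → w+1 :* a :+ Q :* (a :+ b) := (w+1 :+ Q) :* a :+ Q :* b) refl w+1 Q (z (end₁ e)) (z (end₂ e))) }))
        (trans (sym (eq v)) (trans (B≈ (z v)) (trans (solve 3 (λ w+1 r z → w+1 :* (r :* z) := r :* (w+1 :* z)) refl w+1 (w + Q) (z v))
          (*-congˡ (sym (lifted-to (inj₁ v))))))))
      case (inj₂ (e , l)) = trans (N-new e l) (trans
        (+-cong (+-cong (trans (lifted-to (inj₁ (end₁ e))) (w+1-* a)) (trans (lifted-to (inj₁ (end₂ e))) (w+1-* b)))
          (+-cong (total≈ e) (-‿cong (lifted-to (inj₂ (e , l))))))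
        (trans (solve 4 (λ w Q a b → ((w :* a :+ a) :+ (w :* b :+ b)) :+ (Q :* (a :+ b) :- (a :+ b)) := (w :+ Q) :* (a :+ b)) refl w Q a b)
          (*-congˡ (sym (lifted-to (inj₂ (e , l)))))))
        where
        a b : Carrier
        a = z (end₁ e)
        b = z (end₂ e)

-- The eigenvector of the extremal hypergraph

module AttachedFlow (R : OrderedRing) (t Q B : OrderedRing.Carrier R)
  (0<t : OrderedRingProperties._<_ R (OrderedRing.0# R) t) (0≤Q : OrderedRing._≤_ R (OrderedRing.0# R) Q) where

  open OrderedRingProperties R
  open Sums R

  flows : ∀ {n s} (Γ : Graph n s) → (Fin n → Carrier) → Fin n → Carrier
  flows Γ z v = sum (λ e → GraphForm.flow R Γ t Q 0<t 0≤Q z e v)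

  -- What the vertex v still receives from the leaves to be attached.
  pending : ∀ {n k} → (Fin n → Carrier) → (Fin k → Carrier) → (Fin k → Fin n) → List (Fin k) → Fin n → Carrier
  pending z leaf ι []       v = 0#
  pending z leaf ι (u ∷ us) v = when (does (v ≟ ι u)) (t * leaf u + Q * z v) + pending z leaf ι us v

  attached-values : ∀ {n k} → (Fin n → Carrier) → (Fin k → Carrier) → ∀ (us : List (Fin k)) → Fin (grow us n) → Carrier
  attached-values z leaf []       = z
  attached-values z leaf (u ∷ us) = attached-values (cons (leaf u) z) leaf us

  private
    pending-suc : ∀ {n k} (z : Fin n → Carrier) leaf (ι : Fin k → Fin n) x us v →
      pending (cons x z) leaf (suc ∘ ι) us (suc v) ≡ pending z leaf ι us v
    pending-suc z leaf ι x []       v = ≡.refl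
    pending-suc z leaf ι x (u ∷ us) v = ≡.cong (λ y → when (does (v ≟ ι u)) (t * leaf u + Q * z v) + y) (pending-suc z leaf ι x us v)

    pending-zero : ∀ {n k} (z : Fin n → Carrier) leaf (ι : Fin k → Fin n) x us → pending (cons x z) leaf (suc ∘ ι) us zero ≈ 0#
    pending-zero z leaf ι x []       = refl
    pending-zero z leaf ι x (u ∷ us) = trans (+-identityˡ _) (pending-zero z leaf ι x us)

  -- Each attachment moves one term from `pending` into `flows`, so the balance at the old vertices
  -- is invariant, and at the end nothing is pending.
  attached-eigen : ∀ {n s k} (Γ : Graph n s) (z : Fin n → Carrier) (leaf : Fin k → Carrier) (ι : Fin k → Fin n) us →
    All (λ u → B * leaf u ≈ t * z (ι u) + Q * leaf u) us →
    (∀ v → B * z v ≈ flows Γ z v + pending z leaf ι us v) →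
    ∀ v → B * attached-values z leaf us v ≈ flows (attach-all Γ ι us) (attached-values z leaf us) v
  attached-eigen Γ z leaf ι [] _ eq v = trans (eq v) (+-identityʳ _)
  attached-eigen {s = s} Γ z leaf ι (u ∷ us) (eqᵤ ∷ eqs) eq =
    attached-eigen (attach Γ (ι u)) (cons (leaf u) z) leaf (suc ∘ ι) us eqs λ where
      zero    → trans eqᵤ (sym (trans (+-cong (trans (+-cong (+-identityʳ _) (sum-zero {s} {λ _ → 0# + 0#} λ e → +-identityˡ 0#)) (+-identityʳ _))
                  (pending-zero z leaf ι (leaf u) us)) (+-identityʳ _)))
      (suc v) → trans (eq v) (trans
        (solve 3 (λ f a p → f :+ (a :+ p) := (a :+ f) :+ p) refl (flows Γ z v) (when (does (v ≟ ι u)) (t * leaf u + Q * z v)) (pending z leaf ι us v))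
        (+-cong (+-congʳ (sym (+-identityˡ _))) (reflexive (≡.sym (pending-suc z leaf ι (leaf u) us v)))))

  pending-replicate : ∀ {n k} (z : Fin n → Carrier) leaf (ι : Fin k → Fin n) ℓ u us v →
    pending z leaf ι (replicate ℓ u ++ˡ us) v ≈ fromℕ ℓ * when (does (v ≟ ι u)) (t * leaf u + Q * z v) + pending z leaf ι us v
  pending-replicate z leaf ι ℓ u us v = trans (sums ℓ) (+-congʳ (sum-const ℓ _))
    where
    sums : ∀ ℓ → pending z leaf ι (replicate ℓ u ++ˡ us) v ≈
      sum {ℓ} (λ _ → when (does (v ≟ ι u)) (t * leaf u + Q * z v)) + pending z leaf ι us v
    sums zero    = sym (+-identityˡ _)
    sums (suc ℓ) = trans (+-congˡ (sums ℓ)) (sym (+-assoc _ _ _))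

module ExtremalEigenvector (R : OrderedRing) (q ℓ : ℕ) (root : CharacteristicRoot R q ℓ) where

  open OrderedRingProperties R
  open Sums R
  open CharacteristicRoot root using (w)
  open ExtremalForm R q ℓ root
  open Characteristic R q ℓ using (Q; L; 0≤Q)
  open AttachedFlow R t Q B 0<t 0≤Q

  private
    -- A solution of E₂h = Gc, κa = t(h + c), wp = h and wu = c with denominators cleared: h and c
    -- are wκ times G and E₂.
    h c a p u : Carrier
    h = w * (κ * G)
    c = w * (κ * E₂)
    a = t * (w * (G + E₂))
    p = κ * G
    u = κ * E₂

    κa≈ : κ * a ≈ t * (h + c)
    κa≈ = solve 5 (λ w t κ G E₂ → κ :* (t :* (w :* (G :+ E₂))) := t :* (w :* (κ :* G) :+ w :* (κ :* E₂))) refl w t κ G E₂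

    open Relations h c a a u (λ _ → p)
      (solve 4 (λ w κ G E₂ → E₂ :* (w :* (κ :* G)) := G :* (w :* (κ :* E₂))) refl w κ G E₂) κa≈ κa≈ refl (λ _ → refl)

    z : Fin 4 → Carrier
    z = four h a c a

    leaf : Fin 4 → Carrier
    leaf = four p p u p

    leaf-eq : ∀ x → B * x ≈ t * (w * x) + Q * x
    leaf-eq x = solve 4 (λ w t Q x → (t :* w :+ Q) :* x := t :* (w :* x) :+ Q :* x) refl w t Q x

    leaves : All (λ k → B * leaf k ≈ t * z k + Q * leaf k) (T₁C-vertices ℓ 0 1 0)
    leaves = ++⁺ (replicate⁺ ℓ (leaf-eq p)) (leaf-eq u ∷ [])

    drop-zero : ∀ {x o} → o ≈ 0# → x + o ≈ x
    drop-zero o≈0 = trans (+-congˡ o≈0) (+-identityʳ _)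

    at : Carrier → Carrier → Carrier
    at x y = t * x + Q * y

    two-eq : ∀ x → κ * x ≈ t * (h + c) → B * x ≈ at h x + at c x
    two-eq x eq = trans (solve 4 (λ w t Q x → (t :* w :+ Q) :* x := (t :* w :- Q) :* x :+ (Q :* x :+ Q :* x)) refl w t Q x)
      (trans (+-congʳ eq) (solve 5 (λ t Q h c x → t :* (h :+ c) :+ (Q :* x :+ Q :* x) := (t :* h :+ Q :* x) :+ (t :* c :+ Q :* x)) refl t Q h c x))

    centre : B * c ≈ at a c + at h c + at a c + at u c
    centre = trans (solve 4 (λ w t Q c → (t :* w :+ Q) :* c := (t :* w :- (Q :+ Q :+ Q)) :* c :+ con (+ 4) :* (Q :* c)) refl w t Q c)
      (trans (+-congʳ centre-eq) (solve 6 (λ t Q h c a u → t :* (h :+ (a :+ a :+ u)) :+ con (+ 4) :* (Q :* c) :=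
        (t :* a :+ Q :* c) :+ (t :* h :+ Q :* c) :+ (t :* a :+ Q :* c) :+ (t :* u :+ Q :* c)) refl t Q h c a u))

    -- The neutral element enters the solver as a variable `o`; its ten or twelve copies are
    -- discarded by `drop-zero`.
    flows-eq : ∀ v → B * z v ≈ flows Γ◇ z v + pending z leaf id (T₁C-vertices ℓ 0 1 0) v
    flows-eq 0F = trans hub-eq (trans (+-congˡ (+-congˡ (+-congˡ (sum-const ℓ (at p h))))) (sym (trans
      (+-congˡ (pending-replicate z leaf id ℓ 0F (2F ∷ []) 0F))
      (trans (solve 5 (λ x y z l o →
          ((x :+ o) :+ ((o :+ o) :+ ((y :+ o) :+ ((o :+ o) :+ ((z :+ o) :+ o))))) :+ (l :+ (o :+ o)) :=
          (y :+ (x :+ (z :+ l))) :+ con (+ 10) :* o) refl (at a h) (at c h) (at a h) (L * at p h) 0#)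
        (drop-zero (*-zeroʳ _))))))
    flows-eq 1F = trans (two-eq a κa≈) (sym (trans
      (+-congˡ (trans (pending-replicate z leaf id ℓ 0F (2F ∷ []) 1F) (+-congʳ (*-zeroʳ L))))
      (trans (solve 3 (λ x y o →
          ((o :+ x) :+ ((y :+ o) :+ ((o :+ o) :+ ((o :+ o) :+ ((o :+ o) :+ o))))) :+ (o :+ (o :+ o)) :=
          (x :+ y) :+ con (+ 12) :* o) refl (at h a) (at c a) 0#)
        (drop-zero (*-zeroʳ _)))))
    flows-eq 2F = trans centre (sym (trans
      (+-congˡ (trans (pending-replicate z leaf id ℓ 0F (2F ∷ []) 2F) (+-congʳ (*-zeroʳ L))))
      (trans (solve 5 (λ x y z l o →
          ((o :+ o) :+ ((o :+ x) :+ ((o :+ y) :+ ((z :+ o) :+ ((o :+ o) :+ o))))) :+ (o :+ (l :+ o)) :=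
          (x :+ y :+ z :+ l) :+ con (+ 10) :* o) refl (at a c) (at h c) (at a c) (at u c) 0#)
        (drop-zero (*-zeroʳ _)))))
    flows-eq 3F = trans (two-eq a κa≈) (sym (trans
      (+-congˡ (trans (pending-replicate z leaf id ℓ 0F (2F ∷ []) 3F) (+-congʳ (*-zeroʳ L))))
      (trans (solve 3 (λ x y o →
          ((o :+ o) :+ ((o :+ o) :+ ((o :+ o) :+ ((o :+ y) :+ ((o :+ x) :+ o))))) :+ (o :+ (o :+ o)) :=
          (x :+ y) :+ con (+ 12) :* o) refl (at h a) (at c a) 0#)
        (drop-zero (*-zeroʳ _)))))

  eigenvector : Fin (grow (T₁C-vertices ℓ 0 1 0) 4) → Carrier
  eigenvector = attached-values z leaf (T₁C-vertices ℓ 0 1 0)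

  eigenvector-eq : ∀ v → B * eigenvector v ≈ flows (T₁C-graph ℓ 0 1 0) eigenvector v
  eigenvector-eq = attached-eigen Γ◇ z leaf id (T₁C-vertices ℓ 0 1 0) leaves flows-eq

  eigenvector-nonzero : ∃[ v ] 0# < eigenvector v
  eigenvector-nonzero = old-value (T₁C-vertices ℓ 0 1 0) z 0F (*-positive 0<w (*-positive 0<κ 0<G))
    where
    old-value : ∀ {n} us (z : Fin n → Carrier) v → 0# < z v → ∃[ i ] 0# < attached-values z leaf us i
    old-value []       z v 0<z = v , 0<z
    old-value (u ∷ us) z v 0<z = old-value us (cons (leaf u) z) (suc v) 0<z

-- The eigenvalue equation of the complex number α + βi, with eigenvector a + bi, for the matrix ι A.
module SymmetricSpectrum (R : OrderedRing) where

  open OrderedRingProperties R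
  open Sums R

  _·_ : ∀ {n} → (Fin n → Fin n → Bool) → (Fin n → Carrier) → Fin n → Carrier
  (A · x) i = sum (λ j → when (A i j) (x j))

  record EigenPair {n} (A : Fin n → Fin n → Bool) (ι α β : Carrier) (a b : Fin n → Carrier) : Set where
    field
      nonzero : ¬ (∀ i → (a i ≈ 0#) × (b i ≈ 0#))
      re-eq   : ∀ i → sum (λ j → when (A i j) ι * a j - 0# * b j) ≈ α * a i - β * b i
      im-eq   : ∀ i → sum (λ j → when (A i j) ι * b j + 0# * a j) ≈ α * b i + β * a i

  when-* : ∀ b ι x → when b ι * x ≈ ι * when b x
  when-* false ι x = trans (*-zeroˡ x) (sym (*-zeroʳ ι))
  when-* true  ι x = refl

  module _ {n} (A : Fin n → Fin n → Bool) (ι : Carrier) where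

    re-row : ∀ (a b : Fin n → Carrier) i → sum (λ j → when (A i j) ι * a j - 0# * b j) ≈ ι * (A · a) i
    re-row a b i = trans (sum-cong λ j → trans (+-cong (when-* (A i j) ι (a j)) (-‿cong (*-zeroˡ (b j)))) (x-0 _))
      (sym (*-distribˡ-sum ι (λ j → when (A i j) (a j))))
      where
      x-0 : ∀ x → x - 0# ≈ x
      x-0 x = trans (+-congˡ (trans (sym (+-identityˡ (- 0#))) (-‿inverseʳ 0#))) (+-identityʳ x)

    im-row : ∀ (a b : Fin n → Carrier) i → sum (λ j → when (A i j) ι * b j + 0# * a j) ≈ ι * (A · b) i
    im-row a b i = trans (sum-cong λ j → trans (+-cong (when-* (A i j) ι (b j)) (*-zeroˡ (a j))) (+-identityʳ _))
      (sym (*-distribˡ-sum ι (λ j → when (A i j) (b j))))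

    real-eigenpair : ∀ r z → ∃[ v ] 0# < z v → (∀ i → (A · z) i ≈ r * z i) → EigenPair A ι (ι * r) 0# z (λ _ → 0#)
    real-eigenpair r z (v , 0<zᵥ) eq = record
      { nonzero = λ zero → 0<zᵥ (≤-reflexive (proj₁ (zero v)))
      ; re-eq   = λ i → trans (re-row z (λ _ → 0#) i) (trans (*-congˡ (eq i))
          (trans (sym (*-assoc ι r (z i))) (sym (trans (+-congˡ (trans (-‿cong (*-zeroˡ 0#)) (trans (sym (+-identityˡ (- 0#))) (-‿inverseʳ 0#)))) (+-identityʳ _)))))
      ; im-eq   = λ i → trans (im-row z (λ _ → 0#) i) (trans (*-congˡ (sum-zero {n} {λ j → when (A i j) 0#} λ j → when-zero (A i j)))
          (trans (*-zeroʳ ι) (sym (trans (+-cong (*-zeroʳ (ι * r)) (*-zeroˡ (z i))) (+-identityˡ 0#)))))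
      }
      where
      when-zero : ∀ b → when b 0# ≈ 0#
      when-zero false = refl
      when-zero true  = refl

  square-≤ : ∀ {x y} → 0# ≤ y → x * x ≤ y * y → x ≤ y
  square-≤ {x} {y} 0≤y xx≤yy = ≤-stable λ y<x → *-positive (0<y-x y<x) (+-pos-nonneg (≤-<-trans 0≤y y<x) 0≤y)
    (≤-respˡ (solve 2 (λ x y → x :* x :- y :* y := (x :- y) :* (x :+ y)) refl x y) (x≤y⇒x-y≤0 xx≤yy))

  module _ {n} (A : Fin n → Fin n → Bool) (A-sym : ∀ i j → A i j ≡ A j i) where

    ·-symmetric : ∀ a b → sum (λ i → b i * (A · a) i) ≈ sum (λ i → a i * (A · b) i)
    ·-symmetric a b = trans (sum-cong λ i → trans (*-distribˡ-sum (b i) (λ j → when (A i j) (a j))) (sum-cong λ j → *-when (A i j) (b i) (a j)))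
      (trans (∑-comm (λ i j → when (A i j) (b i * a j)))
      (sym (sum-cong λ i → trans (*-distribˡ-sum (a i) (λ j → when (A i j) (b j))) (sum-cong λ j → trans (*-when (A i j) (a i) (b j))
        (trans (when-cong (A i j) (*-comm (a i) (b j))) (reflexive (≡.cong (λ c → when c (b j * a i)) (A-sym i j))))))))

    -- By symmetry the sum of aᵢ(Ab)ᵢ - bᵢ(Aa)ᵢ vanishes, and the two equations turn it into β times
    -- the squared norm.
    imaginary-part-zero : ∀ {a b α β} → ¬ (∀ i → (a i ≈ 0#) × (b i ≈ 0#)) →
      (∀ i → (A · a) i ≈ α * a i - β * b i) → (∀ i → (A · b) i ≈ α * b i + β * a i) → β ≈ 0#
    imaginary-part-zero {a} {b} {α} {β} nonzero re-part im-part = ≈-stable λ β≉0 → nonzero λ i →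
      let norm≤0 = ≤0-cancelˡ (λ ββ≤0 → β≉0 (x*x≤0⇒x≈0 ββ≤0)) (≤-reflexive ββ*norm≈0)
          zeros = sum≤0⇒≈0 (λ i → +-nonneg (square-nonneg (a i)) (square-nonneg (b i))) norm≤0
      in x*x≤0⇒x≈0 (+≤0⇒≤0ˡ (square-nonneg (b i)) (≤-reflexive (zeros i))) ,
         x*x≤0⇒x≈0 (+≤0⇒≤0ʳ (square-nonneg (a i)) (≤-reflexive (zeros i)))
      where
      norm : Carrier
      norm = sum (λ i → a i * a i + b i * b i)
      β*norm≈0 : β * norm ≈ 0#
      β*norm≈0 = trans (*-distribˡ-sum β (λ i → a i * a i + b i * b i)) (trans (sum-cong λ i →
          trans (solve 4 (λ α β a b → β :* (a :* a :+ b :* b) := a :* (α :* b :+ β :* a) :- b :* (α :* a :- β :* b)) refl α β (a i) (b i))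
            (+-cong (*-congˡ (sym (im-part i))) (-‿cong (*-congˡ (sym (re-part i))))))
        (trans (sum-- (λ i → a i * (A · b) i) (λ i → b i * (A · a) i))
          (trans (+-congˡ (-‿cong (·-symmetric a b))) (-‿inverseʳ _))))
      ββ*norm≈0 : (β * β) * norm ≈ 0#
      ββ*norm≈0 = trans (*-assoc β β norm) (trans (*-congˡ β*norm≈0) (*-zeroʳ β))

    private
      signed : ∀ x → ¬ ¬ (∃[ y ] 0# ≤ y × (y ≈ x ⊎ y ≈ - x))
      signed x k = ≤-total 0# x λ where
        (inj₁ 0≤x) → k (x , 0≤x , inj₁ refl)
        (inj₂ x≤0) → k (- x , 0≤-x x≤0 , inj₂ refl)

      -‿≤ : ∀ {x} → 0# ≤ x → - x ≤ x
      -‿≤ {x} 0≤x = ≤-by (+-nonneg 0≤x 0≤x) (solve 1 (λ x → x := :- x :+ (x :+ x)) refl x)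

      bounds : ∀ {x y} → 0# ≤ y → y ≈ x ⊎ y ≈ - x → (x ≤ y) × (- x ≤ y)
      bounds 0≤y (inj₁ y≈x)  = ≤-reflexive (sym y≈x) , ≤-respˡ (-‿cong y≈x) (-‿≤ 0≤y)
      bounds {x} 0≤y (inj₂ y≈-x) = ≤-respˡ (trans (-‿cong y≈-x) (solve 1 (λ x → :- :- x := x) refl x)) (-‿≤ 0≤y) , ≤-reflexive (sym y≈-x)

      ·-mono : ∀ {x y} → (∀ i → x i ≤ y i) → ∀ i → (A · x) i ≤ (A · y) i
      ·-mono x≤y i = sum-mono λ j → case (A i j) (x≤y j)
        where
        case : ∀ b {x y} → x ≤ y → when b x ≤ when b y
        case false _   = ≤-refl
        case true  x≤y = x≤y

      ·-neg : ∀ x i → (A · (λ j → - x j)) i ≈ - (A · x) i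
      ·-neg x i = trans (sum-cong λ j → case (A i j)) (trans (sum-- (λ _ → 0#) (λ j → when (A i j) (x j)))
        (trans (+-congʳ (sum-zero {n} {λ _ → 0#} λ _ → refl)) (+-identityˡ _)))
        where
        case : ∀ b {x} → when b (- x) ≈ 0# - when b x
        case false = sym (-‿inverseʳ 0#)
        case true  = sym (+-identityˡ _)

      -- Entrywise |α||aᵢ| = |(Aa)ᵢ| ≤ (A|a|)ᵢ, as A has nonnegative entries. The signs of the
      -- entries, and that of r relative to α, can be chosen only under double negation.
      real-subsolution : ∀ {a α r} → ¬ (∀ i → a i ≈ 0#) → (∀ i → (A · a) i ≈ α * a i) → r * r ≈ α * α →
        ¬ ¬ (∃[ y ] (∀ i → 0# ≤ y i) × ¬ (∀ i → y i ≤ 0#) × (∀ i → r * y i ≤ (A · y) i))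
      real-subsolution {a} {α} {r} nonzero eq rr≈αα k = Fin-¬¬-choice (λ i → signed (a i)) λ ys →
        let y   = λ i → proj₁ (ys i)
            0≤y = λ i → proj₁ (proj₂ (ys i))
            y≈± = λ i → proj₂ (proj₂ (ys i))
            ≤y  = λ i → proj₁ (bounds (0≤y i) (y≈± i))
            -≤y = λ i → proj₂ (bounds (0≤y i) (y≈± i))
            M≤  = λ i → ·-mono ≤y i
            -M≤ = λ i → ≤-respˡ (·-neg a i) (·-mono -≤y i)
        in k (y , 0≤y ,
          (λ y≤0 → nonzero λ i → ≤-antisym (≤-trans (≤y i) (y≤0 i))
            (≤-resp (trans (-‿cong (sym (+-identityˡ 0#))) (neg0)) (solve 1 (λ x → :- :- x := x) refl (a i)) (-‿antimono (≤-trans (-≤y i) (y≤0 i))))) ,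
          λ i → ≤-stable λ ¬le → ±r λ sign → ¬le (bound sign (y≈± i) (M≤ i) (-M≤ i) (eq i)))
        where
        neg0 : - (0# + 0#) ≈ 0#
        neg0 = trans (-‿cong (+-identityˡ 0#)) (trans (sym (+-identityˡ (- 0#))) (-‿inverseʳ 0#))
        -‿antimono : ∀ {x y} → x ≤ y → - y ≤ - x
        -‿antimono {x} {y} x≤y = ≤-by (0≤y-x x≤y) (solve 2 (λ x y → :- x := :- y :+ (y :- x)) refl x y)
        -- If both alternatives failed, (r - α)²(r + α)² = (r² - α²)² would be positive.
        ±r : ¬ ¬ (r ≈ α ⊎ r ≈ - α)
        ±r k = k (inj₁ (≈-stable λ r≉α → k (inj₂ (≈-stable λ r≉-α →
          *-positive (λ le → r≉α (x-y≈0⇒x≈y (x*x≤0⇒x≈0 le))) (λ le → r≉-α (x-y≈0⇒x≈y (x*x≤0⇒x≈0 le)))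
            (≤-reflexive (trans (solve 2 (λ r α → ((r :- α) :* (r :- α)) :* ((r :- :- α) :* (r :- :- α)) := (r :* r :- α :* α) :* (r :* r :- α :* α)) refl r α)
              (trans (*-congʳ (trans (+-congʳ rr≈αα) (-‿inverseʳ (α * α)))) (*-zeroˡ _))))))))
        bound : ∀ {x y M My} → r ≈ α ⊎ r ≈ - α → y ≈ x ⊎ y ≈ - x → M ≤ My → - M ≤ My → M ≈ α * x → r * y ≤ My
        bound {x} (inj₁ r≈) (inj₁ y≈) M≤ -M≤ eq = ≤-respˡ (trans eq (sym (*-cong r≈ y≈))) M≤
        bound {x} (inj₁ r≈) (inj₂ y≈) M≤ -M≤ eq = ≤-respˡ (trans (-‿cong eq) (sym (trans (*-cong r≈ y≈) (sym (-‿distribʳ-* α x))))) -M≤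
        bound {x} (inj₂ r≈) (inj₁ y≈) M≤ -M≤ eq = ≤-respˡ (trans (-‿cong eq) (sym (trans (*-cong r≈ y≈) (sym (-‿distribˡ-* α x))))) -M≤
        bound {x} (inj₂ r≈) (inj₂ y≈) M≤ -M≤ eq = ≤-respˡ (trans eq (sym (trans (*-cong r≈ y≈) (solve 2 (λ α x → :- α :* :- x := α :* x) refl α x)))) M≤

    -- The eigenvalue is real, so the real or the imaginary part of an eigenvector is an eigenvector as well; take absolute values.
    subsolution : ∀ {ι M α β a b ρ} → M * ι ≈ 1# → EigenPair A ι α β a b → α * α + β * β ≈ ρ * ρ →
      ¬ ¬ (∃[ y ] (∀ i → 0# ≤ y i) × ¬ (∀ i → y i ≤ 0#) × (∀ i → (M * ρ) * y i ≤ (A · y) i))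
    subsolution {ι} {M} {α} {β} {a} {b} {ρ} Mι≈1 E modulus k =
      nonzero-part λ where
        (inj₁ a≉0) → real-subsolution a≉0 re-real rr≈ k
        (inj₂ b≉0) → real-subsolution b≉0 im-real rr≈ k
      where
      open EigenPair E
      unscale : ∀ {x y} → ι * x ≈ y → x ≈ M * y
      unscale {x} {y} eq = trans (sym (trans (trans (sym (*-assoc M ι x)) (*-congʳ Mι≈1)) (*-identityˡ x))) (*-congˡ eq)
      re-part : ∀ i → (A · a) i ≈ (M * α) * a i - (M * β) * b i
      re-part i = trans (unscale (trans (sym (re-row A ι a b i)) (re-eq i)))
        (solve 5 (λ M α β a b → M :* (α :* a :- β :* b) := (M :* α) :* a :- (M :* β) :* b) refl M α β (a i) (b i))
      im-part : ∀ i → (A · b) i ≈ (M * α) * b i + (M * β) * a i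
      im-part i = trans (unscale (trans (sym (im-row A ι a b i)) (im-eq i)))
        (solve 5 (λ M α β a b → M :* (α :* b :+ β :* a) := (M :* α) :* b :+ (M :* β) :* a) refl M α β (a i) (b i))
      Mβ≈0 : M * β ≈ 0#
      Mβ≈0 = imaginary-part-zero nonzero re-part im-part
      re-real : ∀ i → (A · a) i ≈ (M * α) * a i
      re-real i = trans (re-part i) (trans (+-congˡ (-‿cong (trans (*-congʳ Mβ≈0) (*-zeroˡ (b i)))))
        (trans (+-congˡ (trans (sym (+-identityˡ (- 0#))) (-‿inverseʳ 0#))) (+-identityʳ _)))
      im-real : ∀ i → (A · b) i ≈ (M * α) * b i
      im-real i = trans (im-part i) (trans (+-congˡ (trans (*-congʳ Mβ≈0) (*-zeroˡ (a i)))) (+-identityʳ _))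
      rr≈ : (M * ρ) * (M * ρ) ≈ (M * α) * (M * α)
      rr≈ = trans (solve 2 (λ M ρ → (M :* ρ) :* (M :* ρ) := (M :* M) :* (ρ :* ρ)) refl M ρ)
        (trans (*-congˡ (sym modulus)) (trans (solve 3 (λ M α β → (M :* M) :* (α :* α :+ β :* β) := (M :* α) :* (M :* α) :+ (M :* β) :* (M :* β)) refl M α β)
          (trans (+-congˡ (trans (*-congʳ Mβ≈0) (*-zeroˡ (M * β)))) (+-identityʳ _))))
      nonzero-part : ¬ ¬ (¬ (∀ i → a i ≈ 0#) ⊎ ¬ (∀ i → b i ≈ 0#))
      nonzero-part k = k (inj₁ λ a≈0 → k (inj₂ λ b≈0 → nonzero λ i → a≈0 i , b≈0 i))

  adjacency : (H : Hypergraph) → Fin (order H) → Fin (order H) → Bool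
  adjacency H i j = does (adjacent? H i j)

  adjacency-sym : ∀ H i j → adjacency H i j ≡ adjacency H j i
  adjacency-sym H i j = does-⇔ (mk⇔ swap swap) (adjacent? H i j) (adjacent? H j i)
    where
    swap : ∀ {i j} → Adjacent H i j → Adjacent H j i
    swap (i≢j , e , i∈e , j∈e) = i≢j ∘ ≡.sym , e , j∈e , i∈e

  -- Serves the case in which H is the extremal hypergraph: an eigenvalue of H is then bounded by ρ′
  -- as an eigenvalue of T₁C(k-6,0,1,0).
  ≅-eigenpair : ∀ {H K ι α β a b} (iso : H ≅ K) → EigenPair (adjacency H) ι α β a b →
    EigenPair (adjacency K) ι α β (a ∘ from (_≅_.onVertices iso)) (b ∘ from (_≅_.onVertices iso))
  ≅-eigenpair {H} {K} {ι} {α} {β} {a} {b} iso E = record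
    { nonzero = λ zero → nonzero λ i → ≡.subst (λ j → (a j ≈ 0#) × (b j ≈ 0#)) (strictlyInverseʳ onVertices i) (zero (to onVertices i))
    ; re-eq   = λ i → trans (re-row (adjacency K) ι (a ∘ from onVertices) (b ∘ from onVertices) i) (trans (*-congˡ (row a i))
        (trans (sym (re-row (adjacency H) ι a b (from onVertices i))) (re-eq (from onVertices i))))
    ; im-eq   = λ i → trans (im-row (adjacency K) ι (a ∘ from onVertices) (b ∘ from onVertices) i) (trans (*-congˡ (row b i))
        (trans (sym (im-row (adjacency H) ι a b (from onVertices i))) (im-eq (from onVertices i))))
    }
    where
    open _≅_ iso
    open EigenPair E
    same : ∀ i j → adjacency K i (to onVertices j) ≡ adjacency H (from onVertices i) j
    same i j = does-⇔ (mk⇔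
      (λ (i≢ , e , i∈ , j∈) → (λ eq → i≢ (≡.trans (≡.sym (strictlyInverseˡ onVertices i)) (≡.cong (to onVertices) eq))) , from onEdges e ,
        back (≡.subst (_∈ edge K e) (≡.sym (strictlyInverseˡ onVertices i)) i∈) , back j∈)
      (λ (i≢ , e , i∈ , j∈) → (λ eq → i≢ (≡.trans (≡.cong (from onVertices) eq) (strictlyInverseʳ onVertices j))) , to onEdges e ,
        ≡.subst (_∈ edge K (to onEdges e)) (strictlyInverseˡ onVertices i) (to⇔ (incidence (from onVertices i) e) i∈) , to⇔ (incidence j e) j∈))
      (adjacent? K i (to onVertices j)) (adjacent? H (from onVertices i) j)
      where
      back : ∀ {v e} → to onVertices v ∈ edge K e → v ∈ edge H (from onEdges e)
      back {v} {e} v∈ = from⇔ (incidence v (from onEdges e)) (≡.subst (λ f → to onVertices v ∈ edge K f) (≡.sym (strictlyInverseˡ onEdges e)) v∈)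
    row : ∀ x i → (adjacency K · (x ∘ from onVertices)) i ≈ (adjacency H · x) (from onVertices i)
    row x i = trans (sum-permute (λ j → when (adjacency K i j) (x (from onVertices j))) onVertices)
      (sum-cong λ j → reflexive (≡.cong₂ (λ c k → when c (x k)) (same i j) (strictlyInverseʳ onVertices j)))

module ExtremalSpectrum (R : OrderedRing) (q ℓ : ℕ) (root : CharacteristicRoot R q ℓ) where

  open OrderedRingProperties R
  open SymmetricSpectrum R
  open Characteristic R q ℓ using (Q; 0≤w)
  open CharacteristicRoot root
  open ExtremalEigenvector R q ℓ root
  private
    P : Presentation q (T₁C-graph ℓ 0 1 0) (T₁C (suc (suc q)) ℓ 0 1 0)
    P = T₁C-presentation q ℓ 0 1 0
  open PowerSpectrum.Eigenvector R P w (0≤w 1≤w) eigenvector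

  -- Being an eigenvalue makes ι(w + Q) a lower bound for the spectral radius of this hypergraph.
  extremal-eigenpair : ∀ ι → EigenPair (adjacency (T₁C (suc (suc q)) ℓ 0 1 0)) ι (ι * (w + Q)) 0# lifted (λ _ → 0#)
  extremal-eigenpair ι = real-eigenpair (adjacency (T₁C (suc (suc q)) ℓ 0 1 0)) ι (w + Q) lifted positive (eigen eigenvector-eq)
    where
    positive : ∃[ i ] 0# < lifted i
    positive = let v , 0<zᵥ = eigenvector-nonzero in to (Presentation.vertices P) (inj₁ v) ,
      ≡.subst (λ x → 0# < value x) (≡.sym (strictlyInverseʳ (Presentation.vertices P) (inj₁ v)))
        (*-positive (+-nonneg-pos (0≤w 1≤w) (<-respʳ (sym fromℤ-1) 0<1)) 0<zᵥ)

module SpectralComparison (R : OrderedRing) (q : ℕ) {n} (Γ : Graph n (suc n)) {H} (P : Presentation q Γ H)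
  (connected : ∀ r v → ∃[ i ] Graph.Reach Γ r i v)
  (no-universal : ∀ r → ∃[ u ] u ≢ r × ¬ Graph._∼_ Γ r u)
  (root : CharacteristicRoot R q (n ∸ 5)) where

  open OrderedRingProperties R
  open SymmetricSpectrum R
  open CharacteristicRoot root
  open Characteristic R q (n ∸ 5) using (Q; 0≤w)

  large-eigenvalue⇒extremal : ∀ {ι α β a b ρ} → fromℕ (suc q) * ι ≈ 1# → EigenPair (adjacency H) ι α β a b →
    α * α + β * β ≈ ρ * ρ → ι * (w + Q) ≤ ρ → ¬ ¬ Extremal Γ
  large-eigenvalue⇒extremal {ι} {ρ = ρ} Mι≈1 E modulus τ≤ρ ¬extremal =
    subsolution (adjacency H) (adjacency-sym H) Mι≈1 E modulus λ (y , 0≤y , y≰0 , My≤) →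
      let open PowerSpectrum.Subsolution R P w (0≤w 1≤w) y 0≤y (fromℕ (suc q) * ρ) w+Q≤Mρ My≤
      in SpectralBound.extremal R q Γ connected no-universal root old
           (λ v → 0≤y (to (Presentation.vertices P) (inj₁ v))) star (old-nonzero y≰0) ¬extremal
    where
    w+Q≤Mρ : w + Q ≤ fromℕ (suc q) * ρ
    w+Q≤Mρ = ≤-respˡ (trans (sym (*-assoc (fromℕ (suc q)) ι (w + Q))) (trans (*-congʳ Mι≈1) (*-identityˡ (w + Q))))
      (*-monoˡ-≤ (0≤fromℕ (suc q)) τ≤ρ)

-- Complex eigenvalues and the final comparison

module Modulus (R : OrderedRing) where

  open OrderedRingProperties R
  open SymmetricSpectrum R using (square-≤)

  real-modulus-≤ : ∀ x y → 0# ≤ y → x * x + 0# * 0# ≤ y * y → x ≤ y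
  real-modulus-≤ x y 0≤y le = square-≤ 0≤y (≤-respˡ (trans (+-congˡ (*-zeroˡ 0#)) (+-identityʳ _)) le)

  modulus-≤ : ∀ z x y → 0# ≤ y → z ≈ x * x → z ≤ y * y → x ≤ y
  modulus-≤ z x y 0≤y z≈xx z≤yy = square-≤ 0≤y (≤-respˡ z≈xx z≤yy)

module ℝᵒ where
  open OrderedRingProperties ℝ-ordered public
  open Sums ℝ-ordered public
  open SymmetricSpectrum ℝ-ordered public
  open Modulus ℝ-ordered public

re-∑ : ∀ {n} (f : Fin n → ℂ) (g : Fin n → ℝ) → (∀ i → re (f i) ≡ g i) → re (∑ f) ≡ ℝᵒ.sum g
re-∑ {zero}  f g eq = ≡.refl
re-∑ {suc n} f g eq = ≡.cong₂ _+ℝ_ (eq zero) (re-∑ (f ∘ suc) (g ∘ suc) (eq ∘ suc))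

im-∑ : ∀ {n} (f : Fin n → ℂ) (g : Fin n → ℝ) → (∀ i → im (f i) ≡ g i) → im (∑ f) ≡ ℝᵒ.sum g
im-∑ {zero}  f g eq = ≡.refl
im-∑ {suc n} f g eq = ≡.cong₂ _+ℝ_ (eq zero) (im-∑ (f ∘ suc) (g ∘ suc) (eq ∘ suc))

-- The entries of the adjacency matrix, for an arbitrary weight c in place of 1/(m - 1).
module WeightedAdjacency (c : ℚ) (H : Hypergraph) where

  entry : Bool → ℂ
  entry b = if b then ℚ⇒ℂ c else 0ℂ

  A : Matrix (order H)
  A i j = entry (does (adjacent? H i j))

  private
    re-term im-term : Bool → ℂ → ℝ
    re-term b x = ℝᵒ.when b (fromℚ c) *ℝ re x -ℝ 0ℝ *ℝ im x
    im-term b x = ℝᵒ.when b (fromℚ c) *ℝ im x +ℝ 0ℝ *ℝ re x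

    re-entry : ∀ b x → re (entry b *ℂ x) ≡ re-term b x
    re-entry false x = ≡.refl
    re-entry true  x = ≡.refl

    im-entry : ∀ b x → im (entry b *ℂ x) ≡ im-term b x
    im-entry false x = ≡.refl
    im-entry true  x = ≡.refl

    re-row : ∀ (x : Fin (order H) → ℂ) i → re (∑ (λ j → A i j *ℂ x j)) ≡ ℝᵒ.sum (λ j → re-term (does (adjacent? H i j)) (x j))
    re-row x i = re-∑ (λ j → A i j *ℂ x j) (λ j → re-term (does (adjacent? H i j)) (x j)) λ j → re-entry (does (adjacent? H i j)) (x j)

    im-row : ∀ (x : Fin (order H) → ℂ) i → im (∑ (λ j → A i j *ℂ x j)) ≡ ℝᵒ.sum (λ j → im-term (does (adjacent? H i j)) (x j))
    im-row x i = im-∑ (λ j → A i j *ℂ x j) (λ j → im-term (does (adjacent? H i j)) (x j)) λ j → im-entry (does (adjacent? H i j)) (x j)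

  eigenvalue⇒pair : ∀ μ → IsEigenvalue A μ → ∃[ a ] ∃[ b ] ℝᵒ.EigenPair (ℝᵒ.adjacency H) (fromℚ c) (re μ) (im μ) a b
  eigenvalue⇒pair μ (x , nonzero , eq) = re ∘ x , im ∘ x , record
    { nonzero = nonzero
    ; re-eq   = λ i → ≡.subst (_≈ℝ re (μ *ℂ x i)) (re-row x i) (proj₁ (eq i))
    ; im-eq   = λ i → ≡.subst (_≈ℝ im (μ *ℂ x i)) (im-row x i) (proj₂ (eq i))
    }

  pair⇒eigenvalue : ∀ {α β a b} → ℝᵒ.EigenPair (ℝᵒ.adjacency H) (fromℚ c) α β a b → IsEigenvalue A (α +i β)
  pair⇒eigenvalue {α} {β} {a} {b} E = x , nonzero , λ i →
    ≡.subst (_≈ℝ re ((α +i β) *ℂ x i)) (≡.sym (re-row x i)) (re-eq i) ,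
    ≡.subst (_≈ℝ im ((α +i β) *ℂ x i)) (≡.sym (im-row x i)) (im-eq i)
    where
    open ℝᵒ.EigenPair E
    x : Fin (order H) → ℂ
    x i = a i +i b i

weight : ∀ m .{{_ : NonTrivial m}} → ℚ
weight m = ℚ._/_ (+ 1) (m ∸ 1) {{m∸1-nonZero m}}

[m-1]*weight≈1 : ∀ q → ℝᵒ.fromℕ (suc q) *ℝ fromℚ (weight (suc (suc q))) ≈ℝ fromℚ 1ℚ
[m-1]*weight≈1 q = ≡⇒≈ℝ (ℝᵒ.fromℕ (suc q) *ℝ fromℚ (weight (suc (suc q)))) (fromℚ 1ℚ) λ _ → product
  where
  product : ℚᵒ.fromℕ (suc q) ℚ.* weight (suc (suc q)) ≡ 1ℚ
  product = ℚ.toℚᵘ-injective (ℚᵘ.≃-trans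
    (ℚ.toℚᵘ-homo-* (ℚᵒ.fromℕ (suc q)) (weight (suc (suc q))))
    (ℚᵘ.≃-trans (ℚᵘ.*-cong (ℚ.toℚᵘ-fromℚᵘ (mkℚᵘ (+ suc q) 0)) (ℚ.toℚᵘ-fromℚᵘ (mkℚᵘ (+ 1) q)))
      (*≡* (≡.cong +_ (≡.trans (ℕ.*-identityʳ (suc q ℕ.* 1)) (≡.trans (ℕ.*-identityʳ (suc q)) (≡.sym (≡.trans (ℕ.*-identityˡ (suc (q ℕ.+ 0))) (≡.cong suc (ℕ.+-identityʳ q))))))))))

module _ (q : ℕ) .{{_ : NonTrivial (suc (suc q))}} {n} {Γ : Graph n (suc n)} {H} (P : Presentation q Γ H) (connected : Connected H) (tricyclic : Tricyclic H)
  (≇T : ¬ (H ≅ T₁C (suc (suc q)) (suc n ∸ 5) 0 0 0)) (ρ ρ′ : ℝ) where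

  -- If ρ ≤ ρ′ failed, then τ ≤ ρ′ ≤ ρ, so H ≅ T′ and ρ ≤ ρ′ after all; stability turns this
  -- refutation into a proof. If ρ and ρ′ are equal, τ ≤ ρ holds directly and gives the isomorphism.
  spectral-comparison : IsSpectralRadius (adjacencyMatrix (suc (suc q)) H) ρ →
    IsSpectralRadius (adjacencyMatrix (suc (suc q)) (T₁C (suc (suc q)) (suc n ∸ 6) 0 1 0)) ρ′ →
    (ρ ≤ℝ ρ′) × (ρ ≈ℝ ρ′ → H ≅ T₁C (suc (suc q)) (suc n ∸ 6) 0 1 0)
  spectral-comparison (0≤ρ , (μ , μ-eigen , ∣μ∣²≈ρ²) , _) (0≤ρ′ , _ , maximal′) =
    ρ≤ρ′ , λ ρ≈ρ′ → extremal⇒≅ (≤ℝ-trans {τ} {ρ′} {ρ} τ≤ρ′ (≈ℝ⇒≥ℝ {ρ} {ρ′} ρ≈ρ′))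
    where
    T′ : Hypergraph
    T′ = T₁C (suc (suc q)) (suc n ∸ 6) 0 1 0
    root : CharacteristicRoot ℝ-ordered q (n ∸ 5)
    root = characteristicRoot q (n ∸ 5)
    reach : ∀ r v → ∃[ i ] Graph.Reach Γ r i v
    reach = presentation-connected P connected
    1/[m-1] : ℚ
    1/[m-1] = weight (suc (suc q))
    eigenpair : ∃[ a ] ∃[ b ] ℝᵒ.EigenPair (ℝᵒ.adjacency H) (fromℚ 1/[m-1]) (re μ) (im μ) a b
    eigenpair = WeightedAdjacency.eigenvalue⇒pair 1/[m-1] H μ μ-eigen
    τ : ℝ
    τ = fromℚ 1/[m-1] *ℝ (CharacteristicRoot.w root +ℝ ℝᵒ.fromℕ q)
    τ≤ρ′ : τ ≤ℝ ρ′
    τ≤ρ′ = ℝᵒ.real-modulus-≤ τ ρ′ 0≤ρ′ (maximal′ (τ +i 0ℝ) (WeightedAdjacency.pair⇒eigenvalue 1/[m-1] T′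
      (ExtremalSpectrum.extremal-eigenpair ℝ-ordered q (suc n ∸ 6) root (fromℚ 1/[m-1]))))
    extremal⇒≅ : τ ≤ℝ ρ → H ≅ T′
    extremal⇒≅ τ≤ρ = extremal-≅ P (decidable-stable (extremal? Γ)
      (SpectralComparison.large-eigenvalue⇒extremal ℝ-ordered q Γ P reach (no-universal-vertex P tricyclic reach ≇T)
        root {ρ = ρ} ([m-1]*weight≈1 q) (proj₂ (proj₂ eigenpair)) ∣μ∣²≈ρ² τ≤ρ))
    ≅⇒≤ : H ≅ T′ → ρ ≤ℝ ρ′
    ≅⇒≤ iso = ℝᵒ.modulus-≤ ∣ μ ∣² ρ ρ′ 0≤ρ′ ∣μ∣²≈ρ² (maximal′ μ (WeightedAdjacency.pair⇒eigenvalue 1/[m-1] T′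
      (ℝᵒ.≅-eigenpair iso (proj₂ (proj₂ eigenpair)))))
    ρ≤ρ′ : ρ ≤ℝ ρ′
    ρ≤ρ′ = ≤ℝ-stable {ρ} {ρ′} λ ρ≰ρ′ → ρ≰ρ′ (≅⇒≤ (extremal⇒≅ (≤ℝ-trans {τ} {ρ′} {ρ} τ≤ρ′ (ℝᵒ.≰⇒≥ {ρ} {ρ′} ρ≰ρ′))))

-- H has n + sq vertices and s edges, so Type I reads n + sq + 1 = s(q + 1), that is, s = n + 1.
typeI-size : ∀ {q n s} {Γ : Graph n s} {H} → Presentation q Γ H → TypeI (suc (suc q)) H → s ≡ suc n × size H ≡ s
typeI-size {q} {n} {s} {H = H} P typeI = ≡.sym n+1≡s , ≡.sym (↔⇒≡ edges)
  where
  open Presentation P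
  order≡ : n ℕ.+ s ℕ.* q ≡ order H
  order≡ = ↔⇒≡ (inverse (sum↔ identity↔ product↔) ⨾ vertices)
  n+1≡s : suc n ≡ s
  n+1≡s = ℕ.+-cancelʳ-≡ (s ℕ.* q) (suc n) s (≡.trans (≡.cong suc order≡) (≡.trans (≡.sym (ℕ.+-comm (order H) 1))
    (≡.trans typeI (≡.trans (≡.cong (ℕ._* suc q) (≡.sym (↔⇒≡ edges))) (ℕ.*-suc s q)))))

graph-presentation : ∀ {q G H} → Uniform 2 G → H ≅ power (suc (suc q)) G → Σ (Graph (order G) (size G)) λ Γ → Presentation q Γ H
graph-presentation {q} {G} uniform iso =
  let Γ , represents = uniform-graph G uniform in Γ , presentation-≅ (≅-sym iso) (power-presentation G Γ represents)

by-size : ∀ {q} .{{_ : NonTrivial (suc (suc q))}} {n s k} {Γ : Graph n s} {H} → Presentation q Γ H → Connected H → Tricyclic H → s ≡ suc n → k ≡ suc n →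
  ¬ (H ≅ T₁C (suc (suc q)) (k ∸ 5) 0 0 0) → (ρ ρ′ : ℝ) →
  IsSpectralRadius (adjacencyMatrix (suc (suc q)) H) ρ →
  IsSpectralRadius (adjacencyMatrix (suc (suc q)) (T₁C (suc (suc q)) (k ∸ 6) 0 1 0)) ρ′ →
  (ρ ≤ℝ ρ′) × (ρ ≈ℝ ρ′ → H ≅ T₁C (suc (suc q)) (k ∸ 6) 0 1 0)
by-size {q} P connected tricyclic ≡.refl ≡.refl = spectral-comparison q P connected tricyclic

theorem5p1p2 : (m : ℕ) .{{_ : NonTrivial m}} (k : ℕ) (H : Hypergraph) →
    Uniform m H → Linear H → IsPowerOfGraph m H →
    Connected H → Tricyclic H → TypeI m H → size H ≡ k →
    ¬ (H ≅ T₁C m (k ∸ 5) 0 0 0) →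
    (ρ ρ′ : ℝ) →
    IsSpectralRadius (adjacencyMatrix m H) ρ →
    IsSpectralRadius (adjacencyMatrix m (T₁C m (k ∸ 6) 0 1 0)) ρ′ →
    (ρ ≤ℝ ρ′) × (ρ ≈ℝ ρ′ → H ≅ T₁C m (k ∸ 6) 0 1 0)
theorem5p1p2 (suc (suc q)) k H _ _ (G , uniform , iso) connected tricyclic typeI size≡k =
  let Γ , P = graph-presentation {q} {G} {H} uniform iso
      s≡1+n , size≡s = typeI-size P typeI
  in by-size {q} {k = k} {Γ = Γ} {H = H} P connected tricyclic s≡1+n (≡.trans (≡.sym size≡k) (≡.trans size≡s s≡1+n))
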